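{- Let $G$ be a graph with $n = |V(G)| \geq 64$ and $\Delta_E \leq d$. For any $\epsilon > 0$, there is a randomized algorithm which, given $V(G)$, $\epsilon$, and access to the Tripartite Independent Set (TIS) oracle of $G$, makes $\mathcal{O}\left( \frac{d^{2}\log^{18} n}{\epsilon^{4}} \right)$ TIS queries and, with probability at least $1-\frac{\mathcal{O}(1)}{n^{2}}$, outputs a number $\hat{t}$ with $|\hat{t} - t(G)| \leq \epsilon \cdot t(G)$.
   Context: For a graph $G$, $t(G)$ denotes the number of triangles of $G$. For an edge $(u,v)$, $\Delta_{(u,v)}$ is the number of triangles of $G$ containing the edge $(u,v)$, and $\Delta_E = \max_{(u,v)\in E(G)} \Delta_{(u,v)}$. For pairwise disjoint non-empty $A,B,C \subseteq V(G)$, $t(A,B,C)$ denotes the number of triangles of $G$ having exactly one vertex in each of $A$, $B$, $C$ (equivalently, the number of triangles of the tripartite subgraph $G(A,B,C)$, i.e., the subgraph induced on $A\cup B\cup C$ with all edges inside $A$, inside $B$, or inside $C$ removed). The TIS oracle takes three pairwise disjoint non-empty sets $V_1,V_2,V_3 \subseteq V(G)$ and answers YES if and only if $t(V_1,V_2,V_3) \neq 0$. The algorithm knows $V(G)$ but learns about edges only through TIS queries. -}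

module Defs where

open import Data.Nat as ℕ using (ℕ; zero; suc)
open import Data.Nat.Logarithm using (⌈log₂_⌉)
open import Data.Fin using (Fin; toℕ)
open import Data.Bool using (Bool; true; false; _∧_; if_then_else_)
open import Data.List using (List; map; foldr; allFin)
open import Data.Bool.ListAction using (any)
open import Data.Fin.Subset using (Subset; Nonempty; _∩_; ⊥)
open import Data.Fin.Subset.Properties using (_∈?_)
open import Data.Product using (_×_)
open import Data.Integer using (+_)
open import Data.Rational as ℚ using (ℚ; 0ℚ; 1ℚ; _/_; _≤ᵇ_; ∣_∣)
open import Relation.Nullary.Decidable using (⌊_⌋)
open import Relation.Binary.PropositionalEquality using (_≡_)

record Graph (n : ℕ) : Set where
  field
    adj    : Fin n → Fin n → Bool
    sym    : ∀ u v → adj u v ≡ adj v u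
    irrefl : ∀ u → adj u u ≡ false
open Graph public

sumFin : ∀ {n} → (Fin n → ℕ) → ℕ
sumFin {n} f = foldr ℕ._+_ 0 (map f (allFin n))

anyFin : ∀ {n} → (Fin n → Bool) → Bool
anyFin {n} f = any f (allFin n)

maxFin : ∀ {n} → (Fin n → ℕ) → ℕ
maxFin {n} f = foldr ℕ._⊔_ 0 (map f (allFin n))

sumFinℚ : ∀ {n} → (Fin n → ℚ) → ℚ
sumFinℚ {n} f = foldr ℚ._+_ 0ℚ (map f (allFin n))

ind : Bool → ℕ
ind true  = 1
ind false = 0

_<ᶠ_ : ∀ {n} → Fin n → Fin n → Bool
i <ᶠ j = toℕ i ℕ.<ᵇ toℕ j

isTri : ∀ {n} → Graph n → Fin n → Fin n → Fin n → Bool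
isTri G a b c = adj G a b ∧ adj G b c ∧ adj G a c

t : ∀ {n} → Graph n → ℕ
t G = sumFin λ i → sumFin λ j → sumFin λ k →
        ind ((i <ᶠ j) ∧ (j <ᶠ k) ∧ isTri G i j k)

Δedge : ∀ {n} → Graph n → Fin n → Fin n → ℕ
Δedge G u v = sumFin λ w → ind (adj G u w ∧ adj G v w)

ΔE≤ : ∀ {n} → Graph n → ℕ → Set
ΔE≤ G d = ∀ u v → adj G u v ≡ true → Δedge G u v ℕ.≤ d

ValidQuery : ∀ {n} → Subset n → Subset n → Subset n → Set
ValidQuery A B C =
  Nonempty A × Nonempty B × Nonempty C ×
  (A ∩ B ≡ ⊥) × (B ∩ C ≡ ⊥) × (A ∩ C ≡ ⊥)

TIS : ∀ {n} → Graph n → Subset n → Subset n → Subset n → Bool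
TIS G A B C = anyFin λ a → anyFin λ b → anyFin λ c →
  ⌊ a ∈? A ⌋ ∧ ⌊ b ∈? B ⌋ ∧ ⌊ c ∈? C ⌋ ∧ isTri G a b c

-- Randomized TIS-query algorithm on vertex set Fin n (knows V(G) only):
-- a finite tree of oracle queries, uniform random choices from
-- {0,…,k}, and rational outputs.
data Alg (n : ℕ) : Set where
  output : ℚ → Alg n
  query  : (A B C : Subset n) → ValidQuery A B C → (Bool → Alg n) → Alg n
  random : (k : ℕ) → (Fin (suc k) → Alg n) → Alg n

queries : ∀ {n} → Graph n → Alg n → ℕ
queries G (output _)          = 0
queries G (query A B C _ k)   = suc (queries G (k (TIS G A B C)))
queries G (random k f)        = maxFin λ i → queries G (f i)

prob : ∀ {n} → Graph n → (ℚ → Bool) → Alg n → ℚ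
prob G P (output x)        = if P x then 1ℚ else 0ℚ
prob G P (query A B C _ k) = prob G P (k (TIS G A B C))
prob G P (random k f)      = sumFinℚ (λ i → prob G P (f i)) ℚ.* (+ 1 / suc k)

ℕ→ℚ : ℕ → ℚ
ℕ→ℚ m = + m / 1

goodEstimate : ∀ {n} → ℚ → Graph n → ℚ → Bool
goodEstimate ε G x = ∣ x ℚ.- ℕ→ℚ (t G) ∣ ≤ᵇ ε ℚ.* ℕ→ℚ (t G)

-- log n (base 2, rounded up; base only affects the O-constant)
logn : ℕ → ℕ
logn n = ⌈log₂ n ⌉

-- Let S = 6 t(G) be the number of ordered triangles. By double counting, S is the sum over vertices a of the number
-- deg a of ordered edges in the link of a, and every link has maximum degree at most d. Given a guess T with S ≤ 2T,
-- deg a is cut at thresholds τ4^j into layers; the layer between lo and 4 lo is summed over a random set of vertices a of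
-- rate about D² lo / T, and there deg a is estimated from the edges of its link induced by random vertex sets of rate
-- √(τ/lo). The layer functions are Lipschitz, so only L¹ errors and variances are needed, and since links have bounded
-- degree the expected number of triangles in a sample is O(d D⁴), where D = O(log n / ε). All of them are listed by
-- binary search with the oracle. Cutting off expensive runs, Markov's inequality makes the estimate accurate to εT with
-- probability 63/64; a vote among O(log n) copies makes the failure probability polynomially small, and the guesses for
-- T are halved until the estimate confirms the guess.
module Submission where

open import Defs hiding (sym)
open import Data.Bool using (Bool; true; false; not; _∧_; _∨_; if_then_else_)
import Data.Bool as Bool
import Data.Bool.Properties as Bool
open import Data.Bool.ListAction using (any)
open import Data.Empty using (⊥; ⊥-elim)
open import Data.Fin using (Fin; toℕ)
import Data.Fin.Properties as Fin
open import Data.Fin.Subset using (Subset; _∈_; _∩_) renaming (⊥ to ∅)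
open import Data.Fin.Subset.Properties using (nonempty?; _∈?_; x∈p∩q⁻; Empty-unique)
import Data.Integer as ℤ
import Data.Integer.Properties as ℤ
open import Data.List using (List; []; _∷_; _++_; length; map; foldr; replicate; take; drop; lookup; allFin; cartesianProduct; cartesianProductWith)
open import Data.List.Properties using (map-++; map-tabulate; tabulate-lookup; take++drop≡id; length-map; length-replicate; length-tabulate; length-take; length-drop)
open import Data.List.Membership.DecPropositional using () renaming (_∈?_ to _∈ˡ?_)
open import Data.List.Membership.Propositional using () renaming (_∈_ to _∈ˡ_)
open import Data.List.Membership.Propositional.Properties using (∈-map⁺; ∈-allFin)
open import Data.List.Relation.Unary.All using (All; []; _∷_)
open import Data.List.Relation.Unary.Any using (here; there)
open import Data.Nat
open import Data.Nat.DivMod using (_/_; m/n*n≤m; m≡m%n+[m/n]*n; m%n<n)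
open import Data.Nat.Induction using (<-rec)
open import Data.Nat.ListAction using (sum)
open import Data.Nat.ListAction.Properties using (sum-++)
open import Data.Nat.Logarithm using (⌈log₂_⌉; ⌈log₂⌉-mono-≤; ⌈log₂⌈n/2⌉⌉≡⌈log₂n⌉∸1)
open import Data.Nat.Properties
open import Data.Nat.Tactic.RingSolver using (solve-∀)
open import Data.Product using (Σ; ∃; _×_; _,_; proj₁; proj₂)
open import Data.Rational as ℚ using (ℚ; mkℚ; 0ℚ; 1ℚ; toℚᵘ)
import Data.Rational.Properties as ℚ
open import Data.Rational.Solver using (module +-*-Solver)
open import Data.Rational.Unnormalised as ℚᵘ using (mkℚᵘ; *≡*; *≤*)
import Data.Rational.Unnormalised.Properties as ℚᵘ
open import Data.Sum using (_⊎_; inj₁; inj₂)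
open import Data.Vec using (tabulate)
open import Data.Vec.Properties using (≡-dec; lookup∘tabulate; []=⇒lookup; lookup⇒[]=)
open import Function using (_∘_)
open import Relation.Binary.Definitions using (tri<; tri≈; tri>)
open import Relation.Binary.PropositionalEquality using (_≡_; _≢_; refl; sym; trans; cong; cong₂; subst; subst₂; module ≡-Reasoning)
open import Relation.Nullary using (Dec; yes; no)
open import Relation.Nullary.Decidable using (⌊_⌋; _×-dec_)

-- The accuracy is a natural number E with 1 ≤ Eε ≤ 2; put L = ⌈log₂ n⌉, F = 12E, D = 576 F (L+1).
-- Each of the L+1 layers has expected error at most 9T/(2D), in total T/(128F), so the estimate and
-- its query count each fail with probability at most 1/128. The vote triples the error to 3T/F =
-- T/(4E), which is below S/E once T ≤ 2S. The test 4X ≥ 3T ensures this; failing it forces S < T,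
-- the invariant for the next guess T/2. Layers are needed because first vertices are sampled with a
-- variance proportional to the largest value: vertices with many triangles need a higher rate, but
-- their links tolerate sparser sampling. The same sets B and C serve all first vertices, so link
-- estimates are dependent; absolute errors are averaged, and their expectations add up regardless
-- of dependence. The 3L+1 guesses fail with probability at most (3L+1)/16^L ≤ 1/4^L ≤ 1/n². The
-- cost comes out of order d L^11 E^4 and is then relaxed to the stated form.

private variable
  n : ℕ
  A B C Out Out′ : Set

-- Finite sums and product probability spaces.

∑ : List A → (A → ℕ) → ℕ
∑ xs f = sum (map f xs)

∑-cong : ∀ (xs : List A) {f g : A → ℕ} → (∀ x → f x ≡ g x) → ∑ xs f ≡ ∑ xs g
∑-cong []       h = refl
∑-cong (x ∷ xs) h = cong₂ _+_ (h x) (∑-cong xs h)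

∑-mono : ∀ (xs : List A) {f g : A → ℕ} → (∀ x → f x ≤ g x) → ∑ xs f ≤ ∑ xs g
∑-mono []       h = z≤n
∑-mono (x ∷ xs) h = +-mono-≤ (h x) (∑-mono xs h)

∑-++ : ∀ (xs ys : List A) (f : A → ℕ) → ∑ (xs ++ ys) f ≡ ∑ xs f + ∑ ys f
∑-++ xs ys f = trans (cong sum (map-++ f xs ys)) (sum-++ (map f xs) (map f ys))

∑-map : ∀ (h : A → B) (xs : List A) (f : B → ℕ) → ∑ (map h xs) f ≡ ∑ xs λ x → f (h x)
∑-map h []       f = refl
∑-map h (x ∷ xs) f = cong (f (h x) +_) (∑-map h xs f)

∑-replicate : ∀ k (x : A) (f : A → ℕ) → ∑ (replicate k x) f ≡ k * f x
∑-replicate zero    x f = refl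
∑-replicate (suc k) x f = cong (f x +_) (∑-replicate k x f)

+-interchange : ∀ a b c d → (a + b) + (c + d) ≡ (a + c) + (b + d)
+-interchange = solve-∀

∑-+ : ∀ (xs : List A) (f g : A → ℕ) → (∑ xs λ x → f x + g x) ≡ ∑ xs f + ∑ xs g
∑-+ []       f g = refl
∑-+ (x ∷ xs) f g = trans (cong (f x + g x +_) (∑-+ xs f g)) (+-interchange (f x) (g x) _ _)

∑-*ˡ : ∀ (xs : List A) c (f : A → ℕ) → (∑ xs λ x → c * f x) ≡ c * ∑ xs f
∑-*ˡ []       c f = sym (*-zeroʳ c)
∑-*ˡ (x ∷ xs) c f = trans (cong (c * f x +_) (∑-*ˡ xs c f)) (sym (*-distribˡ-+ c (f x) _))

∑-const : ∀ (xs : List A) c → (∑ xs λ _ → c) ≡ length xs * c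
∑-const []       c = refl
∑-const (x ∷ xs) c = cong (c +_) (∑-const xs c)

∑-zero : ∀ (xs : List A) → (∑ xs λ _ → 0) ≡ 0
∑-zero xs = trans (∑-const xs 0) (*-zeroʳ (length xs))

∑-swap : ∀ (xs : List A) (ys : List B) (f : A → B → ℕ) →
         (∑ xs λ x → ∑ ys λ y → f x y) ≡ (∑ ys λ y → ∑ xs λ x → f x y)
∑-swap []       ys f = sym (∑-zero ys)
∑-swap (x ∷ xs) ys f =
  trans (cong (∑ ys (f x) +_) (∑-swap xs ys f)) (sym (∑-+ ys (f x) λ y → ∑ xs λ x → f x y))

∑-cartesianProductWith : ∀ (h : A → B → C) xs ys (f : C → ℕ) →
  ∑ (cartesianProductWith h xs ys) f ≡ ∑ xs λ x → ∑ ys λ y → f (h x y)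
∑-cartesianProductWith h []       ys f = refl
∑-cartesianProductWith h (x ∷ xs) ys f =
  trans (∑-++ (map (h x) ys) _ f) (cong₂ _+_ (∑-map (h x) ys f) (∑-cartesianProductWith h xs ys f))

abs-+ : ∀ a b c d → ∣ (a + b) - (c + d) ∣ ≤ ∣ a - c ∣ + ∣ b - d ∣
abs-+ a b c d = ≤-trans (∣-∣-triangle (a + b) (c + b) (c + d))
  (≤-reflexive (cong₂ _+_ (trans (cong₂ ∣_-_∣ (+-comm a b) (+-comm c b)) (∣m+n-m+o∣≡∣n-o∣ b a c))
                          (∣m+n-m+o∣≡∣n-o∣ c b d)))

∑-abs : ∀ (xs : List A) (f g : A → ℕ) → ∣ ∑ xs f - ∑ xs g ∣ ≤ ∑ xs λ x → ∣ f x - g x ∣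
∑-abs []       f g = z≤n
∑-abs (x ∷ xs) f g = ≤-trans (abs-+ (f x) (∑ xs f) (g x) (∑ xs g)) (+-monoʳ-≤ ∣ f x - g x ∣ (∑-abs xs f g))

∑-square-≤ : ∀ (xs : List A) (f : A → ℕ) {d} → (∀ x → f x ≤ d) → (∑ xs λ x → f x * f x) ≤ d * ∑ xs f
∑-square-≤ xs f {d} f≤d = ≤-trans (∑-mono xs λ x → *-monoˡ-≤ (f x) (f≤d x)) (≤-reflexive (∑-*ˡ xs d f))

length-cartesianProductWith : ∀ (h : A → B → C) xs ys →
  length (cartesianProductWith h xs ys) ≡ length xs * length ys
length-cartesianProductWith h xs ys = trans (sym (length≡∑1 (cartesianProductWith h xs ys)))
  (trans (∑-cartesianProductWith h xs ys (λ _ → 1))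
  (trans (∑-cong xs λ _ → length≡∑1 ys) (∑-const xs (length ys))))
  where
  length≡∑1 : ∀ {A : Set} (xs : List A) → (∑ xs λ _ → 1) ≡ length xs
  length≡∑1 xs = trans (∑-const xs 1) (*-identityʳ _)

-- Lists of outcomes serve as uniform probability spaces, with expectations scaled by the length of the list; this is
-- the product space.
sequences : List (List A) → List (List A)
sequences []         = [] ∷ []
sequences (xs ∷ xss) = cartesianProductWith _∷_ xs (sequences xss)

∑-sequences : ∀ xs (xss : List (List A)) f →
  ∑ (sequences (xs ∷ xss)) f ≡ ∑ xs λ x → ∑ (sequences xss) λ ys → f (x ∷ ys)
∑-sequences xs xss f = ∑-cartesianProductWith _∷_ xs (sequences xss) f

length-sequences : ∀ xs (xss : List (List A)) →
  length (sequences (xs ∷ xss)) ≡ length xs * length (sequences xss)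
length-sequences xs xss = length-cartesianProductWith _∷_ xs (sequences xss)

-- Random masks: first and second moments.

-- The expansion of (x - y)², with the cross term moved to the left because subtraction is
-- truncated. It yields both the AM-GM inequality and the variance formula.
x²+y²≡∣x-y∣²+2xy : ∀ x y → ∣ x - y ∣ * ∣ x - y ∣ + 2 * (x * y) ≡ x * x + y * y
x²+y²≡∣x-y∣²+2xy x y with ≤-total x y
... | inj₁ x≤y with m≤n⇒∃[o]m+o≡n x≤y
... | o , refl rewrite ∣m-m+n∣≡n x o = lem x o
  where
  lem : ∀ x o → o * o + 2 * (x * (x + o)) ≡ x * x + (x + o) * (x + o)
  lem = solve-∀
x²+y²≡∣x-y∣²+2xy x y | inj₂ y≤x with m≤n⇒∃[o]m+o≡n y≤x
... | o , refl rewrite ∣-∣-comm (y + o) y | ∣m-m+n∣≡n y o = lem y o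
  where
  lem : ∀ y o → o * o + 2 * ((y + o) * y) ≡ (y + o) * (y + o) + y * y
  lem = solve-∀

2xy≤x²+y² : ∀ x y → 2 * (x * y) ≤ x * x + y * y
2xy≤x²+y² x y = ≤-trans (m≤n+m (2 * (x * y)) (∣ x - y ∣ * ∣ x - y ∣)) (≤-reflexive (x²+y²≡∣x-y∣²+2xy x y))

-- With one true against p falses, every position is kept independently with probability 1 / (1 + p).
masks : ℕ → ℕ → List (List Bool)
masks p k = sequences (replicate k (true ∷ replicate p false))

select : List Bool → List A → List A
select []          xs       = []
select (_ ∷ _)     []       = []
select (true ∷ m)  (x ∷ xs) = x ∷ select m xs
select (false ∷ m) (x ∷ xs) = select m xs

length-select : ∀ m (xs : List A) → length (select m xs) ≤ length xs
length-select []          xs       = z≤n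
length-select (_ ∷ _)     []       = z≤n
length-select (true ∷ m)  (x ∷ xs) = s≤s (length-select m xs)
length-select (false ∷ m) (x ∷ xs) = m≤n⇒m≤1+n (length-select m xs)

∑-masks : ∀ p k (f : List Bool → ℕ) →
  ∑ (masks p (suc k)) f ≡ ∑ (masks p k) (λ m → f (true ∷ m)) + p * ∑ (masks p k) (λ m → f (false ∷ m))
∑-masks p k f = trans (∑-sequences (true ∷ replicate p false) (replicate k (true ∷ replicate p false)) f)
  (cong (∑ (masks p k) (λ m → f (true ∷ m)) +_) (∑-replicate p false λ b → ∑ (masks p k) λ m → f (b ∷ m)))

length-masks : ∀ p k → length (masks p (suc k)) ≡ suc p * length (masks p k)
length-masks p k = trans (length-sequences (true ∷ replicate p false) (replicate k (true ∷ replicate p false)))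
  (cong (λ l → suc l * length (masks p k)) (length-replicate p))

-- Inverse-probability weighting: an entry survives with probability 1/(1+p), so scaling the sampled
-- sum by 1+p makes it unbiased.
∑-mask-first-moment : ∀ p (xs : List A) (w : A → ℕ) →
  (∑ (masks p (length xs)) λ m → suc p * ∑ (select m xs) w) ≡ length (masks p (length xs)) * ∑ xs w
∑-mask-first-moment p []       w = cong (_+ 0) (*-zeroʳ p)
∑-mask-first-moment p (x ∷ xs) w = begin
  (∑ (masks p (suc (length xs))) λ m → suc p * ∑ (select m (x ∷ xs)) w)
    ≡⟨ ∑-masks p (length xs) _ ⟩
  (∑ M λ m → suc p * (w x + Y m)) + p * (∑ M λ m → suc p * Y m)
    ≡⟨ cong (_+ p * (∑ M λ m → suc p * Y m)) (trans (∑-cong M λ m → *-distribˡ-+ (suc p) (w x) (Y m)) (trans (∑-+ M _ _) (cong (_+ (∑ M λ m → suc p * Y m)) (∑-const M _)))) ⟩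
  N * (suc p * w x) + (∑ M λ m → suc p * Y m) + p * (∑ M λ m → suc p * Y m)
    ≡⟨ cong (λ z → N * (suc p * w x) + z + p * z) (∑-mask-first-moment p xs w) ⟩
  N * (suc p * w x) + N * ∑ xs w + p * (N * ∑ xs w)
    ≡⟨ lem N p (w x) (∑ xs w) ⟩
  (suc p * N) * (w x + ∑ xs w)
    ≡⟨ cong (_* (w x + ∑ xs w)) (sym (length-masks p (length xs))) ⟩
  length (masks p (suc (length xs))) * (w x + ∑ xs w) ∎
  where
  open ≡-Reasoning
  M = masks p (length xs)
  N = length M
  Y : List Bool → ℕ
  Y m = ∑ (select m xs) w
  lem : ∀ N p a s → N * (suc p * a) + N * s + p * (N * s) ≡ (suc p * N) * (a + s)
  lem = solve-∀

-- Distinct entries are kept independently and only contribute to the squared mean. On the diagonal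
-- an entry gives (1+p) w², which is its w² in the squared mean plus a variance of p w².
∑-mask-second-moment : ∀ p (xs : List A) (w : A → ℕ) →
  (∑ (masks p (length xs)) λ m → (suc p * ∑ (select m xs) w) * (suc p * ∑ (select m xs) w))
  ≡ length (masks p (length xs)) * (∑ xs w * ∑ xs w + p * ∑ xs λ x → w x * w x)
∑-mask-second-moment p []       w = trans (cong (λ z → z * z + 0) (*-zeroʳ p)) (sym (cong (_+ 0) (*-zeroʳ p)))
∑-mask-second-moment p (x ∷ xs) w = begin
  (∑ (masks p (suc (length xs))) λ m → (suc p * ∑ (select m (x ∷ xs)) w) * (suc p * ∑ (select m (x ∷ xs)) w))
    ≡⟨ ∑-masks p (length xs) _ ⟩
  (∑ M λ m → (suc p * (w x + Y m)) * (suc p * (w x + Y m))) + p * V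
    ≡⟨ cong (_+ p * V) (trans (∑-cong M λ m → expand p (w x) (Y m)) (trans (∑-+ M _ _) (cong₂ _+_ (∑-const M _) (trans (∑-+ M _ _) (cong (_+ V) (∑-*ˡ M (2 * (suc p * w x)) λ m → suc p * Y m)))))) ⟩
  N * (suc p * w x * (suc p * w x)) + (2 * (suc p * w x) * (∑ M λ m → suc p * Y m) + V) + p * V
    ≡⟨ cong₂ (λ u v → N * (suc p * w x * (suc p * w x)) + (2 * (suc p * w x) * u + v) + p * v) (∑-mask-first-moment p xs w) (∑-mask-second-moment p xs w) ⟩
  N * (suc p * w x * (suc p * w x)) + (2 * (suc p * w x) * (N * s) + N * (s * s + p * q)) + p * (N * (s * s + p * q))
    ≡⟨ lem N p (w x) s q ⟩
  (suc p * N) * ((w x + s) * (w x + s) + p * (w x * w x + q))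
    ≡⟨ cong (_* ((w x + s) * (w x + s) + p * (w x * w x + q))) (sym (length-masks p (length xs))) ⟩
  length (masks p (suc (length xs))) * ((w x + s) * (w x + s) + p * (w x * w x + q)) ∎
  where
  open ≡-Reasoning
  M = masks p (length xs)
  N = length M
  s = ∑ xs w
  q = ∑ xs λ x → w x * w x
  Y : List Bool → ℕ
  Y m = ∑ (select m xs) w
  V = ∑ M λ m → (suc p * Y m) * (suc p * Y m)
  expand : ∀ p a y → (suc p * (a + y)) * (suc p * (a + y)) ≡ suc p * a * (suc p * a) + (2 * (suc p * a) * (suc p * y) + suc p * y * (suc p * y))
  expand = solve-∀
  lem : ∀ N p a s q → N * (suc p * a * (suc p * a)) + (2 * (suc p * a) * (N * s) + N * (s * s + p * q)) + p * (N * (s * s + p * q))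
      ≡ (suc p * N) * ((a + s) * (a + s) + p * (a * a + q))
  lem = solve-∀

-- The usual E(X - m)² = E X² - m²; the cross term 2m E X is added to both sides to stay within the
-- natural numbers.
∑-variance : ∀ (Ω : List A) (X : A → ℕ) m v →
  (∑ Ω X) ≡ length Ω * m → (∑ Ω λ ω → X ω * X ω) ≡ length Ω * (m * m + v) →
  (∑ Ω λ ω → ∣ X ω - m ∣ * ∣ X ω - m ∣) ≡ length Ω * v
∑-variance Ω X m v mean second = +-cancelʳ-≡ (2 * (length Ω * m * m)) _ _ (begin
  (∑ Ω λ ω → ∣ X ω - m ∣ * ∣ X ω - m ∣) + 2 * (length Ω * m * m)
    ≡⟨ cong (λ z → (∑ Ω λ ω → ∣ X ω - m ∣ * ∣ X ω - m ∣) + z) (trans (cong (λ z → 2 * (z * m)) (sym mean)) (lem₁ (∑ Ω X) m)) ⟩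
  (∑ Ω λ ω → ∣ X ω - m ∣ * ∣ X ω - m ∣) + 2 * m * ∑ Ω X
    ≡⟨ cong ((∑ Ω λ ω → ∣ X ω - m ∣ * ∣ X ω - m ∣) +_) (sym (∑-*ˡ Ω (2 * m) X)) ⟩
  (∑ Ω λ ω → ∣ X ω - m ∣ * ∣ X ω - m ∣) + (∑ Ω λ ω → 2 * m * X ω)
    ≡⟨ sym (∑-+ Ω _ _) ⟩
  (∑ Ω λ ω → ∣ X ω - m ∣ * ∣ X ω - m ∣ + 2 * m * X ω)
    ≡⟨ ∑-cong Ω (λ ω → trans (cong (∣ X ω - m ∣ * ∣ X ω - m ∣ +_) (lem₂ m (X ω))) (x²+y²≡∣x-y∣²+2xy (X ω) m)) ⟩
  (∑ Ω λ ω → X ω * X ω + m * m)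
    ≡⟨ ∑-+ Ω _ _ ⟩
  (∑ Ω λ ω → X ω * X ω) + (∑ Ω λ ω → m * m)
    ≡⟨ cong₂ _+_ second (∑-const Ω (m * m)) ⟩
  length Ω * (m * m + v) + length Ω * (m * m)
    ≡⟨ lem₃ (length Ω) m v ⟩
  length Ω * v + 2 * (length Ω * m * m) ∎)
  where
  open ≡-Reasoning
  lem₁ : ∀ x m → 2 * (x * m) ≡ 2 * m * x
  lem₁ = solve-∀
  lem₂ : ∀ m x → 2 * m * x ≡ 2 * (x * m)
  lem₂ = solve-∀
  lem₃ : ∀ N m v → N * (m * m + v) + N * (m * m) ≡ N * v + 2 * (N * m * m)
  lem₃ = solve-∀

-- Estimating the number of edges of one link.

-- In the application `e` is the adjacency of the link of a fixed vertex and `m` its number of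
-- ordered edges. Rows and columns are thinned by independent masks, so the link is treated as a
-- bipartite graph.
module Link (vs : List A) (e : A → A → ℕ) (q : ℕ) where

  Ω : List (List Bool)
  Ω = masks q (length vs)

  N m rows² cols² : ℕ
  N = length Ω
  m = ∑ vs λ b → ∑ vs λ c → e b c
  rows² = ∑ vs λ b → ∑ vs (e b) * ∑ vs (e b)
  cols² = ∑ vs λ c → (∑ vs λ b → e b c) * (∑ vs λ b → e b c)

  cells² : ℕ
  cells² = ∑ vs λ c → ∑ vs λ b → e b c * e b c

  count : List Bool → List Bool → ℕ
  count B C = ∑ (select B vs) λ b → ∑ (select C vs) λ c → e b c

  scaled : List Bool → List Bool → ℕ
  scaled B C = (suc q * suc q) * count B C

  private
    column : List Bool → A → ℕ
    column B c = ∑ (select B vs) λ b → e b c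

    scaled-columns : ∀ B C → scaled B C ≡ suc q * ∑ (select C vs) λ c → suc q * column B c
    scaled-columns B C = begin
      suc q * suc q * count B C ≡⟨ *-assoc (suc q) (suc q) (count B C) ⟩
      suc q * (suc q * count B C) ≡⟨ cong (λ z → suc q * (suc q * z)) (∑-swap (select B vs) (select C vs) e) ⟩
      suc q * (suc q * ∑ (select C vs) (column B)) ≡⟨ cong (suc q *_) (sym (∑-*ˡ (select C vs) (suc q) (column B))) ⟩
      suc q * (∑ (select C vs) λ c → suc q * column B c) ∎
      where open ≡-Reasoning

    total-columns : ∀ B → (∑ vs λ c → suc q * column B c) ≡ suc q * ∑ (select B vs) λ b → ∑ vs (e b)
    total-columns B = trans (∑-*ˡ vs (suc q) (column B)) (cong (suc q *_) (∑-swap vs (select B vs) λ c b → e b c))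

  scaled-mean : (∑ Ω λ B → ∑ Ω λ C → scaled B C) ≡ N * N * m
  scaled-mean = begin
    (∑ Ω λ B → ∑ Ω λ C → scaled B C)
      ≡⟨ ∑-cong Ω (λ B → trans (∑-cong Ω (scaled-columns B)) (trans (∑-mask-first-moment q vs λ c → suc q * column B c) (cong (N *_) (total-columns B)))) ⟩
    (∑ Ω λ B → N * (suc q * ∑ (select B vs) λ b → ∑ vs (e b)))
      ≡⟨ ∑-*ˡ Ω N _ ⟩
    N * (∑ Ω λ B → suc q * ∑ (select B vs) λ b → ∑ vs (e b))
      ≡⟨ cong (N *_) (∑-mask-first-moment q vs λ b → ∑ vs (e b)) ⟩
    N * (N * m)
      ≡⟨ sym (*-assoc N N m) ⟩
    N * N * m ∎
    where open ≡-Reasoning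

  -- For fixed `B` this is a second moment over the columns, and the mean of the squared columns is
  -- again a second moment, over `B`. The variance terms come from pairs of entries in the same row,
  -- in the same column, and in the same cell.
  scaled-second-moment : (∑ Ω λ B → ∑ Ω λ C → scaled B C * scaled B C)
    ≡ N * N * (m * m + (q * rows² + q * (cols² + q * cells²)))
  scaled-second-moment = begin
    (∑ Ω λ B → ∑ Ω λ C → scaled B C * scaled B C)
      ≡⟨ ∑-cong Ω (λ B → trans (∑-cong Ω λ C → cong (λ z → z * z) (scaled-columns B C))
                        (trans (∑-mask-second-moment q vs λ c → suc q * column B c)
                               (cong (λ z → N * (z * z + q * squares B)) (total-columns B)))) ⟩
    (∑ Ω λ B → N * (X B * X B + q * squares B))
      ≡⟨ trans (∑-*ˡ Ω N _) (cong (N *_) (trans (∑-+ Ω (λ B → X B * X B) λ B → q * squares B)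
           (cong₂ _+_ (∑-mask-second-moment q vs λ b → ∑ vs (e b)) (∑-*ˡ Ω q squares)))) ⟩
    N * (N * (m * m + q * rows²) + q * ∑ Ω squares)
      ≡⟨ cong (λ z → N * (N * (m * m + q * rows²) + q * z)) ∑-squares ⟩
    N * (N * (m * m + q * rows²) + q * (N * (cols² + q * cells²)))
      ≡⟨ lem N q (m * m) rows² (cols² + q * cells²) ⟩
    N * N * (m * m + (q * rows² + q * (cols² + q * cells²))) ∎
    where
    open ≡-Reasoning
    X squares : List Bool → ℕ
    X B = suc q * ∑ (select B vs) λ b → ∑ vs (e b)
    squares B = ∑ vs λ c → (suc q * column B c) * (suc q * column B c)
    ∑-squares : ∑ Ω squares ≡ N * (cols² + q * cells²)
    ∑-squares = begin
      ∑ Ω squares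
        ≡⟨ ∑-swap Ω vs (λ B c → (suc q * column B c) * (suc q * column B c)) ⟩
      (∑ vs λ c → ∑ Ω λ B → (suc q * column B c) * (suc q * column B c))
        ≡⟨ ∑-cong vs (λ c → ∑-mask-second-moment q vs λ b → e b c) ⟩
      (∑ vs λ c → N * (k c * k c + q * ∑ vs λ b → e b c * e b c))
        ≡⟨ ∑-*ˡ vs N _ ⟩
      N * (∑ vs λ c → k c * k c + q * ∑ vs λ b → e b c * e b c)
        ≡⟨ cong (N *_) (trans (∑-+ vs _ _) (cong (cols² +_) (∑-*ˡ vs q λ c → ∑ vs λ b → e b c * e b c))) ⟩
      N * (cols² + q * cells²) ∎
      where
      k : A → ℕ
      k c = ∑ vs λ b → e b c
    lem : ∀ N q a r s → N * (N * (a + q * r) + q * (N * s)) ≡ N * N * (a + (q * r + q * s))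
    lem = solve-∀

  module _ {d} (row≤ : ∀ b → ∑ vs (e b) ≤ d) (col≤ : ∀ c → (∑ vs λ b → e b c) ≤ d) (e≤1 : ∀ b c → e b c ≤ 1) where

    -- The degree bound makes `rows²` and `cols²` at most `d * m`, and 0/1 entries make `cells²` at
    -- most `m`. The variance is therefore linear in `m`, so that it can be summed over all
    -- vertices.
    scaled-variance : (∑ Ω λ B → ∑ Ω λ C → ∣ scaled B C - m ∣ * ∣ scaled B C - m ∣)
      ≤ N * N * (m * (q * q + 2 * (d * q)))
    scaled-variance = begin
      (∑ Ω λ B → ∑ Ω λ C → ∣ scaled B C - m ∣ * ∣ scaled B C - m ∣)
        ≡⟨ sym (∑-cartesianProductWith _,_ Ω Ω λ (B , C) → ∣ scaled B C - m ∣ * ∣ scaled B C - m ∣) ⟩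
      (∑ Ω² λ (B , C) → ∣ scaled B C - m ∣ * ∣ scaled B C - m ∣)
        ≡⟨ ∑-variance Ω² (λ (B , C) → scaled B C) m v
             (trans (∑-cartesianProductWith _,_ Ω Ω λ (B , C) → scaled B C) (trans scaled-mean (cong (_* m) N²)))
             (trans (∑-cartesianProductWith _,_ Ω Ω λ (B , C) → scaled B C * scaled B C) (trans scaled-second-moment (cong (_* (m * m + v)) N²))) ⟩
      length Ω² * v
        ≡⟨ cong (_* v) (sym N²) ⟩
      N * N * (q * rows² + q * (cols² + q * cells²))
        ≤⟨ *-monoʳ-≤ (N * N) (+-mono-≤ (*-monoʳ-≤ q rows²≤) (*-monoʳ-≤ q (+-mono-≤ cols²≤ (*-monoʳ-≤ q cells²≤)))) ⟩
      N * N * (q * (d * m) + q * (d * m + q * m))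
        ≡⟨ cong (N * N *_) (lem q d m) ⟩
      N * N * (m * (q * q + 2 * (d * q))) ∎
      where
      open ≤-Reasoning
      Ω² = cartesianProduct Ω Ω
      v = q * rows² + q * (cols² + q * cells²)
      N² : N * N ≡ length Ω²
      N² = sym (length-cartesianProductWith _,_ Ω Ω)
      m′ : (∑ vs λ c → ∑ vs λ b → e b c) ≡ m
      m′ = sym (∑-swap vs vs e)
      rows²≤ : rows² ≤ d * m
      rows²≤ = ∑-square-≤ vs (λ b → ∑ vs (e b)) row≤
      cols²≤ : cols² ≤ d * m
      cols²≤ = ≤-trans (∑-square-≤ vs (λ c → ∑ vs λ b → e b c) col≤) (≤-reflexive (cong (d *_) m′))
      cells²≤ : cells² ≤ m
      cells²≤ = ≤-trans (∑-mono vs λ c → ∑-mono vs λ b → ≤-trans (*-monoˡ-≤ (e b c) (e≤1 b c)) (≤-reflexive (*-identityˡ _))) (≤-reflexive m′)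
      lem : ∀ q d m → q * (d * m) + q * (d * m + q * m) ≡ m * (q * q + 2 * (d * q))
      lem = solve-∀

-- Layer functions and their expected error.

-- For lo ≤ hi, the length of the part of the interval [0, x] inside [lo, hi]; consecutive layers
-- add up.
clip : ℕ → ℕ → ℕ → ℕ
clip lo hi x = (x ⊓ hi) ∸ lo

clip≤ : ∀ lo hi x → clip lo hi x ≤ x
clip≤ lo hi x = ≤-trans (m∸n≤m (x ⊓ hi) lo) (m⊓n≤m x hi)

clip≤hi : ∀ lo hi x → clip lo hi x ≤ hi
clip≤hi lo hi x = ≤-trans (m∸n≤m (x ⊓ hi) lo) (m⊓n≤n x hi)

clip-mono : ∀ lo hi {x y} → x ≤ y → clip lo hi x ≤ clip lo hi y
clip-mono lo hi x≤y = ∸-monoˡ-≤ lo (⊓-monoˡ-≤ hi x≤y)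

clip-glue : ∀ {lo mid hi} x → lo ≤ mid → mid ≤ hi → clip lo mid x + clip mid hi x ≡ clip lo hi x
clip-glue {lo} {mid} {hi} x lo≤mid mid≤hi with ≤-total x mid
... | inj₁ x≤mid rewrite m≤n⇒m⊓n≡m x≤mid | m≤n⇒m⊓n≡m (≤-trans x≤mid mid≤hi) | m≤n⇒m∸n≡0 x≤mid = +-identityʳ _
... | inj₂ mid≤x rewrite m≥n⇒m⊓n≡n mid≤x = begin
  (mid ∸ lo) + (x ⊓ hi ∸ mid) ≡⟨ sym (+-∸-comm (x ⊓ hi ∸ mid) lo≤mid) ⟩
  mid + (x ⊓ hi ∸ mid) ∸ lo   ≡⟨ cong (_∸ lo) (m+[n∸m]≡n (⊓-glb mid≤x mid≤hi)) ⟩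
  x ⊓ hi ∸ lo                 ∎
  where open ≡-Reasoning

clip-lipschitz-≤ : ∀ {lo hi x y} → x ≤ y → ∣ clip lo hi x - clip lo hi y ∣ ≤ ∣ x - y ∣
clip-lipschitz-≤ {lo} {hi} {x} {y} x≤y rewrite m≤n⇒∣m-n∣≡n∸m (clip-mono lo hi x≤y) | m≤n⇒∣m-n∣≡n∸m x≤y =
    m≤n+o⇒m∸n≤o (clip lo hi y) (clip lo hi x) (begin
      (y ⊓ hi) ∸ lo                ≤⟨ ∸-monoˡ-≤ lo y⊓hi≤ ⟩
      ((x ⊓ hi) + (y ∸ x)) ∸ lo    ≤⟨ m≤n+o⇒m∸n≤o _ lo (≤-trans (+-monoˡ-≤ (y ∸ x) (m≤n+m∸n (x ⊓ hi) lo)) (≤-reflexive (+-assoc lo _ _))) ⟩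
      clip lo hi x + (y ∸ x)       ∎)
    where
    open ≤-Reasoning
    y⊓hi≤ : y ⊓ hi ≤ (x ⊓ hi) + (y ∸ x)
    y⊓hi≤ with ≤-total x hi
    ... | inj₁ x≤hi rewrite m≤n⇒m⊓n≡m x≤hi = ≤-trans (m⊓n≤m y hi) (≤-reflexive (sym (m+[n∸m]≡n x≤y)))
    ... | inj₂ hi≤x rewrite m≥n⇒m⊓n≡n hi≤x = ≤-trans (m⊓n≤n y hi) (m≤m+n hi (y ∸ x))

clip-lipschitz : ∀ lo hi x y → ∣ clip lo hi x - clip lo hi y ∣ ≤ ∣ x - y ∣
clip-lipschitz lo hi x y with ≤-total x y
... | inj₁ x≤y = clip-lipschitz-≤ {lo} {hi} x≤y
... | inj₂ y≤x = begin
  ∣ clip lo hi x - clip lo hi y ∣ ≡⟨ ∣-∣-comm (clip lo hi x) (clip lo hi y) ⟩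
  ∣ clip lo hi y - clip lo hi x ∣ ≤⟨ clip-lipschitz-≤ {lo} {hi} y≤x ⟩
  ∣ y - x ∣                       ≡⟨ ∣-∣-comm y x ⟩
  ∣ x - y ∣                       ∎
  where open ≤-Reasoning

clip-below : ∀ lo hi {x} → x ≤ lo → clip lo hi x ≡ 0
clip-below lo hi {x} x≤lo = m≤n⇒m∸n≡0 (≤-trans (m⊓n≤m x hi) x≤lo)

-- The case t ≤ lo/2 and x ≥ lo, with lo = 2t + w and x = lo + u. The clipped value is at most u,
-- while the error of x is (t + w) + u, and expanding its square dominates 2u lo.
clip-error-above : ∀ D hi t w u → 1 ≤ D →
  2 * D * (2 * t + w) * clip (2 * t + w) hi (2 * t + w + u) ≤ D * D * (∣ 2 * t + w + u - t ∣ * ∣ 2 * t + w + u - t ∣)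
clip-error-above D hi t w u 1≤D = begin
  2 * D * lo * clip lo hi (lo + u) ≤⟨ *-monoʳ-≤ (2 * D * lo) (≤-trans (∸-monoˡ-≤ lo (m⊓n≤m (lo + u) hi)) (≤-reflexive (m+n∸m≡n lo u))) ⟩
  2 * D * lo * u                   ≡⟨ lem₁ D t w u ⟩
  D * (2 * (u * (t + w)) + 2 * (u * t)) ≤⟨ *-monoʳ-≤ D (+-monoʳ-≤ (2 * (u * (t + w))) (*-monoʳ-≤ 2 (*-monoʳ-≤ u (m≤m+n t w)))) ⟩
  D * (2 * (u * (t + w)) + 2 * (u * (t + w))) ≤⟨ *-monoʳ-≤ D (+-monoʳ-≤ (2 * (u * (t + w))) (2xy≤x²+y² u (t + w))) ⟩
  D * (2 * (u * (t + w)) + (u * u + (t + w) * (t + w))) ≡⟨ lem₂ D t w u ⟩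
  D * (z * z)                      ≤⟨ *-monoˡ-≤ (z * z) D≤D² ⟩
  D * D * (z * z)                  ≡⟨ cong (λ y → D * D * (y * y)) (sym y≡z) ⟩
  D * D * (∣ lo + u - t ∣ * ∣ lo + u - t ∣) ∎
  where
  open ≤-Reasoning
  lo = 2 * t + w
  z = t + w + u
  D≤D² : D ≤ D * D
  D≤D² = ≤-trans (≤-reflexive (sym (*-identityʳ D))) (*-monoʳ-≤ D 1≤D)
  lem₀ : ∀ t w u → 2 * t + w + u ≡ t + (t + w + u)
  lem₀ = solve-∀
  y≡z : ∣ lo + u - t ∣ ≡ z
  y≡z = trans (cong (∣_- t ∣) (lem₀ t w u)) (trans (∣-∣-comm (t + z) t) (∣m-m+n∣≡n t z))
  lem₁ : ∀ D t w u → 2 * D * (2 * t + w) * u ≡ D * (2 * (u * (t + w)) + 2 * (u * t))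
  lem₁ = solve-∀
  lem₂ : ∀ D t w u → D * (2 * (u * (t + w)) + (u * u + (t + w) * (t + w))) ≡ D * ((t + w + u) * (t + w + u))
  lem₂ = solve-∀

-- Bounding the error by a square is what allows it to be averaged using only the variance of x; the term in t
-- alone is tolerable because every t is counted once per level.
clip-error : ∀ D lo hi x t → 1 ≤ D →
  2 * D * lo * ∣ clip lo hi x - clip lo hi t ∣ ≤ 2 * lo * t + D * D * (∣ x - t ∣ * ∣ x - t ∣)
clip-error D lo hi x t 1≤D with ≤-total lo (2 * t)
... | inj₁ lo≤2t = begin
  2 * D * lo * ∣ clip lo hi x - clip lo hi t ∣ ≤⟨ *-monoʳ-≤ (2 * D * lo) (clip-lipschitz lo hi x t) ⟩
  2 * D * lo * y               ≡⟨ lem₁ D lo y ⟩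
  2 * (lo * (D * y))           ≤⟨ 2xy≤x²+y² lo (D * y) ⟩
  -- AM-GM leaves lo², which 2t ≥ lo charges to `t`.
  lo * lo + D * y * (D * y)    ≤⟨ +-monoˡ-≤ _ (*-monoʳ-≤ lo lo≤2t) ⟩
  lo * (2 * t) + D * y * (D * y) ≡⟨ lem₂ D lo y t ⟩
  2 * lo * t + D * D * (y * y) ∎
  where
  open ≤-Reasoning
  y = ∣ x - t ∣
  lem₁ : ∀ D lo y → 2 * D * lo * y ≡ 2 * (lo * (D * y))
  lem₁ = solve-∀
  lem₂ : ∀ D lo y t → lo * (2 * t) + D * y * (D * y) ≡ 2 * lo * t + D * D * (y * y)
  lem₂ = solve-∀
-- Now `t` clips to 0, so only an overshoot of `x` beyond `lo` causes an error.
... | inj₂ 2t≤lo with m≤n⇒∃[o]m+o≡n 2t≤lo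
... | w , refl rewrite clip-below (2 * t + w) hi {t} (≤-trans (m≤m+n t (t + 0)) (m≤m+n (2 * t) w)) | ∣-∣-identityʳ (clip (2 * t + w) hi x)
  with ≤-total x (2 * t + w)
... | inj₁ x≤lo rewrite clip-below (2 * t + w) hi x≤lo | *-zeroʳ (2 * D * (2 * t + w)) = z≤n
... | inj₂ lo≤x with m≤n⇒∃[o]m+o≡n lo≤x
... | u , refl = ≤-trans (clip-error-above D hi t w u 1≤D) (m≤n+m _ (2 * (2 * t + w) * t))

module _ (vs : List A) (e : A → A → ℕ) (q lo hi D d : ℕ) (1≤D : 1 ≤ D)
  (row≤ : ∀ b → ∑ vs (e b) ≤ d) (col≤ : ∀ c → (∑ vs λ b → e b c) ≤ d) (e≤1 : ∀ b c → e b c ≤ 1)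
  (fine : D * D * (q * q + 2 * (d * q)) ≤ lo)
  where
  open Link vs e q

  private
    v : ℕ
    v = q * q + 2 * (d * q)
    y Δ : List Bool → List Bool → ℕ
    y B C = ∣ scaled B C - m ∣
    Δ B C = ∣ clip lo hi (scaled B C) - clip lo hi m ∣
    var : (∑ Ω λ B → ∑ Ω λ C → y B C * y B C) ≤ N * N * (m * v)
    var = scaled-variance row≤ col≤ e≤1

    ∑∑-*ˡ : ∀ c (f : List Bool → List Bool → ℕ) → (∑ Ω λ B → ∑ Ω λ C → c * f B C) ≡ c * ∑ Ω λ B → ∑ Ω λ C → f B C
    ∑∑-*ˡ c f = trans (∑-cong Ω λ B → ∑-*ˡ Ω c (f B)) (∑-*ˡ Ω c λ B → ∑ Ω (f B))

    -- A natural number is at most its square, so zero variance leaves no absolute error either.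
    exact : v ≡ 0 → (∑ Ω λ B → ∑ Ω λ C → 2 * D * Δ B C) ≤ N * N * (3 * m)
    exact v≡0 = begin
      (∑ Ω λ B → ∑ Ω λ C → 2 * D * Δ B C) ≡⟨ ∑∑-*ˡ (2 * D) Δ ⟩
      2 * D * (∑ Ω λ B → ∑ Ω λ C → Δ B C) ≤⟨ *-monoʳ-≤ (2 * D) (∑-mono Ω λ B → ∑-mono Ω λ C → ≤-trans (clip-lipschitz lo hi (scaled B C) m) (x≤x² (y B C))) ⟩
      2 * D * (∑ Ω λ B → ∑ Ω λ C → y B C * y B C) ≤⟨ *-monoʳ-≤ (2 * D) var ⟩
      2 * D * (N * N * (m * v)) ≡⟨ cong (λ z → 2 * D * (N * N * (m * z))) v≡0 ⟩
      2 * D * (N * N * (m * 0)) ≡⟨ lem D N m ⟩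
      0 ≤⟨ z≤n ⟩
      N * N * (3 * m) ∎
      where
      open ≤-Reasoning
      x≤x² : ∀ x → x ≤ x * x
      x≤x² zero = z≤n
      x≤x² (suc x) = m≤m+n (suc x) (x * suc x)
      lem : ∀ D N m → 2 * D * (N * N * (m * 0)) ≡ 0
      lem = solve-∀

    inexact : (∑ Ω λ B → ∑ Ω λ C → lo * (2 * D * Δ B C)) ≤ lo * (N * N * (3 * m))
    inexact = begin
      (∑ Ω λ B → ∑ Ω λ C → lo * (2 * D * Δ B C))
        ≤⟨ ∑-mono Ω (λ B → ∑-mono Ω λ C → ≤-trans (≤-reflexive (lem₁ lo D (Δ B C))) (clip-error D lo hi (scaled B C) m 1≤D)) ⟩
      (∑ Ω λ B → ∑ Ω λ C → 2 * lo * m + D * D * (y B C * y B C))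
        ≡⟨ trans (∑-cong Ω λ B → trans (∑-+ Ω (λ _ → 2 * lo * m) _) (cong (_+ ∑ Ω λ C → D * D * (y B C * y B C)) (∑-const Ω (2 * lo * m))))
                 (trans (∑-+ Ω (λ _ → N * (2 * lo * m)) _) (cong₂ _+_ (∑-const Ω (N * (2 * lo * m))) (∑∑-*ˡ (D * D) λ B C → y B C * y B C))) ⟩
      N * (N * (2 * lo * m)) + D * D * (∑ Ω λ B → ∑ Ω λ C → y B C * y B C)
        ≤⟨ +-monoʳ-≤ (N * (N * (2 * lo * m))) (*-monoʳ-≤ (D * D) var) ⟩
      N * (N * (2 * lo * m)) + D * D * (N * N * (m * v))
        ≡⟨ lem₂ N lo m (D * D) v ⟩
      N * N * m * (2 * lo + D * D * v)
        ≤⟨ *-monoʳ-≤ (N * N * m) (+-monoʳ-≤ (2 * lo) fine) ⟩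
      N * N * m * (2 * lo + lo)
        ≡⟨ lem₃ N lo m ⟩
      lo * (N * N * (3 * m)) ∎
      where
      open ≤-Reasoning
      lem₁ : ∀ lo D x → lo * (2 * D * x) ≡ 2 * D * lo * x
      lem₁ = solve-∀
      lem₂ : ∀ N lo m D² v → N * (N * (2 * lo * m)) + D² * (N * N * (m * v)) ≡ N * N * m * (2 * lo + D² * v)
      lem₂ = solve-∀
      lem₃ : ∀ N lo m → N * N * m * (2 * lo + lo) ≡ lo * (N * N * (3 * m))
      lem₃ = solve-∀

  -- Averaging `clip-error`: by `fine` the variance term is at most lo * m, which with 2 * lo * m
  -- makes 3 * lo * m; then `lo` cancels.
  ∑-clip-error : (∑ Ω λ B → ∑ Ω λ C → 2 * D * Δ B C) ≤ N * N * (3 * m)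
  ∑-clip-error with lo ≟ 0
  -- Nothing can be cancelled for lo = 0, but then `fine` forces the variance to vanish.
  ... | yes lo≡0 = exact (n≤0⇒n≡0 (begin
      v         ≡⟨ sym (*-identityˡ v) ⟩
      1 * v     ≤⟨ *-monoˡ-≤ v (*-mono-≤ 1≤D 1≤D) ⟩
      D * D * v ≤⟨ fine ⟩
      lo        ≡⟨ lo≡0 ⟩
      0         ∎))
    where open ≤-Reasoning
  ... | no lo≢0 = *-cancelˡ-≤ lo {{≢-nonZero lo≢0}} (≤-trans (≤-reflexive (sym (∑∑-*ˡ lo λ B C → 2 * D * Δ B C))) inexact)

accumulate : ∀ {A B : Set} → (A → B → ℕ) → List A → List B → ℕ
accumulate X []       _        = 0
accumulate X (_ ∷ _)  []       = 0
accumulate X (a ∷ as) (b ∷ bs) = X a b + accumulate X as bs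

-- Linearity of expectation over independent seeds, one per list entry. Only subadditivity of `g` is
-- asked for, so that it covers absolute errors of sums as well as query costs.
∑-subadditive : ∀ {A B : Set} (space : A → List B) (X : A → B → ℕ) c (g : List A → List B → ℕ) →
  (∀ a → ∑ (space a) (X a) ≤ length (space a) * c) →
  g [] [] ≡ 0 → (∀ a b as bs → g (a ∷ as) (b ∷ bs) ≤ X a b + g as bs) → ∀ as →
  ∑ (sequences (map space as)) (g as) ≤ length (sequences (map space as)) * (length as * c)
∑-subadditive space X c g h g[] g∷ []       = ≤-reflexive (trans (+-identityʳ _) g[])
∑-subadditive space X c g h g[] g∷ (a ∷ as) = begin
  ∑ (sequences (map space (a ∷ as))) (g (a ∷ as))
    ≡⟨ ∑-sequences (space a) (map space as) (g (a ∷ as)) ⟩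
  (∑ (space a) λ b → ∑ Ω λ bs → g (a ∷ as) (b ∷ bs))
    ≤⟨ ∑-mono (space a) (λ b → ∑-mono Ω λ bs → g∷ a b as bs) ⟩
  (∑ (space a) λ b → ∑ Ω λ bs → X a b + g as bs)
    ≡⟨ ∑-cong (space a) (λ b → trans (∑-+ Ω (λ _ → X a b) (g as)) (cong (_+ R) (∑-const Ω (X a b)))) ⟩
  (∑ (space a) λ b → length Ω * X a b + R)
    ≡⟨ trans (∑-+ (space a) (λ b → length Ω * X a b) λ _ → R) (cong₂ _+_ (∑-*ˡ (space a) (length Ω) (X a)) (∑-const (space a) R)) ⟩
  length Ω * ∑ (space a) (X a) + length (space a) * R
    ≤⟨ +-mono-≤ (*-monoʳ-≤ (length Ω) (h a)) (*-monoʳ-≤ (length (space a)) (∑-subadditive space X c g h g[] g∷ as)) ⟩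
  length Ω * (length (space a) * c) + length (space a) * (length Ω * (length as * c))
    ≡⟨ lem (length Ω) (length (space a)) c (length as) ⟩
  length (space a) * length Ω * (suc (length as) * c)
    ≡⟨ cong (_* (suc (length as) * c)) (sym (length-sequences (space a) (map space as))) ⟩
  length (sequences (map space (a ∷ as))) * (suc (length as) * c) ∎
  where
  open ≤-Reasoning
  Ω = sequences (map space as)
  R = ∑ Ω (g as)
  lem : ∀ N M c l → N * (M * c) + M * (N * (l * c)) ≡ M * N * (suc l * c)
  lem = solve-∀

-- Sampling within one layer.

Seed : Set
Seed = List Bool × List Bool × List Bool

-- A level samples first vertices at rate 1/(1+p) and the other two at rate 1/(1+q), and accounts for the part of the
-- number of triangles at a first vertex lying between lo and hi.
record Level (d D T κ : ℕ) : Set where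
  field
    p q lo hi : ℕ
    fine  : D * D * (q * q + 2 * (d * q)) ≤ lo
    light : D * D * (p * hi) ≤ T
    cheap : T ≤ D * D * (κ * (suc p * (suc q * suc q)))

  space : ℕ → List Seed
  space k = cartesianProduct (masks p k) (cartesianProduct (masks q k) (masks q k))

module Sampling {V : Set} (vs : List V) (e : V → V → V → ℕ) (d D T κ : ℕ) where

  deg : V → ℕ
  deg a = ∑ vs λ b → ∑ vs λ c → e a b c

  S : ℕ
  S = ∑ vs deg

  module At (ℓ : Level d D T κ) where

    open Level ℓ renaming (space to spaceOf)

    firsts others : List (List Bool)
    firsts = masks p (length vs)
    others = masks q (length vs)

    space : List Seed
    space = spaceOf (length vs)

    count : List Bool → List Bool → V → ℕ
    count B C a = ∑ (select B vs) λ b → ∑ (select C vs) λ c → e a b c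

    value : List Bool → List Bool → V → ℕ
    value B C a = clip lo hi ((suc q * suc q) * count B C a)

    estimate triples : Seed → ℕ
    estimate (A , B , C) = suc p * ∑ (select A vs) (value B C)
    triples  (A , B , C) = ∑ (select A vs) (count B C)

    target : ℕ
    target = ∑ vs λ a → clip lo hi (deg a)

    error : Seed → ℕ
    error ω = 2 * D * ∣ estimate ω - target ∣

    ∑-space : ∀ f → ∑ space f ≡ ∑ firsts λ A → ∑ others λ B → ∑ others λ C → f (A , B , C)
    ∑-space f = trans (∑-cartesianProductWith _,_ firsts (cartesianProduct others others) f)
      (∑-cong firsts λ A → ∑-cartesianProductWith _,_ others others λ BC → f (A , BC))

    length-space : length space ≡ length firsts * (length others * length others)
    length-space = trans (length-cartesianProductWith _,_ firsts (cartesianProduct others others))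
      (cong (length firsts *_) (length-cartesianProductWith _,_ others others))

    private
      P N : ℕ
      P = length firsts
      N = length others

    -- For fixed `B` and `C` the weighted sum over sampled first vertices is unbiased, so `A` is
    -- moved innermost and averaged out. Afterwards each first vertex is treated alone.
    ∑-firsts : ∀ (h : List Bool → List Bool → V → ℕ) →
      (∑ firsts λ A → ∑ others λ B → ∑ others λ C → suc p * ∑ (select A vs) (h B C))
      ≡ P * ∑ vs λ a → ∑ others λ B → ∑ others λ C → h B C a
    ∑-firsts h = begin
      (∑ firsts λ A → ∑ others λ B → ∑ others λ C → suc p * ∑ (select A vs) (h B C))
        ≡⟨ ∑-cong firsts (λ A → sym (∑-cartesianProductWith _,_ others others λ (B , C) → suc p * ∑ (select A vs) (h B C))) ⟩
      (∑ firsts λ A → ∑ Ω² λ (B , C) → suc p * ∑ (select A vs) (h B C))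
        ≡⟨ ∑-swap firsts Ω² (λ A (B , C) → suc p * ∑ (select A vs) (h B C)) ⟩
      (∑ Ω² λ (B , C) → ∑ firsts λ A → suc p * ∑ (select A vs) (h B C))
        ≡⟨ ∑-cong Ω² (λ (B , C) → ∑-mask-first-moment p vs (h B C)) ⟩
      (∑ Ω² λ (B , C) → P * ∑ vs (h B C))
        ≡⟨ ∑-*ˡ Ω² P (λ (B , C) → ∑ vs (h B C)) ⟩
      P * (∑ Ω² λ (B , C) → ∑ vs (h B C))
        ≡⟨ cong (P *_) (∑-swap Ω² vs λ (B , C) a → h B C a) ⟩
      P * (∑ vs λ a → ∑ Ω² λ (B , C) → h B C a)
        ≡⟨ cong (P *_) (∑-cong vs λ a → ∑-cartesianProductWith _,_ others others λ (B , C) → h B C a) ⟩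
      P * (∑ vs λ a → ∑ others λ B → ∑ others λ C → h B C a) ∎
      where
      open ≡-Reasoning
      Ω² = cartesianProduct others others

    -- A triple survives with probability 1/((1+p)(1+q)²).
    mean-triples : (suc p * (suc q * suc q)) * ∑ space triples ≡ length space * S
    mean-triples = begin
      (suc p * Q²) * ∑ space triples
        ≡⟨ sym (∑-*ˡ space (suc p * Q²) triples) ⟩
      (∑ space λ ω → (suc p * Q²) * triples ω)
        ≡⟨ ∑-space (λ ω → (suc p * Q²) * triples ω) ⟩
      (∑ firsts λ A → ∑ others λ B → ∑ others λ C → (suc p * Q²) * ∑ (select A vs) (count B C))
        ≡⟨ ∑-cong firsts (λ A → ∑-cong others λ B → ∑-cong others λ C →
             trans (*-assoc (suc p) Q² _) (cong (suc p *_) (sym (∑-*ˡ (select A vs) Q² (count B C))))) ⟩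
      (∑ firsts λ A → ∑ others λ B → ∑ others λ C → suc p * ∑ (select A vs) λ a → Q² * count B C a)
        ≡⟨ ∑-firsts (λ B C a → Q² * count B C a) ⟩
      P * (∑ vs λ a → ∑ others λ B → ∑ others λ C → Q² * count B C a)
        ≡⟨ cong (P *_) (∑-cong vs λ a → Link.scaled-mean vs (e a) q) ⟩
      P * (∑ vs λ a → N * N * deg a)
        ≡⟨ trans (cong (P *_) (∑-*ˡ vs (N * N) deg)) (sym (*-assoc P (N * N) S)) ⟩
      P * (N * N) * S
        ≡⟨ cong (_* S) (sym length-space) ⟩
      length space * S ∎
      where
      open ≡-Reasoning
      Q² = suc q * suc q

    -- The condition `cheap` says that a triple survives with probability at most D²κ/T.
    level-triples : T * ∑ space triples ≤ length space * (D * D * κ * S)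
    level-triples = begin
      T * ∑ space triples
        ≤⟨ *-monoˡ-≤ (∑ space triples) cheap ⟩
      D * D * (κ * (suc p * (suc q * suc q))) * ∑ space triples
        ≡⟨ lem₁ D κ (suc p * (suc q * suc q)) (∑ space triples) ⟩
      D * D * κ * ((suc p * (suc q * suc q)) * ∑ space triples)
        ≡⟨ cong (D * D * κ *_) mean-triples ⟩
      D * D * κ * (length space * S)
        ≡⟨ lem₂ (D * D * κ) (length space) S ⟩
      length space * (D * D * κ * S) ∎
      where
      open ≤-Reasoning
      lem₁ : ∀ D κ r x → D * D * (κ * r) * x ≡ D * D * κ * (r * x)
      lem₁ = solve-∀
      lem₂ : ∀ a b c → a * (b * c) ≡ b * (a * c)
      lem₂ = solve-∀

    module _ (1≤D : 1 ≤ D) (1≤T : 1 ≤ T)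
      (row≤ : ∀ a b → ∑ vs (e a b) ≤ d) (col≤ : ∀ a c → (∑ vs λ b → e a b c) ≤ d) (e≤1 : ∀ a b c → e a b c ≤ 1) where

      private
        g : V → ℕ
        g a = clip lo hi (deg a)

        W : List Bool → ℕ
        W A = suc p * ∑ (select A vs) g

        -- The clipped values are at most `hi` and sum to at most `S`, so their squares sum to at
        -- most `hi * S`.
        sampling-variance : (∑ firsts λ A → ∣ W A - target ∣ * ∣ W A - target ∣) ≤ P * (p * (hi * S))
        sampling-variance = begin
          (∑ firsts λ A → ∣ W A - target ∣ * ∣ W A - target ∣)
            ≡⟨ ∑-variance firsts W target (p * ∑ vs λ a → g a * g a) (∑-mask-first-moment p vs g) (∑-mask-second-moment p vs g) ⟩
          P * (p * ∑ vs λ a → g a * g a)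
            ≤⟨ *-monoʳ-≤ P (*-monoʳ-≤ p (≤-trans (∑-square-≤ vs g λ a → clip≤hi lo hi (deg a)) (*-monoʳ-≤ hi (∑-mono vs λ a → clip≤ lo hi (deg a))))) ⟩
          P * (p * (hi * S)) ∎
          where open ≤-Reasoning

        -- By `light`, D² times the variance is at most T S. Passing to the absolute error through
        -- 2DyT ≤ D²y² + T² avoids square roots.
        sampling-error : (∑ firsts λ A → 2 * D * ∣ W A - target ∣) ≤ P * (S + T)
        sampling-error = *-cancelˡ-≤ T {{>-nonZero 1≤T}} (begin
          T * (∑ firsts λ A → 2 * D * ∣ W A - target ∣)
            ≡⟨ sym (∑-*ˡ firsts T λ A → 2 * D * ∣ W A - target ∣) ⟩
          (∑ firsts λ A → T * (2 * D * ∣ W A - target ∣))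
            ≤⟨ ∑-mono firsts (λ A → amgm ∣ W A - target ∣) ⟩
          (∑ firsts λ A → D * D * (∣ W A - target ∣ * ∣ W A - target ∣) + T * T)
            ≡⟨ trans (∑-+ firsts _ (λ _ → T * T)) (cong₂ _+_ (∑-*ˡ firsts (D * D) λ A → ∣ W A - target ∣ * ∣ W A - target ∣) (∑-const firsts (T * T))) ⟩
          D * D * (∑ firsts λ A → ∣ W A - target ∣ * ∣ W A - target ∣) + P * (T * T)
            ≤⟨ +-monoˡ-≤ (P * (T * T)) (*-monoʳ-≤ (D * D) sampling-variance) ⟩
          D * D * (P * (p * (hi * S))) + P * (T * T)
            ≡⟨ cong (_+ P * (T * T)) (lem₂ D P p hi S) ⟩
          P * (D * D * (p * hi) * S) + P * (T * T)
            ≤⟨ +-monoˡ-≤ (P * (T * T)) (*-monoʳ-≤ P (*-monoˡ-≤ S light)) ⟩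
          P * (T * S) + P * (T * T)
            ≡⟨ lem₃ P T S ⟩
          T * (P * (S + T)) ∎)
          where
          open ≤-Reasoning
          lem₀ : ∀ D T y → T * (2 * D * y) ≡ 2 * (D * y * T)
          lem₀ = solve-∀
          lem₁ : ∀ D T y → D * y * (D * y) + T * T ≡ D * D * (y * y) + T * T
          lem₁ = solve-∀
          amgm : ∀ y → T * (2 * D * y) ≤ D * D * (y * y) + T * T
          amgm y = ≤-trans (≤-reflexive (lem₀ D T y)) (≤-trans (2xy≤x²+y² (D * y) T) (≤-reflexive (lem₁ D T y)))
          lem₂ : ∀ D P p hi S → D * D * (P * (p * (hi * S))) ≡ P * (D * D * (p * hi) * S)
          lem₂ = solve-∀
          lem₃ : ∀ P T S → P * (T * S) + P * (T * T) ≡ T * (P * (S + T))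
          lem₃ = solve-∀

        Δ : List Bool → List Bool → V → ℕ
        Δ B C a = 2 * D * ∣ value B C a - g a ∣

        -- The weight of the first vertices is linear, so the errors of their link estimates can be averaged one by one.
        estimate-error : (∑ firsts λ A → ∑ others λ B → ∑ others λ C → suc p * ∑ (select A vs) (Δ B C)) ≤ P * (N * N) * (3 * S)
        estimate-error = begin
          (∑ firsts λ A → ∑ others λ B → ∑ others λ C → suc p * ∑ (select A vs) (Δ B C))
            ≡⟨ ∑-firsts Δ ⟩
          P * (∑ vs λ a → ∑ others λ B → ∑ others λ C → Δ B C a)
            ≤⟨ *-monoʳ-≤ P (∑-mono vs λ a → ∑-clip-error vs (e a) q lo hi D d 1≤D (row≤ a) (col≤ a) (e≤1 a) fine) ⟩
          P * (∑ vs λ a → N * N * (3 * deg a))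
            ≡⟨ cong (P *_) (trans (∑-*ˡ vs (N * N) λ a → 3 * deg a) (cong (N * N *_) (∑-*ˡ vs 3 deg))) ⟩
          P * (N * N * (3 * S))
            ≡⟨ sym (*-assoc P (N * N) (3 * S)) ⟩
          P * (N * N) * (3 * S) ∎
          where open ≤-Reasoning

      -- The triangle inequality through `W A`, the sampled sum with exact link values: 3S comes
      -- from the link estimates and S + T from the choice of first vertices.
      level-error : ∑ space error ≤ length space * (4 * S + T)
      level-error = begin
        ∑ space error
          ≡⟨ ∑-space error ⟩
        (∑ firsts λ A → ∑ others λ B → ∑ others λ C → error (A , B , C))
          ≤⟨ ∑-mono firsts (λ A → ∑-mono others λ B → ∑-mono others λ C → split A B C) ⟩
        (∑ firsts λ A → ∑ others λ B → ∑ others λ C → suc p * ∑ (select A vs) (Δ B C) + 2 * D * ∣ W A - target ∣)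
          ≡⟨ trans (∑-cong firsts λ A → trans (∑-cong others λ B → trans (∑-+ others _ _) (cong ((∑ others λ C → suc p * ∑ (select A vs) (Δ B C)) +_) (∑-const others (2 * D * ∣ W A - target ∣))))
                                       (trans (∑-+ others _ _) (cong ((∑ others λ B → ∑ others λ C → suc p * ∑ (select A vs) (Δ B C)) +_) (trans (∑-const others (N * (2 * D * ∣ W A - target ∣))) (sym (*-assoc N N _))))))
                   (trans (∑-+ firsts _ _) (cong ((∑ firsts λ A → ∑ others λ B → ∑ others λ C → suc p * ∑ (select A vs) (Δ B C)) +_) (∑-*ˡ firsts (N * N) λ A → 2 * D * ∣ W A - target ∣))) ⟩
        (∑ firsts λ A → ∑ others λ B → ∑ others λ C → suc p * ∑ (select A vs) (Δ B C)) + N * N * (∑ firsts λ A → 2 * D * ∣ W A - target ∣)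
          ≤⟨ +-mono-≤ estimate-error (*-monoʳ-≤ (N * N) sampling-error) ⟩
        P * (N * N) * (3 * S) + N * N * (P * (S + T))
          ≡⟨ lem P N S T ⟩
        P * (N * N) * (4 * S + T)
          ≡⟨ cong (_* (4 * S + T)) (sym length-space) ⟩
        length space * (4 * S + T) ∎
        where
        open ≤-Reasoning
        lem : ∀ P N S T → P * (N * N) * (3 * S) + N * N * (P * (S + T)) ≡ P * (N * N) * (4 * S + T)
        lem = solve-∀
        lem₁ : ∀ D p s → 2 * D * (suc p * s) ≡ suc p * (2 * D * s)
        lem₁ = solve-∀
        split : ∀ A B C → error (A , B , C) ≤ suc p * ∑ (select A vs) (Δ B C) + 2 * D * ∣ W A - target ∣
        split A B C = begin
          2 * D * ∣ E - target ∣
            ≤⟨ *-monoʳ-≤ (2 * D) (∣-∣-triangle E (W A) target) ⟩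
          2 * D * (∣ E - W A ∣ + ∣ W A - target ∣)
            ≡⟨ *-distribˡ-+ (2 * D) ∣ E - W A ∣ ∣ W A - target ∣ ⟩
          2 * D * ∣ E - W A ∣ + 2 * D * ∣ W A - target ∣
            ≤⟨ +-monoˡ-≤ (2 * D * ∣ W A - target ∣) (begin
                 2 * D * ∣ E - W A ∣
                   ≡⟨ cong (2 * D *_) (sym (*-distribˡ-∣-∣ (suc p) (∑ As (value B C)) (∑ As g))) ⟩
                 2 * D * (suc p * ∣ ∑ As (value B C) - ∑ As g ∣)
                   ≤⟨ *-monoʳ-≤ (2 * D) (*-monoʳ-≤ (suc p) (∑-abs As (value B C) g)) ⟩
                 2 * D * (suc p * ∑ As λ a → ∣ value B C a - g a ∣)
                   ≡⟨ trans (lem₁ D p (∑ As λ a → ∣ value B C a - g a ∣)) (cong (suc p *_) (sym (∑-*ˡ As (2 * D) λ a → ∣ value B C a - g a ∣))) ⟩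
                 suc p * ∑ As (Δ B C) ∎) ⟩
          suc p * ∑ As (Δ B C) + 2 * D * ∣ W A - target ∣ ∎
          where
          As = select A vs
          E = suc p * ∑ As (value B C)

-- The schedule of layers and its total error.

quotient : ∀ T c → 1 ≤ c → ∃ λ p → p * c ≤ T × T ≤ suc p * c
quotient T (suc c) _ = T / suc c , m/n*n≤m T (suc c) ,
  ≤-trans (≤-reflexive (m≡m%n+[m/n]*n T (suc c))) (+-monoˡ-≤ (T / suc c * suc c) (<⇒≤ (m%n<n T (suc c))))

markov : ∀ {A : Set} (Ω : List A) (X : A → ℕ) w → w * (∑ Ω λ ω → ind (w <ᵇ X ω)) ≤ ∑ Ω X
markov Ω X w = ≤-trans (≤-reflexive (sym (∑-*ˡ Ω w λ ω → ind (w <ᵇ X ω)))) (∑-mono Ω pointwise)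
  where
  pointwise : ∀ ω → w * ind (w <ᵇ X ω) ≤ X ω
  pointwise ω with w <ᵇ X ω in eq
  ... | true  = ≤-trans (≤-reflexive (*-identityʳ w)) (<⇒≤ (<ᵇ⇒< w (X ω) (subst Bool.T (sym eq) _)))
  ... | false = ≤-trans (≤-reflexive (*-zeroʳ w)) z≤n

4^≡2^² : ∀ j → 4 ^ j ≡ 2 ^ j * 2 ^ j
4^≡2^² j = trans (^-*-assoc 2 2 j) (trans (cong (2 ^_) (cong (j +_) (+-identityʳ j))) (^-distribˡ-+-* 2 j j))

-- With q < Q and d ≥ 1, q² + 2dq is at most 3dQ²; this τ is thus the factor for which `fine` holds
-- in the layer starting at τQ².
threshold : ℕ → ℕ → ℕ
threshold d D = 3 * (d * (D * D))

module Schedule (d D T : ℕ) (1≤d : 1 ≤ d) (1≤D : 1 ≤ D) where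

  τ κ : ℕ
  τ = threshold d D
  κ = 4 * τ

  1≤τ : 1 ≤ τ
  1≤τ = *-mono-≤ {1} {3} {1} (s≤s z≤n) (*-mono-≤ 1≤d (*-mono-≤ 1≤D 1≤D))

  -- `light` asks for a high rate of first vertices and `cheap` for a low one. Rounding T/(D² hi)
  -- down to `p` meets both, as long as `hi` is at most κ(1+q)².
  level : ∀ q lo hi → D * D * (q * q + 2 * (d * q)) ≤ lo → 1 ≤ hi → hi ≤ κ * (suc q * suc q) → Level d D T κ
  level q lo hi fine 1≤hi hi≤ with quotient T (D * D * hi) (*-mono-≤ (*-mono-≤ 1≤D 1≤D) 1≤hi)
  ... | p , p≤ , ≤p = record
    { p = p ; q = q ; lo = lo ; hi = hi ; fine = fine
    ; light = ≤-trans (≤-reflexive (lem₁ (D * D) p hi)) p≤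
    ; cheap = begin
        T                                           ≤⟨ ≤p ⟩
        suc p * (D * D * hi)                        ≤⟨ *-monoʳ-≤ (suc p) (*-monoʳ-≤ (D * D) hi≤) ⟩
        suc p * (D * D * (κ * (suc q * suc q)))     ≡⟨ lem₂ (suc p) (D * D) κ (suc q * suc q) ⟩
        D * D * (κ * (suc p * (suc q * suc q)))     ∎
    }
    where
    open ≤-Reasoning
    lem₁ : ∀ a p h → a * (p * h) ≡ p * (a * h)
    lem₁ = solve-∀
    lem₂ : ∀ p a k r → p * (a * (k * r)) ≡ a * (k * (p * r))
    lem₂ = solve-∀

  -- With q = 0 links are read exactly, so `fine` holds even with lo = 0.
  base : Level d D T κ
  base = level 0 0 τ (≤-reflexive (trans (cong (D * D *_) (cong (2 *_) (*-zeroʳ d))) (*-zeroʳ (D * D)))) 1≤τ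
    (≤-trans (m≤n*m τ 4) (≤-reflexive (sym (*-identityʳ κ))))

  -- Keeping each side of a link at rate 1/2^j keeps an edge with probability 1/4^j. The variance
  -- bound then grows like 4^j, as does `lo`; since hi = 4 lo, the constant κ is 4τ.
  geometric : ℕ → Level d D T κ
  geometric j = level (2 ^ j ∸ 1) (τ * 4 ^ j) (τ * 4 ^ suc j) fine (*-mono-≤ 1≤τ (m^n>0 4 (suc j))) (≤-reflexive hi≡)
    where
    Q = 2 ^ j
    Q≡ : suc (Q ∸ 1) ≡ Q
    Q≡ = m+[n∸m]≡n (m^n>0 2 j)
    hi≡ : τ * 4 ^ suc j ≡ κ * (suc (Q ∸ 1) * suc (Q ∸ 1))
    hi≡ = trans (lem τ (4 ^ j)) (cong (4 * τ *_) (trans (4^≡2^² j) (sym (cong₂ _*_ Q≡ Q≡))))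
      where
      lem : ∀ t x → t * (4 * x) ≡ 4 * t * x
      lem = solve-∀
    fine : D * D * ((Q ∸ 1) * (Q ∸ 1) + 2 * (d * (Q ∸ 1))) ≤ τ * 4 ^ j
    fine = begin
      D * D * ((Q ∸ 1) * (Q ∸ 1) + 2 * (d * (Q ∸ 1)))
        ≤⟨ *-monoʳ-≤ (D * D) (+-mono-≤ (*-mono-≤ (m∸n≤m Q 1) (m∸n≤m Q 1)) (*-monoʳ-≤ 2 (*-monoʳ-≤ d (≤-trans (m∸n≤m Q 1) Q≤Q²)))) ⟩
      D * D * (Q * Q + 2 * (d * (Q * Q)))
        ≤⟨ *-monoʳ-≤ (D * D) (+-monoˡ-≤ _ (≤-trans (≤-reflexive (sym (*-identityˡ (Q * Q)))) (*-monoˡ-≤ (Q * Q) 1≤d))) ⟩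
      D * D * (d * (Q * Q) + 2 * (d * (Q * Q)))
        ≡⟨ trans (lem D d (Q * Q)) (cong (τ *_) (sym (4^≡2^² j))) ⟩
      τ * 4 ^ j ∎
      where
      open ≤-Reasoning
      Q≤Q² : Q ≤ Q * Q
      Q≤Q² = ≤-trans (≤-reflexive (sym (*-identityʳ Q))) (*-monoʳ-≤ Q (m^n>0 2 j))
      lem : ∀ D d x → D * D * (d * x + 2 * (d * x)) ≡ 3 * (d * (D * D)) * x
      lem = solve-∀

  geometrics : ℕ → ℕ → List (Level d D T κ)
  geometrics j zero    = []
  geometrics j (suc k) = geometric j ∷ geometrics (suc j) k

  schedule : ℕ → List (Level d D T κ)
  schedule L = base ∷ geometrics 0 L

  length-schedule : ∀ L → length (schedule L) ≡ suc L
  length-schedule L = cong suc (go 0 L)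
    where
    go : ∀ j k → length (geometrics j k) ≡ k
    go j zero    = refl
    go j (suc k) = cong suc (go (suc j) k)

  module Quality {V : Set} (vs : List V) (e : V → V → V → ℕ) where

    open Sampling vs e d D T κ public

    targets : List (Level d D T κ) → ℕ
    targets ls = ∑ ls At.target

    targets-geometrics : ∀ j k → targets (geometrics j k) ≡ ∑ vs λ a → clip (τ * 4 ^ j) (τ * 4 ^ (j + k)) (deg a)
    targets-geometrics j zero    = sym (trans (∑-cong vs λ a → m≤n⇒m∸n≡0 (≤-trans (m⊓n≤n (deg a) _) (≤-reflexive (cong (λ i → τ * 4 ^ i) (+-identityʳ j))))) (∑-zero vs))
    targets-geometrics j (suc k) = begin
      (∑ vs λ a → clip lo mid (deg a)) + targets (geometrics (suc j) k)
        ≡⟨ cong (At.target (geometric j) +_) (targets-geometrics (suc j) k) ⟩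
      (∑ vs λ a → clip lo mid (deg a)) + (∑ vs λ a → clip mid (τ * 4 ^ (suc j + k)) (deg a))
        ≡⟨ sym (∑-+ vs _ _) ⟩
      (∑ vs λ a → clip lo mid (deg a) + clip mid (τ * 4 ^ (suc j + k)) (deg a))
        ≡⟨ ∑-cong vs (λ a → trans (clip-glue (deg a) (*-monoʳ-≤ τ (^-monoʳ-≤ 4 (n≤1+n j))) (*-monoʳ-≤ τ (^-monoʳ-≤ 4 (m≤m+n (suc j) k))))
                                  (cong (λ i → clip lo (τ * 4 ^ i) (deg a)) (sym (+-suc j k)))) ⟩
      (∑ vs λ a → clip lo (τ * 4 ^ (j + suc k)) (deg a)) ∎
      where
      open ≡-Reasoning
      lo = τ * 4 ^ j
      mid = τ * 4 ^ suc j

    -- The layers telescope to a single clipping at τ4^L, which exceeds the number of ordered edges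
    -- of any link.
    targets-schedule : ∀ L → (∀ a → deg a ≤ 4 ^ L) → targets (schedule L) ≡ S
    targets-schedule L deg≤ = begin
      (∑ vs λ a → clip 0 τ (deg a)) + targets (geometrics 0 L)
        ≡⟨ cong (At.target base +_) (targets-geometrics 0 L) ⟩
      (∑ vs λ a → clip 0 τ (deg a)) + (∑ vs λ a → clip (τ * 1) (τ * 4 ^ L) (deg a))
        ≡⟨ cong (λ t → (∑ vs λ a → clip 0 τ (deg a)) + (∑ vs λ a → clip t (τ * 4 ^ L) (deg a))) (*-identityʳ τ) ⟩
      (∑ vs λ a → clip 0 τ (deg a)) + (∑ vs λ a → clip τ (τ * 4 ^ L) (deg a))
        ≡⟨ sym (∑-+ vs _ _) ⟩
      (∑ vs λ a → clip 0 τ (deg a) + clip τ (τ * 4 ^ L) (deg a))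
        ≡⟨ ∑-cong vs (λ a → trans (clip-glue (deg a) z≤n (≤-trans (≤-reflexive (sym (*-identityʳ τ))) (*-monoʳ-≤ τ (m^n>0 4 L))))
                                  (m≤n⇒m⊓n≡m (≤-trans (deg≤ a) (≤-trans (≤-reflexive (sym (*-identityˡ (4 ^ L)))) (*-monoˡ-≤ (4 ^ L) 1≤τ))))) ⟩
      S ∎
      where open ≡-Reasoning

    seeds : List (Level d D T κ) → List (List Seed)
    seeds ls = sequences (map At.space ls)

    estimates : List (Level d D T κ) → List Seed → ℕ
    estimates = accumulate At.estimate

    module _ (1≤T : 1 ≤ T) (S≤2T : S ≤ 2 * T) where

      -- The constant 9 is the bound 4S + T ≤ 9T, from S ≤ 2T.
      ∑-estimates-error : (row≤ : ∀ a b → ∑ vs (e a b) ≤ d) (col≤ : ∀ a c → (∑ vs λ b → e a b c) ≤ d) (e≤1 : ∀ a b c → e a b c ≤ 1) →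
        ∀ ls → (∑ (seeds ls) λ ωs → 2 * D * ∣ estimates ls ωs - targets ls ∣) ≤ length (seeds ls) * (length ls * (9 * T))
      ∑-estimates-error row≤ col≤ e≤1 = ∑-subadditive At.space At.error (9 * T) (λ ls ωs → 2 * D * ∣ estimates ls ωs - targets ls ∣)
        (λ ℓ → ≤-trans (At.level-error ℓ 1≤D 1≤T row≤ col≤ e≤1) (*-monoʳ-≤ (length (At.space ℓ)) (begin
          4 * S + T         ≤⟨ +-monoˡ-≤ T (*-monoʳ-≤ 4 S≤2T) ⟩
          4 * (2 * T) + T   ≡⟨ lem T ⟩
          9 * T             ∎)))
        (*-zeroʳ (2 * D))
        λ ℓ ω ls ωs → ≤-trans (*-monoʳ-≤ (2 * D) (abs-+ (At.estimate ℓ ω) (estimates ls ωs) (At.target ℓ) (targets ls)))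
                              (≤-reflexive (*-distribˡ-+ (2 * D) _ _))
        where
        open ≤-Reasoning
        lem : ∀ T → 4 * (2 * T) + T ≡ 9 * T
        lem = solve-∀

      ∑-triples : ∀ ℓ → ∑ (At.space ℓ) (At.triples ℓ) ≤ length (At.space ℓ) * (2 * (D * D * κ))
      ∑-triples ℓ = *-cancelˡ-≤ T {{>-nonZero 1≤T}} (begin
        T * ∑ (At.space ℓ) (At.triples ℓ) ≤⟨ At.level-triples ℓ ⟩
        N * (D * D * κ * S)                     ≤⟨ *-monoʳ-≤ N (*-monoʳ-≤ (D * D * κ) S≤2T) ⟩
        N * (D * D * κ * (2 * T))               ≡⟨ lem N (D * D * κ) T ⟩
        T * (N * (2 * (D * D * κ)))             ∎)
        where
        open ≤-Reasoning
        N = length (At.space ℓ)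
        lem : ∀ N x T → N * (x * (2 * T)) ≡ T * (N * (2 * x))
        lem = solve-∀

-- Deterministic query trees.

data Tree (n : ℕ) (Out : Set) : Set where
  return : Out → Tree n Out
  ask    : (A B C : Subset n) → ValidQuery A B C → (Bool → Tree n Out) → Tree n Out

infixl 1 _>>=_
_>>=_ : Tree n Out → (Out → Tree n Out′) → Tree n Out′
return r      >>= f = f r
ask A B C v k >>= f = ask A B C v λ b → k b >>= f

run : Graph n → Tree n Out → Out
run G (return r)      = r
run G (ask A B C _ k) = run G (k (TIS G A B C))

cost : Graph n → Tree n Out → ℕ
cost G (return _)      = 0
cost G (ask A B C _ k) = suc (cost G (k (TIS G A B C)))

run->>= : ∀ (G : Graph n) (t : Tree n Out) (f : Out → Tree n Out′) → run G (t >>= f) ≡ run G (f (run G t))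
run->>= G (return r)      f = refl
run->>= G (ask A B C _ k) f = run->>= G (k (TIS G A B C)) f

cost->>= : ∀ (G : Graph n) (t : Tree n Out) (f : Out → Tree n Out′) → cost G (t >>= f) ≡ cost G t + cost G (f (run G t))
cost->>= G (return r)      f = refl
cost->>= G (ask A B C _ k) f = cong suc (cost->>= G (k (TIS G A B C)) f)

truncate : ℕ → Out → Tree n Out → Tree n Out
truncate w       r (return x)      = return x
truncate zero    r (ask A B C v k) = return r
truncate (suc w) r (ask A B C v k) = ask A B C v λ b → truncate w r (k b)

cost-truncate : ∀ (G : Graph n) w (r : Out) t → cost G (truncate w r t) ≤ w
cost-truncate G w       r (return x)      = z≤n
cost-truncate G zero    r (ask A B C v k) = z≤n
cost-truncate G (suc w) r (ask A B C v k) = s≤s (cost-truncate G w r (k (TIS G A B C)))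

run-truncate : ∀ (G : Graph n) w (r : Out) t → cost G t ≤ w → run G (truncate w r t) ≡ run G t
run-truncate G w       r (return x)      _       = refl
run-truncate G (suc w) r (ask A B C v k) (s≤s h) = run-truncate G w r (k (TIS G A B C)) h

infixr 2 _orElse_
_orElse_ : Tree n Bool → Tree n Bool → Tree n Bool
t orElse u = t >>= λ b → if b then return true else u

infixr 3 _andThen_
_andThen_ : Tree n Bool → Tree n ℕ → Tree n ℕ
t andThen u = t >>= λ b → if b then u else return 0

infixl 6 _⊕_
_⊕_ : Tree n ℕ → Tree n ℕ → Tree n ℕ
t ⊕ u = t >>= λ x → u >>= λ y → return (x + y)

run-orElse : ∀ (G : Graph n) t u → run G (t orElse u) ≡ run G t ∨ run G u
run-orElse G t u rewrite run->>= G t (λ b → if b then return true else u) with run G t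
... | true  = refl
... | false = refl

cost-orElse : ∀ (G : Graph n) t u → cost G (t orElse u) ≤ cost G t + cost G u
cost-orElse G t u rewrite cost->>= G t (λ b → if b then return true else u) with run G t
... | true  = +-monoʳ-≤ (cost G t) z≤n
... | false = ≤-refl

run-⊕ : ∀ (G : Graph n) t u → run G (t ⊕ u) ≡ run G t + run G u
run-⊕ G t u = trans (run->>= G t _) (run->>= G u _)

cost-⊕ : ∀ (G : Graph n) t u → cost G (t ⊕ u) ≡ cost G t + cost G u
cost-⊕ G t u = trans (cost->>= G t _) (cong (cost G t +_) (trans (cost->>= G u _) (+-identityʳ _)))

disjunction : List A → (A → Tree n Bool) → Tree n Bool
disjunction []       t = return false
disjunction (x ∷ xs) t = t x orElse disjunction xs t

cost-disjunction : ∀ (G : Graph n) (xs : List A) t {c} → (∀ x → cost G (t x) ≤ c) → cost G (disjunction xs t) ≤ length xs * c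
cost-disjunction G []       t h = z≤n
cost-disjunction G (x ∷ xs) t h = ≤-trans (cost-orElse G (t x) (disjunction xs t)) (+-mono-≤ (h x) (cost-disjunction G xs t h))

disjunction⁺ : ∀ (G : Graph n) {xs : List A} {t x} → x ∈ˡ xs → run G (t x) ≡ true → run G (disjunction xs t) ≡ true
disjunction⁺ G {x ∷ xs} {t} (here refl) h rewrite run-orElse G (t x) (disjunction xs t) | h = refl
disjunction⁺ G {x ∷ xs} {t} (there x∈)  h rewrite run-orElse G (t x) (disjunction xs t) | disjunction⁺ G {xs} {t} x∈ h = Bool.∨-zeroʳ _

disjunction⁻ : ∀ (G : Graph n) (xs : List A) {t} → run G (disjunction xs t) ≡ true → ∃ λ x → run G (t x) ≡ true
disjunction⁻ G (x ∷ xs) {t} h rewrite run-orElse G (t x) (disjunction xs t) with run G (t x) in eq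
... | true  = x , eq
... | false = disjunction⁻ G xs h

-- Binary search with a test for nonzero weight.

module Search {n : ℕ} {A : Set} (test : List A → Tree n Bool) (leaf : A → Tree n ℕ) where

  -- Meaningful for lists of length at most 2^k only.
  search : ℕ → List A → Tree n ℕ
  search zero    []       = return 0
  search zero    (x ∷ _)  = test (x ∷ []) andThen leaf x
  search (suc k) xs       = test xs andThen (search k (take (2 ^ k) xs) ⊕ search k (drop (2 ^ k) xs))

  halves : ∀ k (xs : List A) (f : A → ℕ) → ∑ (take (2 ^ k) xs) f + ∑ (drop (2 ^ k) xs) f ≡ ∑ xs f
  halves k xs f = trans (sym (∑-++ (take (2 ^ k) xs) _ f)) (cong (λ ys → ∑ ys f) (take++drop≡id (2 ^ k) xs))

  length-first : ∀ k (xs : List A) → length (take (2 ^ k) xs) ≤ 2 ^ k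
  length-first k xs = ≤-trans (≤-reflexive (length-take (2 ^ k) xs)) (m⊓n≤m (2 ^ k) (length xs))

  length-second : ∀ k (xs : List A) → length xs ≤ 2 ^ suc k → length (drop (2 ^ k) xs) ≤ 2 ^ k
  length-second k xs h = ≤-trans (≤-reflexive (length-drop (2 ^ k) xs)) (m≤n+o⇒m∸n≤o (length xs) (2 ^ k) (≤-trans h (≤-reflexive (cong (2 ^ k +_) (+-identityʳ (2 ^ k))))))

  module _ (G : Graph n) (w : A → ℕ)
    (sound    : ∀ xs → run G (test xs) ≡ true → 1 ≤ ∑ xs w)
    (complete : ∀ xs → run G (test xs) ≡ false → ∑ xs w ≡ 0) where

    module _ (value : A → ℕ) (run-leaf : ∀ x → 1 ≤ w x → run G (leaf x) ≡ value x) (value0 : ∀ x → w x ≡ 0 → value x ≡ 0) where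

      vanish : ∀ xs → ∑ xs w ≡ 0 → ∑ xs value ≡ 0
      vanish []       h = refl
      vanish (x ∷ xs) h = cong₂ _+_ (value0 x (m+n≡0⇒m≡0 (w x) h)) (vanish xs (m+n≡0⇒n≡0 (w x) h))

      -- A pruned sublist has weight 0, and elements of weight 0 have value 0, so nothing is lost.
      run-search : ∀ k xs → length xs ≤ 2 ^ k → run G (search k xs) ≡ ∑ xs value
      run-search zero [] h = refl
      run-search zero (x ∷ []) h rewrite run->>= G (test (x ∷ [])) (λ b → if b then leaf x else return 0) with run G (test (x ∷ [])) in eq
      ... | true  = trans (run-leaf x (≤-trans (sound (x ∷ []) eq) (≤-reflexive (+-identityʳ (w x))))) (sym (+-identityʳ _))
      ... | false = sym (vanish (x ∷ []) (complete (x ∷ []) eq))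
      run-search zero (x ∷ y ∷ xs) (s≤s ())
      run-search (suc k) xs h
        rewrite run->>= G (test xs) (λ b → if b then search k (take (2 ^ k) xs) ⊕ search k (drop (2 ^ k) xs) else return 0)
        with run G (test xs) in eq
      ... | false = sym (vanish xs (complete xs eq))
      ... | true  = trans (run-⊕ G (search k (take (2 ^ k) xs)) (search k (drop (2 ^ k) xs)))
        (trans (cong₂ _+_ (run-search k (take (2 ^ k) xs) (length-first k xs)) (run-search k (drop (2 ^ k) xs) (length-second k xs h))) (halves k xs value))

    module _ (r β : ℕ) (cost-test : ∀ xs → cost G (test xs) ≤ r) (cost-leaf : ∀ x → cost G (leaf x) ≤ r + β * w x) where

      -- The first `r` pays for the test at the root. A node that tests positive has weight at least
      -- 1 and charges the tests of its two halves, 2r, to its weight; over k levels each unit of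
      -- weight pays 2kr, and at the leaf r + β.
      cost-search : ∀ k xs → length xs ≤ 2 ^ k → cost G (search k xs) ≤ r + (r + β + 2 * k * r) * ∑ xs w
      cost-search zero [] h = z≤n
      cost-search zero (x ∷ []) h rewrite cost->>= G (test (x ∷ [])) (λ b → if b then leaf x else return 0) with run G (test (x ∷ [])) in eq
      ... | false = +-mono-≤ (cost-test (x ∷ [])) z≤n
      ... | true  = +-mono-≤ (cost-test (x ∷ [])) (begin
        cost G (leaf x)           ≤⟨ cost-leaf x ⟩
        r + β * w x               ≤⟨ +-monoˡ-≤ (β * w x) (≤-trans (≤-reflexive (sym (*-identityʳ r))) (*-monoʳ-≤ r (≤-trans (sound (x ∷ []) eq) (≤-reflexive (+-identityʳ (w x)))))) ⟩
        r * w x + β * w x         ≡⟨ lem r β (w x) ⟩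
        (r + β + 0) * (w x + 0)   ∎)
        where
        open ≤-Reasoning
        lem : ∀ r β x → r * x + β * x ≡ (r + β + 0) * (x + 0)
        lem = solve-∀
      cost-search zero (x ∷ y ∷ xs) (s≤s ())
      cost-search (suc k) xs h
        rewrite cost->>= G (test xs) (λ b → if b then search k (take (2 ^ k) xs) ⊕ search k (drop (2 ^ k) xs) else return 0)
        with run G (test xs) in eq
      ... | false = +-mono-≤ (cost-test xs) z≤n
      ... | true  = +-mono-≤ (cost-test xs) (begin
        cost G (search k ls ⊕ search k rs)
          ≡⟨ cost-⊕ G (search k ls) (search k rs) ⟩
        cost G (search k ls) + cost G (search k rs)
          ≤⟨ +-mono-≤ (cost-search k ls (length-first k xs)) (cost-search k rs (length-second k xs h)) ⟩
        (r + γ * ∑ ls w) + (r + γ * ∑ rs w)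
          ≡⟨ lem₁ r γ (∑ ls w) (∑ rs w) ⟩
        2 * r * 1 + γ * (∑ ls w + ∑ rs w)
          ≡⟨ cong (λ s → 2 * r * 1 + γ * s) (halves k xs w) ⟩
        2 * r * 1 + γ * ∑ xs w
          ≤⟨ +-monoˡ-≤ (γ * ∑ xs w) (*-monoʳ-≤ (2 * r) (sound xs eq)) ⟩
        2 * r * ∑ xs w + γ * ∑ xs w
          ≡⟨ lem₂ r β k (∑ xs w) ⟩
        (r + β + 2 * suc k * r) * ∑ xs w ∎)
        where
        open ≤-Reasoning
        ls = take (2 ^ k) xs
        rs = drop (2 ^ k) xs
        γ = r + β + 2 * k * r
        lem₁ : ∀ r γ x y → (r + γ * x) + (r + γ * y) ≡ 2 * r * 1 + γ * (x + y)
        lem₁ = solve-∀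
        lem₂ : ∀ r β k s → 2 * r * s + (r + β + 2 * k * r) * s ≡ (r + β + 2 * suc k * r) * s
        lem₂ = solve-∀

-- Binary digits separating two numbers.

even? odd? : ℕ → Bool
even? zero    = true
even? (suc m) = odd? m
odd? zero    = false
odd? (suc m) = even? m

-- Each bit is listed together with its negation, so that two different numbers can be separated in
-- a prescribed direction.
digits : ℕ → List (ℕ → Bool)
digits zero    = []
digits (suc k) = even? ∷ odd? ∷ map (_∘ ⌊_/2⌋) (digits k)

length-digits : ∀ k → length (digits k) ≡ 2 * k
length-digits zero    = refl
length-digits (suc k) = trans (cong (2 +_) (trans (length-map _ (digits k)) (length-digits k))) (sym (*-distribˡ-+ 2 1 k))

parity-halves : ∀ a b → even? a ≡ even? b → ⌊ a /2⌋ ≡ ⌊ b /2⌋ → a ≡ b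
parity-halves zero zero p h = refl
parity-halves zero (suc zero) () h
parity-halves (suc zero) zero () h
parity-halves (suc zero) (suc zero) p h = refl
parity-halves (suc (suc a)) (suc (suc b)) p h = cong (suc ∘ suc) (parity-halves a b p (suc-injective h))

odd≡not-even : ∀ a → odd? a ≡ not (even? a)
odd≡not-even zero          = refl
odd≡not-even (suc zero)    = refl
odd≡not-even (suc (suc a)) = odd≡not-even a

⌊/2⌋< : ∀ k a → a < 2 ^ suc k → ⌊ a /2⌋ < 2 ^ k
⌊/2⌋< k a a< = *-cancelˡ-< 2 ⌊ a /2⌋ (2 ^ k) (≤-<-trans (2⌊/2⌋≤ a) a<)
  where
  2⌊/2⌋≤ : ∀ a → 2 * ⌊ a /2⌋ ≤ a
  2⌊/2⌋≤ zero          = z≤n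
  2⌊/2⌋≤ (suc zero)    = z≤n
  2⌊/2⌋≤ (suc (suc a)) = ≤-trans (≤-reflexive (*-distribˡ-+ 2 1 ⌊ a /2⌋)) (s≤s (s≤s (2⌊/2⌋≤ a)))

digits-separate : ∀ k {a b} → a < 2 ^ k → b < 2 ^ k → a ≢ b → ∃ λ f → f ∈ˡ digits k × f a ≡ true × f b ≡ false
digits-separate zero {zero} {zero} _ _ a≢b = ⊥-elim (a≢b refl)
digits-separate zero {suc a} (s≤s ()) _ _
digits-separate zero {_} {suc b} _ (s≤s ()) _
digits-separate (suc k) {a} {b} a< b< a≢b with even? a in ea | even? b in eb
... | true  | false = even? , here refl , ea , eb
... | false | true  = odd? , there (here refl) , trans (odd≡not-even a) (cong not ea) , trans (odd≡not-even b) (cong not eb)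
... | true  | true  = let f , f∈ , fa , fb = digits-separate k (⌊/2⌋< k a a<) (⌊/2⌋< k b b<) (λ h → a≢b (parity-halves a b (trans ea (sym eb)) h))
                      in f ∘ ⌊_/2⌋ , there (there (∈-map⁺ _ f∈)) , fa , fb
... | false | false = let f , f∈ , fa , fb = digits-separate k (⌊/2⌋< k a a<) (⌊/2⌋< k b b<) (λ h → a≢b (parity-halves a b (trans ea (sym eb)) h))
                      in f ∘ ⌊_/2⌋ , there (there (∈-map⁺ _ f∈)) , fa , fb

-- Oracle queries on sets of vertices.

∧-true : ∀ a {b} → a ∧ b ≡ true → a ≡ true × b ≡ true
∧-true true h = refl , h

∧-intro : ∀ {a b} → a ≡ true → b ≡ true → a ∧ b ≡ true
∧-intro refl refl = refl

⌊⌋-true : ∀ {P : Set} (p? : Dec P) → ⌊ p? ⌋ ≡ true → P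
⌊⌋-true (yes p) _ = p

⌊⌋-intro : ∀ {P : Set} (p? : Dec P) → P → ⌊ p? ⌋ ≡ true
⌊⌋-intro (yes _) _ = refl
⌊⌋-intro (no ¬p) p = ⊥-elim (¬p p)

any⁺ : ∀ {f : A → Bool} {x xs} → x ∈ˡ xs → f x ≡ true → any f xs ≡ true
any⁺ (here refl) h rewrite h = refl
any⁺ {f = f} {xs = y ∷ _} (there x∈) h rewrite any⁺ {f = f} x∈ h = Bool.∨-zeroʳ (f y)

any⁻ : ∀ {f : A → Bool} xs → any f xs ≡ true → ∃ λ x → f x ≡ true
any⁻ {f = f} (x ∷ xs) h with f x in eq
... | true  = x , eq
... | false = any⁻ xs h

anyFin⁺ : ∀ {f : Fin n → Bool} i → f i ≡ true → anyFin f ≡ true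
anyFin⁺ i = any⁺ (∈-allFin i)

TIS⁺ : ∀ (G : Graph n) {A B C a b c} → a ∈ A → b ∈ B → c ∈ C → isTri G a b c ≡ true → TIS G A B C ≡ true
TIS⁺ G {A} {B} {C} {a} {b} {c} a∈ b∈ c∈ h =
  anyFin⁺ a (anyFin⁺ b (anyFin⁺ c
    (∧-intro (⌊⌋-intro (a ∈? A) a∈) (∧-intro (⌊⌋-intro (b ∈? B) b∈) (∧-intro (⌊⌋-intro (c ∈? C) c∈) h)))))

TIS⁻ : ∀ (G : Graph n) {A B C} → TIS G A B C ≡ true →
  ∃ λ a → ∃ λ b → ∃ λ c → a ∈ A × b ∈ B × c ∈ C × isTri G a b c ≡ true
TIS⁻ {n} G {A} {B} {C} h with any⁻ (allFin n) h
... | a , ha with any⁻ (allFin n) ha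
... | b , hb with any⁻ (allFin n) hb
... | c , hc with ∧-true ⌊ a ∈? A ⌋ hc
... | a∈ , h₁ with ∧-true ⌊ b ∈? B ⌋ h₁
... | b∈ , h₂ with ∧-true ⌊ c ∈? C ⌋ h₂
... | c∈ , abc = a , b , c , ⌊⌋-true (a ∈? A) a∈ , ⌊⌋-true (b ∈? B) b∈ , ⌊⌋-true (c ∈? C) c∈ , abc

isTri-distinct : ∀ (G : Graph n) {a b c} → isTri G a b c ≡ true → a ≢ b × b ≢ c × c ≢ a
isTri-distinct G {a} {b} {c} h with ∧-true (adj G a b) h
... | ab , h₁ with ∧-true (adj G b c) h₁
... | bc , ac = loop ab , loop bc , λ { refl → loop ac refl }
  where
  loop : ∀ {u v} → adj G u v ≡ true → u ≢ v
  loop {u} uv refl with trans (sym uv) (irrefl G u)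
  ... | ()

-- Used for the pairs (f, h), (g, f), (h, g): any two of these parts are disjoint because one of the
-- three tests takes opposite values on them.
part : (f g : ℕ → Bool) → List (Fin n) → Subset n
part f g xs = tabulate λ v → (f (toℕ v) ∧ not (g (toℕ v))) ∧ ⌊ _∈ˡ?_ Fin._≟_ v xs ⌋

∈-part⁺ : ∀ f g {xs} {v : Fin n} → f (toℕ v) ≡ true → g (toℕ v) ≡ false → v ∈ˡ xs → v ∈ part f g xs
∈-part⁺ f g {xs} {v} fv gv v∈ = lookup⇒[]= v _ (trans (lookup∘tabulate _ v)
  (∧-intro (∧-intro fv (cong not gv)) (⌊⌋-intro (_∈ˡ?_ Fin._≟_ v xs) v∈)))

∈-part⁻ : ∀ f g xs {v : Fin n} → v ∈ part f g xs → (f (toℕ v) ≡ true × g (toℕ v) ≡ false) × v ∈ˡ xs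
∈-part⁻ f g xs {v} h with ∧-true (f (toℕ v) ∧ not (g (toℕ v))) (trans (sym (lookup∘tabulate _ v)) ([]=⇒lookup h))
... | fgv , v∈ with ∧-true (f (toℕ v)) fgv
... | fv , gv = (fv , Bool.not-injective gv) , ⌊⌋-true (_∈ˡ?_ Fin._≟_ v xs) v∈

valid? : ∀ (A B C : Subset n) → Dec (ValidQuery A B C)
valid? A B C = nonempty? A ×-dec nonempty? B ×-dec nonempty? C ×-dec
  ≡-dec Bool._≟_ (A ∩ B) ∅ ×-dec ≡-dec Bool._≟_ (B ∩ C) ∅ ×-dec ≡-dec Bool._≟_ (A ∩ C) ∅

-- Validity is decidable without the oracle. Answering an invalid triple with `false` is harmless,
-- since every triangle is found by some valid query.
askIfValid : ∀ (A B C : Subset n) → Tree n Bool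
askIfValid A B C with valid? A B C
... | yes v = ask A B C v return
... | no  _ = return false

cost-askIfValid : ∀ (G : Graph n) A B C → cost G (askIfValid A B C) ≤ 1
cost-askIfValid G A B C with valid? A B C
... | yes v = ≤-refl
... | no  _ = z≤n

run-askIfValid⁺ : ∀ (G : Graph n) {A B C} → ValidQuery A B C → TIS G A B C ≡ true → run G (askIfValid A B C) ≡ true
run-askIfValid⁺ G {A} {B} {C} v h with valid? A B C
... | yes _ = h
... | no ¬v = ⊥-elim (¬v v)

run-askIfValid⁻ : ∀ (G : Graph n) {A B C} → run G (askIfValid A B C) ≡ true → TIS G A B C ≡ true
run-askIfValid⁻ G {A} {B} {C} h with valid? A B C
... | yes _ = h
run-askIfValid⁻ G () | no _

-- Testing arbitrary vertex lists for a triangle.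

∈-∑ : ∀ {x : A} {xs} (f : A → ℕ) → x ∈ˡ xs → f x ≤ ∑ xs f
∈-∑ {xs = _ ∷ xs} f (here refl) = m≤m+n _ (∑ xs f)
∈-∑ {xs = y ∷ _}  f (there x∈)  = ≤-trans (∈-∑ f x∈) (m≤n+m _ (f y))

∑-positive : ∀ (xs : List A) (f : A → ℕ) → 1 ≤ ∑ xs f → ∃ λ x → x ∈ˡ xs × 1 ≤ f x
∑-positive (x ∷ xs) f h with f x in eq
... | suc _ = x , here refl , ≤-trans (s≤s z≤n) (≤-reflexive (sym eq))
... | zero  = let y , y∈ , hy = ∑-positive xs f h in y , there y∈ , hy

ind-positive : ∀ {b} → 1 ≤ ind b → b ≡ true
ind-positive {true} _ = refl

tri : Graph n → Fin n → Fin n → Fin n → ℕ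
tri G a b c = ind (isTri G a b c)

triangles : Graph n → (xs ys zs : List (Fin n)) → ℕ
triangles G xs ys zs = ∑ xs λ a → ∑ ys λ b → ∑ zs λ c → tri G a b c

-- The oracle accepts disjoint sets only, so arbitrary sets are first split by binary digits f, g, h: a triangle (a,b,c)
-- is seen when f separates a from b, g separates b from c and h separates c from a.
exists : ℕ → (xs ys zs : List (Fin n)) → Tree n Bool
exists {n} k xs ys zs = disjunction (digits k) λ f → disjunction (digits k) λ g → disjunction (digits k) λ h →
  askIfValid (part f h xs) (part g f ys) (part h g zs)

existsCost : ℕ → ℕ
existsCost k = 2 * k * (2 * k * (2 * k * 1))

cost-exists : ∀ (G : Graph n) k xs ys zs → cost G (exists k xs ys zs) ≤ existsCost k
cost-exists G k xs ys zs = subst (λ l → cost G (exists k xs ys zs) ≤ l * (l * (l * 1))) (length-digits k)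
  (cost-disjunction G (digits k) _ λ f → cost-disjunction G (digits k) _ λ g → cost-disjunction G (digits k) _ λ h → cost-askIfValid G _ _ _)

exists-sound : ∀ (G : Graph n) k xs ys zs → run G (exists k xs ys zs) ≡ true → 1 ≤ triangles G xs ys zs
exists-sound G k xs ys zs r =
  let f , rf = disjunction⁻ G (digits k) r
      g , rg = disjunction⁻ G (digits k) rf
      h , rh = disjunction⁻ G (digits k) rg
      a , b , c , a∈ , b∈ , c∈ , abc = TIS⁻ G (run-askIfValid⁻ G rh)
  in begin
    1                                           ≡⟨ cong ind (sym abc) ⟩
    tri G a b c                                 ≤⟨ ∈-∑ {xs = zs} (λ c → tri G a b c) (proj₂ (∈-part⁻ h g zs c∈)) ⟩
    (∑ zs λ c → tri G a b c)                    ≤⟨ ∈-∑ {xs = ys} (λ b → ∑ zs λ c → tri G a b c) (proj₂ (∈-part⁻ g f ys b∈)) ⟩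
    (∑ ys λ b → ∑ zs λ c → tri G a b c)         ≤⟨ ∈-∑ {xs = xs} (λ a → ∑ ys λ b → ∑ zs λ c → tri G a b c) (proj₂ (∈-part⁻ f h xs a∈)) ⟩
    triangles G xs ys zs                        ∎
  where open ≤-Reasoning

part-disjoint : ∀ f g h i (xs ys : List (Fin n)) → (∀ v → f v ≡ true → g v ≡ false → h v ≡ true → i v ≡ false → ⊥) →
  part f g xs ∩ part h i ys ≡ ∅
part-disjoint f g h i xs ys contra = Empty-unique λ (v , v∈) →
  let v∈xs , v∈ys = x∈p∩q⁻ (part f g xs) (part h i ys) v∈
      (fv , gv) , _ = ∈-part⁻ f g xs v∈xs
      (hv , iv) , _ = ∈-part⁻ h i ys v∈ys
  in contra (toℕ v) fv gv hv iv

-- The vertices of a triangle are distinct, so each cyclic pair has a separating digit. The query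
-- for these three digits is valid and contains the triangle.
exists-complete : ∀ (G : Graph n) k xs ys zs → n ≤ 2 ^ k → run G (exists k xs ys zs) ≡ false → triangles G xs ys zs ≡ 0
exists-complete {n} G k xs ys zs n≤ r with triangles G xs ys zs in eq
... | zero  = refl
... | suc m with ∑-positive xs (λ a → ∑ ys λ b → ∑ zs λ c → tri G a b c) (≤-trans (s≤s z≤n) (≤-reflexive (sym eq)))
... | a , a∈ , ha with ∑-positive ys (λ b → ∑ zs λ c → tri G a b c) ha
... | b , b∈ , hb with ∑-positive zs (λ c → tri G a b c) hb
... | c , c∈ , hc = ⊥-elim (absurd (trans (sym r) found))
  where
  absurd : false ≢ true
  absurd ()
  abc : isTri G a b c ≡ true
  abc = ind-positive hc
  small : ∀ v → toℕ v < 2 ^ k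
  small v = <-≤-trans (Fin.toℕ<n v) n≤
  separate : ∀ {u v} → u ≢ v → ∃ λ f → f ∈ˡ digits k × f (toℕ u) ≡ true × f (toℕ v) ≡ false
  separate {u} {v} u≢v = digits-separate k (small u) (small v) (λ h → u≢v (Fin.toℕ-injective h))
  clash : ∀ {b} → b ≡ true → b ≡ false → ⊥
  clash refl ()
  found : run G (exists k xs ys zs) ≡ true
  found =
    let a≢b , b≢c , c≢a = isTri-distinct G abc
        f , f∈ , fa , fb = separate a≢b
        g , g∈ , gb , gc = separate b≢c
        h , h∈ , hc , ha = separate c≢a
        a∈A = ∈-part⁺ f h fa ha a∈
        b∈B = ∈-part⁺ g f gb fb b∈
        c∈C = ∈-part⁺ h g hc gc c∈
        valid = (a , a∈A) , (b , b∈B) , (c , c∈C)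
          , part-disjoint f h g f xs ys (λ v fv _ _ fv′ → clash fv fv′)
          , part-disjoint g f h g ys zs (λ v gv _ _ gv′ → clash gv gv′)
          , part-disjoint f h h g xs zs (λ v _ hv′ hv _ → clash hv hv′)
    in disjunction⁺ G f∈ (disjunction⁺ G g∈ (disjunction⁺ G h∈ (run-askIfValid⁺ G valid (TIS⁺ G a∈A b∈B c∈C abc))))

-- Listing the triangles of a sample by three nested searches.

module Rates (k : ℕ) where

  -- The costs per triangle of the searches for the third, second and first vertex: each is the rate
  -- in `cost-search` with the previous one as its leaf rate.
  β₁ β₂ β₃ : ℕ
  β₁ = existsCost k + 0 + 2 * k * existsCost k
  β₂ = existsCost k + β₁ + 2 * k * existsCost k
  β₃ = existsCost k + β₂ + 2 * k * existsCost k

module Count {n : ℕ} (k : ℕ) where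

  open Rates k

  linkRow : Fin n → List (Fin n) → Fin n → Tree n ℕ
  linkRow a zs b = Search.search (λ zs → exists k (a ∷ []) (b ∷ []) zs) (λ _ → return 1) k zs

  link : (ys zs : List (Fin n)) → Fin n → Tree n ℕ
  link ys zs a = Search.search (λ ys → exists k (a ∷ []) ys zs) (linkRow a zs) k ys

  sumLinks : (ℕ → ℕ) → (xs ys zs : List (Fin n)) → Tree n ℕ
  sumLinks g xs ys zs = Search.search (λ xs → exists k xs ys zs) (λ a → link ys zs a >>= λ m → return (g m)) k xs

  module _ (n≤ : n ≤ 2 ^ k) (G : Graph n) where

    row : Fin n → List (Fin n) → Fin n → ℕ
    row a zs b = ∑ zs λ c → tri G a b c

    private
      row≡ : ∀ a b zs → triangles G (a ∷ []) (b ∷ []) zs ≡ row a zs b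
      row≡ a b zs = trans (+-identityʳ _) (+-identityʳ _)

      row-sound : ∀ a b zs → run G (exists k (a ∷ []) (b ∷ []) zs) ≡ true → 1 ≤ row a zs b
      row-sound a b zs r = ≤-trans (exists-sound G k (a ∷ []) (b ∷ []) zs r) (≤-reflexive (row≡ a b zs))

      row-complete : ∀ a b zs → run G (exists k (a ∷ []) (b ∷ []) zs) ≡ false → row a zs b ≡ 0
      row-complete a b zs r = trans (sym (row≡ a b zs)) (exists-complete G k (a ∷ []) (b ∷ []) zs n≤ r)

      link-sound : ∀ a ys zs → run G (exists k (a ∷ []) ys zs) ≡ true → 1 ≤ ∑ ys (row a zs)
      link-sound a ys zs r = ≤-trans (exists-sound G k (a ∷ []) ys zs r) (≤-reflexive (+-identityʳ _))

      link-complete : ∀ a ys zs → run G (exists k (a ∷ []) ys zs) ≡ false → ∑ ys (row a zs) ≡ 0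
      link-complete a ys zs r = trans (sym (+-identityʳ _)) (exists-complete G k (a ∷ []) ys zs n≤ r)

    run-linkRow : ∀ a zs b → length zs ≤ 2 ^ k → run G (linkRow a zs b) ≡ row a zs b
    run-linkRow a zs b = Search.run-search _ _ G (tri G a b) (row-sound a b) (row-complete a b) (tri G a b)
      (λ c h → sym (cong ind (ind-positive h))) (λ _ h → h) k zs

    cost-linkRow : ∀ a zs b → length zs ≤ 2 ^ k → cost G (linkRow a zs b) ≤ existsCost k + β₁ * row a zs b
    cost-linkRow a zs b = Search.cost-search _ _ G (tri G a b) (row-sound a b) (row-complete a b) (existsCost k) 0
      (λ zs → cost-exists G k (a ∷ []) (b ∷ []) zs) (λ _ → z≤n) k zs

    run-link : ∀ ys zs a → length ys ≤ 2 ^ k → length zs ≤ 2 ^ k → run G (link ys zs a) ≡ ∑ ys (row a zs)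
    run-link ys zs a hys hzs = Search.run-search _ _ G (row a zs) (λ ys → link-sound a ys zs) (λ ys → link-complete a ys zs) (row a zs)
      (λ b _ → run-linkRow a zs b hzs) (λ _ h → h) k ys hys

    cost-link : ∀ ys zs a → length ys ≤ 2 ^ k → length zs ≤ 2 ^ k → cost G (link ys zs a) ≤ existsCost k + β₂ * ∑ ys (row a zs)
    cost-link ys zs a hys hzs = Search.cost-search _ _ G (row a zs) (λ ys → link-sound a ys zs) (λ ys → link-complete a ys zs) (existsCost k) β₁
      (λ ys → cost-exists G k (a ∷ []) ys zs) (λ b → cost-linkRow a zs b hzs) k ys hys

    module _ (g : ℕ → ℕ) (xs ys zs : List (Fin n)) (hxs : length xs ≤ 2 ^ k) (hys : length ys ≤ 2 ^ k) (hzs : length zs ≤ 2 ^ k) where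

      -- The search prunes first vertices without a triangle; g 0 = 0 makes their terms vanish.
      run-sumLinks : g 0 ≡ 0 → run G (sumLinks g xs ys zs) ≡ ∑ xs λ a → g (∑ ys (row a zs))
      run-sumLinks g0 = Search.run-search _ _ G (λ a → ∑ ys (row a zs)) (λ xs → exists-sound G k xs ys zs)
        (λ xs → exists-complete G k xs ys zs n≤) (λ a → g (∑ ys (row a zs)))
        (λ a _ → trans (run->>= G (link ys zs a) (λ m → return (g m))) (cong g (run-link ys zs a hys hzs)))
        (λ a h → trans (cong g h) g0) k xs hxs

      cost-sumLinks : cost G (sumLinks g xs ys zs) ≤ existsCost k + β₃ * triangles G xs ys zs
      cost-sumLinks = Search.cost-search _ _ G (λ a → ∑ ys (row a zs)) (λ xs → exists-sound G k xs ys zs)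
        (λ xs → exists-complete G k xs ys zs n≤) (existsCost k) β₂ (λ xs → cost-exists G k xs ys zs)
        (λ a → ≤-trans (≤-reflexive (trans (cost->>= G (link ys zs a) (λ m → return (g m))) (+-identityʳ _))) (cost-link ys zs a hys hzs)) k xs hxs

-- The estimator for one guess.

ind-mono : ∀ {a b} → (a ≡ true → b ≡ true) → ind a ≤ ind b
ind-mono {false} h = z≤n
ind-mono {true}  h rewrite h refl = ≤-refl

ind≤1 : ∀ b → ind b ≤ 1
ind≤1 true  = ≤-refl
ind≤1 false = z≤n

<ᵇ-true : ∀ {m n} → m < n → (m <ᵇ n) ≡ true
<ᵇ-true {m} {n} m<n with m <ᵇ n in eq
... | true  = refl
... | false with subst Bool.T eq (<⇒<ᵇ m<n)
... | ()

-- Union bound: a run within its budget returns the untruncated value.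
truncation-error : ∀ {n} (G : Graph n) w (t : Tree n ℕ) T F S →
  ind (T <ᵇ F * ∣ run G (truncate w 0 t) - S ∣) ≤ ind (w <ᵇ cost G t) + ind (T <ᵇ F * ∣ run G t - S ∣)
truncation-error G w t T F S with cost G t ≤? w
... | yes c≤ = ≤-trans (≤-reflexive (cong (λ x → ind (T <ᵇ F * ∣ x - S ∣)) (run-truncate G w 0 t c≤))) (m≤n+m _ (ind (w <ᵇ cost G t)))
... | no  c≰ = ≤-trans (ind≤1 (T <ᵇ F * ∣ run G (truncate w 0 t) - S ∣))
  (≤-trans (≤-reflexive (sym (cong ind (<ᵇ-true (≰⇒> c≰))))) (m≤m+n (ind (w <ᵇ cost G t)) _))

-- An upper bound for the expected number of queries spent on one level.
levelCost : ℕ → ℕ → ℕ → ℕ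
levelCost L d D = existsCost L + Rates.β₃ L * (2 * (D * D * (4 * threshold d D)))

-- By Markov's inequality this is exceeded with probability at most 1/128.
budget : ℕ → ℕ → ℕ → ℕ
budget L d D = 128 * suc (suc L * levelCost L d D)

module Estimator (n L d D T : ℕ) (1≤d : 1 ≤ d) (1≤D : 1 ≤ D) where

  open Schedule d D T 1≤d 1≤D public
  open Count {n} L public
  open Rates L using (β₃)

  V : List (Fin n)
  V = allFin n

  levelTree : Level d D T κ → Seed → Tree n ℕ
  levelTree ℓ (A , B , C) =
    sumLinks (λ m → clip lo hi ((suc q * suc q) * m)) (select A V) (select B V) (select C V) >>= λ s → return (suc p * s)
    where open Level ℓ

  estimateTree : List (Level d D T κ) → List Seed → Tree n ℕ
  estimateTree []       _        = return 0
  estimateTree (_ ∷ _)  []       = return 0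
  estimateTree (ℓ ∷ ls) (ω ∷ ωs) = levelTree ℓ ω ⊕ estimateTree ls ωs

  Ω : List (List Seed)
  Ω = sequences (map (λ ℓ → Level.space ℓ (length V)) (schedule L))

  sample : List Seed → Tree n ℕ
  sample ω = truncate (budget L d D) 0 (estimateTree (schedule L) ω)

  module Correct (G : Graph n) (n≤ : n ≤ 2 ^ L) where

    open Quality V (tri G) public

    short : ∀ A → length (select A V) ≤ 2 ^ L
    short A = ≤-trans (length-select A V) (≤-trans (≤-reflexive (length-tabulate (λ i → i))) n≤)

    run-levelTree : ∀ ℓ ω → run G (levelTree ℓ ω) ≡ At.estimate ℓ ω
    run-levelTree ℓ (A , B , C) = trans (run->>= G (sumLinks g (select A V) (select B V) (select C V)) (λ s → return (suc p * s)))
      (cong (suc p *_) (run-sumLinks n≤ G g (select A V) (select B V) (select C V) (short A) (short B) (short C)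
        (trans (cong (clip lo hi) (*-zeroʳ (suc q * suc q))) (0∸n≡0 lo))))
      where
      open Level ℓ
      g : ℕ → ℕ
      g m = clip lo hi ((suc q * suc q) * m)

    run-estimateTree : ∀ ls ωs → run G (estimateTree ls ωs) ≡ estimates ls ωs
    run-estimateTree []       _        = refl
    run-estimateTree (_ ∷ _)  []       = refl
    run-estimateTree (ℓ ∷ ls) (ω ∷ ωs) = trans (run-⊕ G (levelTree ℓ ω) (estimateTree ls ωs)) (cong₂ _+_ (run-levelTree ℓ ω) (run-estimateTree ls ωs))

    cost-levelTree : ∀ ℓ ω → cost G (levelTree ℓ ω) ≤ existsCost L + β₃ * At.triples ℓ ω
    cost-levelTree ℓ (A , B , C) = ≤-trans (≤-reflexive (trans (cost->>= G (sumLinks g (select A V) (select B V) (select C V)) (λ s → return (suc p * s))) (+-identityʳ _)))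
      (cost-sumLinks n≤ G g (select A V) (select B V) (select C V) (short A) (short B) (short C))
      where
      open Level ℓ
      g : ℕ → ℕ
      g m = clip lo hi ((suc q * suc q) * m)

    module _ (degrees : (∀ a b → ∑ V (tri G a b) ≤ d) × (∀ a c → (∑ V λ b → tri G a b c) ≤ d))
      (deg≤ : ∀ a → deg a ≤ 4 ^ L) (1≤T : 1 ≤ T) (S≤2T : S ≤ 2 * T) where

      private
        N : ℕ
        N = length Ω

      ∑-cost : (∑ Ω λ ω → cost G (estimateTree (schedule L) ω)) ≤ N * (suc L * levelCost L d D)
      ∑-cost = ≤-trans (∑-subadditive At.space (λ ℓ ω → existsCost L + β₃ * At.triples ℓ ω) (levelCost L d D) (λ ls ω → cost G (estimateTree ls ω))
        (λ ℓ → begin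
          (∑ (At.space ℓ) λ ω → existsCost L + β₃ * At.triples ℓ ω)
            ≡⟨ trans (∑-+ (At.space ℓ) (λ _ → existsCost L) _) (cong₂ _+_ (∑-const (At.space ℓ) (existsCost L)) (∑-*ˡ (At.space ℓ) β₃ (At.triples ℓ))) ⟩
          length (At.space ℓ) * existsCost L + β₃ * ∑ (At.space ℓ) (At.triples ℓ)
            ≤⟨ +-monoʳ-≤ _ (*-monoʳ-≤ β₃ (∑-triples 1≤T S≤2T ℓ)) ⟩
          length (At.space ℓ) * existsCost L + β₃ * (length (At.space ℓ) * (2 * (D * D * κ)))
            ≡⟨ lem (length (At.space ℓ)) (existsCost L) β₃ (2 * (D * D * κ)) ⟩
          length (At.space ℓ) * levelCost L d D ∎)
        refl
        (λ ℓ ω ls ωs → ≤-trans (≤-reflexive (cost-⊕ G (levelTree ℓ ω) (estimateTree ls ωs))) (+-monoˡ-≤ _ (cost-levelTree ℓ ω)))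
        (schedule L)) (≤-reflexive (cong (λ l → N * (l * levelCost L d D)) (length-schedule L)))
        where
        open ≤-Reasoning
        lem : ∀ l r b x → l * r + b * (l * x) ≡ l * (r + b * x)
        lem = solve-∀

      -- Markov's inequality; the successor in `budget` keeps the cancelled factor positive.
      overrun : 128 * (∑ Ω λ ω → ind (budget L d D <ᵇ cost G (estimateTree (schedule L) ω))) ≤ N
      overrun = *-cancelˡ-≤ (suc U) (begin
        suc U * (128 * I)         ≡⟨ lem 128 (suc U) I ⟩
        budget L d D * I                ≤⟨ markov Ω (λ ω → cost G (estimateTree (schedule L) ω)) (budget L d D) ⟩
        (∑ Ω λ ω → cost G (estimateTree (schedule L) ω)) ≤⟨ ∑-cost ⟩
        N * U                     ≤⟨ *-monoʳ-≤ N (n≤1+n U) ⟩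
        N * suc U                 ≡⟨ *-comm N (suc U) ⟩
        suc U * N                 ∎)
        where
        open ≤-Reasoning
        U = suc L * levelCost L d D
        I = ∑ Ω λ ω → ind (budget L d D <ᵇ cost G (estimateTree (schedule L) ω))
        lem : ∀ c u i → u * (c * i) ≡ c * u * i
        lem = solve-∀

      module _ (F : ℕ) (1≤F : 1 ≤ F) (D≡ : D ≡ 9 * (64 * (F * suc L))) where

        -- Markov's inequality. In `D`, the factor `suc L` pays for the number of layers, 9 for the
        -- error 9T of each, `F` for the precision, and 64 together with the 2 in 2D for the
        -- probability 1/128.
        inaccurate : 128 * (∑ Ω λ ω → ind (T <ᵇ F * ∣ estimates (schedule L) ω - S ∣)) ≤ N
        inaccurate = *-cancelˡ-≤ (9 * (F * suc L) * T) {{>-nonZero (*-mono-≤ (*-mono-≤ {1} {9} {1} (s≤s z≤n) (*-mono-≤ 1≤F (s≤s {0} {L} z≤n))) 1≤T)}} (begin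
          9 * (F * suc L) * T * (128 * I)
            ≡⟨ lem₁ 64 (F * suc L) T I ⟩
          2 * (9 * (64 * (F * suc L))) * (T * I)
            ≡⟨ cong (λ D → 2 * D * (T * I)) (sym D≡) ⟩
          2 * D * (T * I)
            ≤⟨ *-monoʳ-≤ (2 * D) (markov Ω (λ ω → F * y ω) T) ⟩
          2 * D * (∑ Ω λ ω → F * y ω)
            ≡⟨ trans (cong (2 * D *_) (∑-*ˡ Ω F y)) (lem₂ (2 * D) F (∑ Ω y)) ⟩
          F * (2 * D * ∑ Ω y)
            ≡⟨ cong (F *_) (sym (∑-*ˡ Ω (2 * D) y)) ⟩
          F * (∑ Ω λ ω → 2 * D * y ω)
            ≡⟨ cong (λ s → F * (∑ Ω λ ω → 2 * D * ∣ estimates (schedule L) ω - s ∣)) (sym (targets-schedule L deg≤)) ⟩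
          F * (∑ Ω λ ω → 2 * D * ∣ estimates (schedule L) ω - targets (schedule L) ∣)
            ≤⟨ *-monoʳ-≤ F (∑-estimates-error 1≤T S≤2T (proj₁ degrees) (proj₂ degrees) (λ a b c → ind≤1 (isTri G a b c)) (schedule L)) ⟩
          F * (N * (length (schedule L) * (9 * T)))
            ≡⟨ cong (λ l → F * (N * (l * (9 * T)))) (length-schedule L) ⟩
          F * (N * (suc L * (9 * T)))
            ≡⟨ lem₃ F N (suc L) T ⟩
          9 * (F * suc L) * T * N ∎)
          where
          open ≤-Reasoning
          y : List Seed → ℕ
          y ω = ∣ estimates (schedule L) ω - S ∣
          I = ∑ Ω λ ω → ind (T <ᵇ F * y ω)
          lem₁ : ∀ c x t i → 9 * x * t * (2 * c * i) ≡ 2 * (9 * (c * x)) * (t * i)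
          lem₁ = solve-∀
          lem₂ : ∀ a f x → a * (f * x) ≡ f * (a * x)
          lem₂ = solve-∀
          lem₃ : ∀ F N l t → F * (N * (l * (9 * t))) ≡ 9 * (F * l) * t * N
          lem₃ = solve-∀

        sample-error : 64 * (∑ Ω λ ω → ind (T <ᵇ F * ∣ run G (sample ω) - S ∣)) ≤ N
        sample-error = *-cancelˡ-≤ 2 (begin
          2 * (64 * (∑ Ω λ ω → ind (T <ᵇ F * ∣ run G (sample ω) - S ∣)))
            ≤⟨ *-monoʳ-≤ 2 (*-monoʳ-≤ 64 (≤-trans (∑-mono Ω pointwise) (≤-reflexive (∑-+ Ω _ _)))) ⟩
          2 * (64 * (I + J))
            ≡⟨ lem 64 I J ⟩
          128 * I + 128 * J
            ≤⟨ +-mono-≤ overrun inaccurate ⟩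
          N + N
            ≡⟨ cong (N +_) (sym (+-identityʳ N)) ⟩
          2 * N ∎)
          where
          open ≤-Reasoning
          I = ∑ Ω λ ω → ind (budget L d D <ᵇ cost G (estimateTree (schedule L) ω))
          J = ∑ Ω λ ω → ind (T <ᵇ F * ∣ estimates (schedule L) ω - S ∣)
          lem : ∀ c i j → 2 * (c * (i + j)) ≡ 2 * c * i + 2 * c * j
          lem = solve-∀
          pointwise : ∀ ω → ind (T <ᵇ F * ∣ run G (sample ω) - S ∣)
            ≤ ind (budget L d D <ᵇ cost G (estimateTree (schedule L) ω)) + ind (T <ᵇ F * ∣ estimates (schedule L) ω - S ∣)
          pointwise ω = ≤-trans (truncation-error G (budget L d D) (estimateTree (schedule L) ω) T F S)
            (≤-reflexive (cong (λ x → ind (budget L d D <ᵇ cost G (estimateTree (schedule L) ω)) + ind (T <ᵇ F * ∣ x - S ∣)) (run-estimateTree (schedule L) ω)))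

-- Amplification by a vote.

-- Short lists of seeds are padded with the value 0, so that there are always m values.
values : ℕ → (A → ℕ) → List A → List ℕ
values zero    v _        = []
values (suc m) v []       = 0 ∷ values m v []
values (suc m) v (ω ∷ ωs) = v ω ∷ values m v ωs

length-values : ∀ m (v : A → ℕ) ωs → length (values m v ωs) ≡ m
length-values zero    v ωs       = refl
length-values (suc m) v []       = cong suc (length-values m v [])
length-values (suc m) v (ω ∷ ωs) = cong suc (length-values m v ωs)

length-power : ∀ m (Ω : List A) → length (sequences (replicate m Ω)) ≡ length Ω ^ m
length-power zero    Ω = refl
length-power (suc m) Ω = trans (length-sequences Ω (replicate m Ω)) (cong (length Ω *_) (length-power m Ω))

-- By independence the moment is a product. Each factor is at most 1 + c times the indicator of a
-- bad value, whose mean is at most 2.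
exponential-moment : ∀ (Ω : List A) (v : A → ℕ) (bad : ℕ → Bool) c .{{_ : NonZero c}} →
  c * (∑ Ω λ ω → ind (bad (v ω))) ≤ length Ω → ∀ m →
  (∑ (sequences (replicate m Ω)) λ ωs → c ^ ∑ (values m v ωs) (λ x → ind (bad x))) ≤ (2 * length Ω) ^ m
exponential-moment Ω v bad c rare zero    = ≤-refl
exponential-moment Ω v bad c rare (suc m) = begin
  (∑ (sequences (replicate (suc m) Ω)) λ ωs → c ^ count (suc m) ωs)
    ≡⟨ ∑-sequences Ω (replicate m Ω) (λ ωs → c ^ count (suc m) ωs) ⟩
  (∑ Ω λ ω → ∑ Ωᵐ λ ωs → c ^ (ind (bad (v ω)) + count m ωs))
    ≡⟨ ∑-cong Ω (λ ω → trans (∑-cong Ωᵐ λ ωs → ^-distribˡ-+-* c (ind (bad (v ω))) (count m ωs)) (∑-*ˡ Ωᵐ (c ^ ind (bad (v ω))) λ ωs → c ^ count m ωs)) ⟩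
  (∑ Ω λ ω → c ^ ind (bad (v ω)) * M)
    ≤⟨ ∑-mono Ω (λ ω → *-monoˡ-≤ M (single (bad (v ω)))) ⟩
  (∑ Ω λ ω → (1 + c * ind (bad (v ω))) * M)
    ≡⟨ trans (∑-cong Ω λ ω → *-comm (1 + c * ind (bad (v ω))) M) (trans (∑-*ˡ Ω M λ ω → 1 + c * ind (bad (v ω))) (*-comm M _)) ⟩
  (∑ Ω λ ω → 1 + c * ind (bad (v ω))) * M
    ≡⟨ cong (_* M) (trans (∑-+ Ω (λ _ → 1) _) (cong₂ _+_ (trans (∑-const Ω 1) (*-identityʳ (length Ω))) (∑-*ˡ Ω c λ ω → ind (bad (v ω))))) ⟩
  (length Ω + c * (∑ Ω λ ω → ind (bad (v ω)))) * M
    ≤⟨ *-mono-≤ (≤-trans (+-monoʳ-≤ (length Ω) rare) (≤-reflexive (cong (length Ω +_) (sym (+-identityʳ (length Ω)))))) (exponential-moment Ω v bad c rare m) ⟩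
  2 * length Ω * (2 * length Ω) ^ m ∎
  where
  open ≤-Reasoning
  Ωᵐ = sequences (replicate m Ω)
  count : ∀ k → List _ → ℕ
  count k ωs = ∑ (values k v ωs) (λ x → ind (bad x))
  M = ∑ Ωᵐ λ ωs → c ^ count m ωs
  single : ∀ b → c ^ ind b ≤ 1 + c * ind b
  single true  = n≤1+n (c * 1)
  single false = m≤m+n 1 (c * 0)

^-distribʳ-* : ∀ a b k → (a * b) ^ k ≡ a ^ k * b ^ k
^-distribʳ-* a b zero    = refl
^-distribʳ-* a b (suc k) = trans (cong (a * b *_) (^-distribʳ-* a b k)) (lem a b (a ^ k) (b ^ k))
  where
  lem : ∀ a b x y → a * b * (x * y) ≡ a * x * (b * y)
  lem = solve-∀

-- Markov's inequality for 64 to the number of bad values: k bad ones among 2k have probability at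
-- most 2^(2k)/64^k = 1/16^k.
majority-tail : ∀ (Ω : List A) (v : A → ℕ) (bad : ℕ → Bool) → 64 * (∑ Ω λ ω → ind (bad (v ω))) ≤ length Ω → ∀ k →
  16 ^ k * (∑ (sequences (replicate (2 * k) Ω)) λ ωs → ind (k ≤ᵇ ∑ (values (2 * k) v ωs) λ x → ind (bad x)))
  ≤ length (sequences (replicate (2 * k) Ω))
majority-tail Ω v bad rare k = *-cancelˡ-≤ (4 ^ k) {{m^n≢0 4 k}} (begin
  4 ^ k * (16 ^ k * ∑ Ωᵐ hit)
    ≡⟨ trans (sym (*-assoc (4 ^ k) (16 ^ k) _)) (cong (_* ∑ Ωᵐ hit) (sym (^-distribʳ-* 4 16 k))) ⟩
  64 ^ k * ∑ Ωᵐ hit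
    ≡⟨ sym (∑-*ˡ Ωᵐ (64 ^ k) hit) ⟩
  (∑ Ωᵐ λ ωs → 64 ^ k * hit ωs)
    ≤⟨ ∑-mono Ωᵐ pointwise ⟩
  (∑ Ωᵐ λ ωs → 64 ^ count ωs)
    ≤⟨ exponential-moment Ω v bad 64 rare (2 * k) ⟩
  (2 * length Ω) ^ (2 * k)
    ≡⟨ ^-distribʳ-* 2 (length Ω) (2 * k) ⟩
  2 ^ (2 * k) * length Ω ^ (2 * k)
    ≡⟨ cong₂ _*_ (sym (^-*-assoc 2 2 k)) (sym (length-power (2 * k) Ω)) ⟩
  4 ^ k * length Ωᵐ ∎)
  where
  open ≤-Reasoning
  Ωᵐ = sequences (replicate (2 * k) Ω)
  count hit : List _ → ℕ
  count ωs = ∑ (values (2 * k) v ωs) λ x → ind (bad x)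
  hit ωs = ind (k ≤ᵇ count ωs)
  pointwise : ∀ ωs → 64 ^ k * hit ωs ≤ 64 ^ count ωs
  pointwise ωs with k ≤ᵇ count ωs in eq
  ... | true  = ≤-trans (≤-reflexive (*-identityʳ (64 ^ k))) (^-monoʳ-≤ 64 (≤ᵇ⇒≤ k (count ωs) (subst Bool.T (sym eq) _)))
  ... | false = ≤-trans (≤-reflexive (*-zeroʳ (64 ^ k))) z≤n

≤ᵇ-true : ∀ {a b} → a ≤ b → (a ≤ᵇ b) ≡ true
≤ᵇ-true {a} {b} a≤b with a ≤ᵇ b in eq
... | true  = refl
... | false = ⊥-elim (subst Bool.T eq (≤⇒≤ᵇ a≤b))

≤ᵇ-true⁻ : ∀ {a b} → (a ≤ᵇ b) ≡ true → a ≤ b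
≤ᵇ-true⁻ {a} {b} h = ≤ᵇ⇒≤ a b (subst Bool.T (sym h) _)

<ᵇ-false⁻ : ∀ {a b} → (a <ᵇ b) ≡ false → b ≤ a
<ᵇ-false⁻ {a} {b} h with b ≤? a
... | yes b≤a = b≤a
... | no  b≰a with trans (sym h) (<ᵇ-true (≰⇒> b≰a))
... | ()

-- Among 2k values a majority of which are accurate, any value close to at least k of them is accurate.
module Pick (F T k : ℕ) where

  close : ℕ → ℕ → Bool
  close x y = F * ∣ x - y ∣ ≤ᵇ 2 * T

  support : List ℕ → ℕ → ℕ
  support xs x = ∑ xs λ y → ind (close x y)

  -- The default 0 is returned only if no value has enough support, which an accurate majority rules
  -- out.
  pickFrom : List ℕ → List ℕ → ℕ
  pickFrom xs []       = 0
  pickFrom xs (y ∷ ys) = if k ≤ᵇ support xs y then y else pickFrom xs ys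

  pick : List ℕ → ℕ
  pick xs = pickFrom xs xs

  pickFrom-supported : ∀ xs ys {y} → y ∈ˡ ys → k ≤ support xs y → k ≤ support xs (pickFrom xs ys)
  pickFrom-supported xs (z ∷ ys) y∈ h with k ≤ᵇ support xs z in eq
  ... | true = ≤ᵇ-true⁻ eq
  pickFrom-supported xs (z ∷ ys) (here refl) h | false with trans (sym eq) (≤ᵇ-true h)
  ... | ()
  pickFrom-supported xs (z ∷ ys) (there y∈) h | false = pickFrom-supported xs ys y∈ h

  module _ (S : ℕ) where

    bad : ℕ → Bool
    bad x = T <ᵇ F * ∣ x - S ∣

    good⇒ : ∀ {x} → not (bad x) ≡ true → F * ∣ x - S ∣ ≤ T
    good⇒ {x} h = <ᵇ-false⁻ (not-true h)
      where
      not-true : ∀ {b} → not b ≡ true → b ≡ false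
      not-true {false} _ = refl

    through : ∀ x y z {a b} → F * ∣ x - y ∣ ≤ a → F * ∣ y - z ∣ ≤ b → F * ∣ x - z ∣ ≤ a + b
    through x y z hx hy = ≤-trans (*-monoʳ-≤ F (∣-∣-triangle x y z)) (≤-trans (≤-reflexive (*-distribˡ-+ F ∣ x - y ∣ _)) (+-mono-≤ hx hy))

    good-majority : ∀ xs → length xs ≡ 2 * k → (∑ xs λ y → ind (bad y)) < k → suc k ≤ ∑ xs λ y → ind (not (bad y))
    good-majority xs len few = +-cancelˡ-≤ (∑ xs λ y → ind (bad y)) (suc k) _ (begin
      (∑ xs λ y → ind (bad y)) + suc k             ≡⟨ +-suc _ k ⟩
      suc (∑ xs λ y → ind (bad y)) + k             ≤⟨ +-monoˡ-≤ k few ⟩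
      k + k                                        ≡⟨ cong (k +_) (sym (+-identityʳ k)) ⟩
      2 * k                                        ≡⟨ sym len ⟩
      length xs                                    ≡⟨ sym (trans (∑-const xs 1) (*-identityʳ _)) ⟩
      (∑ xs λ _ → 1)                               ≡⟨ ∑-cong xs (λ y → sym (total (bad y))) ⟩
      (∑ xs λ y → ind (bad y) + ind (not (bad y))) ≡⟨ ∑-+ xs _ _ ⟩
      (∑ xs λ y → ind (bad y)) + (∑ xs λ y → ind (not (bad y))) ∎)
      where
      open ≤-Reasoning
      total : ∀ b → ind b + ind (not b) ≡ 1
      total true  = refl
      total false = refl

    -- Pigeonhole: at least k supporters cannot all be among fewer than k bad values.
    close-good : ∀ xs x → (∑ xs λ y → ind (bad y)) < k → k ≤ support xs x → 1 ≤ ∑ xs λ y → ind (close x y ∧ not (bad y))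
    close-good xs x few h = +-cancelˡ-≤ (∑ xs λ y → ind (bad y)) 1 _ (begin
      (∑ xs λ y → ind (bad y)) + 1                              ≡⟨ +-comm _ 1 ⟩
      suc (∑ xs λ y → ind (bad y))                              ≤⟨ few ⟩
      k                                                         ≤⟨ h ⟩
      support xs x                                              ≤⟨ ∑-mono xs (λ y → split (close x y) (bad y)) ⟩
      (∑ xs λ y → ind (bad y) + ind (close x y ∧ not (bad y)))  ≡⟨ ∑-+ xs _ _ ⟩
      (∑ xs λ y → ind (bad y)) + (∑ xs λ y → ind (close x y ∧ not (bad y))) ∎)
      where
      open ≤-Reasoning
      split : ∀ a b → ind a ≤ ind b + ind (a ∧ not b)
      split false b     = z≤n
      split true  true  = s≤s z≤n
      split true  false = s≤s z≤n

    -- Some supporter is accurate: 2T for the distance to it and T for its own error.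
    supported-accurate : ∀ xs x → (∑ xs λ y → ind (bad y)) < k → k ≤ support xs x → F * ∣ x - S ∣ ≤ 3 * T
    supported-accurate xs x few h with ∑-positive xs (λ y → ind (close x y ∧ not (bad y))) (close-good xs x few h)
    ... | y , _ , hy with ∧-true (close x y) (ind-positive hy)
    ... | cl , good = ≤-trans (through x y S (≤ᵇ-true⁻ cl) (good⇒ {y} good)) (≤-reflexive (+-comm (2 * T) T))

    -- Accurate values are mutually close, so each of them is supported by the whole accurate
    -- majority; hence a supported value exists.
    pick-accurate : ∀ xs → length xs ≡ 2 * k → (∑ xs λ y → ind (bad y)) < k → F * ∣ pick xs - S ∣ ≤ 3 * T
    pick-accurate xs len few
      with ∑-positive xs (λ y → ind (not (bad y))) (≤-trans (s≤s z≤n) (good-majority xs len few))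
    ... | x , x∈ , hx = supported-accurate xs (pick xs) few (pickFrom-supported xs xs x∈ (begin
        k                              ≤⟨ n≤1+n k ⟩
        suc k                          ≤⟨ good-majority xs len few ⟩
        (∑ xs λ y → ind (not (bad y))) ≤⟨ ∑-mono xs (λ y → ind-mono (near y)) ⟩
        support xs x                   ∎))
      where
      open ≤-Reasoning
      near : ∀ y → not (bad y) ≡ true → close x y ≡ true
      near y hy = ≤ᵇ-true (≤-trans
        (through x S y (good⇒ {x} (ind-positive hx)) (≤-trans (≤-reflexive (cong (F *_) (∣-∣-comm S y))) (good⇒ {y} hy)))
        (≤-reflexive (cong (T +_) (sym (+-identityʳ T)))))

valuesTree : ℕ → (A → Tree n ℕ) → List A → Tree n (List ℕ)
valuesTree zero    t _        = return []
valuesTree (suc m) t []       = valuesTree m t [] >>= λ xs → return (0 ∷ xs)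
valuesTree (suc m) t (ω ∷ ωs) = t ω >>= λ x → valuesTree m t ωs >>= λ xs → return (x ∷ xs)

run-valuesTree : ∀ (G : Graph n) m (t : A → Tree n ℕ) ωs → run G (valuesTree m t ωs) ≡ values m (λ ω → run G (t ω)) ωs
run-valuesTree G zero    t ωs       = refl
run-valuesTree G (suc m) t []       = trans (run->>= G (valuesTree m t []) _) (cong (0 ∷_) (run-valuesTree G m t []))
run-valuesTree G (suc m) t (ω ∷ ωs) = trans (run->>= G (t ω) _) (trans (run->>= G (valuesTree m t ωs) _)
  (cong (run G (t ω) ∷_) (run-valuesTree G m t ωs)))

cost-valuesTree : ∀ (G : Graph n) m (t : A → Tree n ℕ) ωs {c} → (∀ ω → cost G (t ω) ≤ c) → cost G (valuesTree m t ωs) ≤ m * c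
cost-valuesTree G zero    t ωs       h = z≤n
cost-valuesTree G (suc m) t []       {c} h = ≤-trans (≤-reflexive (trans (cost->>= G (valuesTree m t []) _) (+-identityʳ _)))
  (≤-trans (cost-valuesTree G m t [] h) (m≤n+m (m * c) c))
cost-valuesTree G (suc m) t (ω ∷ ωs) h = ≤-trans (≤-reflexive (trans (cost->>= G (t ω) _) (cong (cost G (t ω) +_) (trans (cost->>= G (valuesTree m t ωs) _) (+-identityʳ _)))))
  (+-mono-≤ (h ω) (cost-valuesTree G m t ωs h))

module Amplify (F T k : ℕ) (Ω : List A) (sample : A → Tree n ℕ) where

  Ω′ : List (List A)
  Ω′ = sequences (replicate (2 * k) Ω)

  vote : List A → Tree n ℕ
  vote ωs = valuesTree (2 * k) sample ωs >>= λ xs → return (Pick.pick F T k xs)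

  cost-vote : ∀ (G : Graph n) {c} → (∀ ω → cost G (sample ω) ≤ c) → ∀ ωs → cost G (vote ωs) ≤ 2 * k * c
  cost-vote G h ωs = ≤-trans (≤-reflexive (trans (cost->>= G (valuesTree (2 * k) sample ωs) _) (+-identityʳ _))) (cost-valuesTree G (2 * k) sample ωs h)

  vote-error : ∀ (G : Graph n) S → 64 * (∑ Ω λ ω → ind (T <ᵇ F * ∣ run G (sample ω) - S ∣)) ≤ length Ω →
    16 ^ k * (∑ Ω′ λ ωs → ind (3 * T <ᵇ F * ∣ run G (vote ωs) - S ∣)) ≤ length Ω′
  vote-error G S rare = ≤-trans (*-monoʳ-≤ (16 ^ k) (∑-mono Ω′ λ ωs → ind-mono (λ h → ≤ᵇ-true (many ωs h))))
    (majority-tail Ω (λ ω → run G (sample ω)) (Pick.bad F T k S) rare k)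
    where
    xs : List A → List ℕ
    xs ωs = values (2 * k) (λ ω → run G (sample ω)) ωs
    run-vote : ∀ ωs → run G (vote ωs) ≡ Pick.pick F T k (xs ωs)
    run-vote ωs = trans (run->>= G (valuesTree (2 * k) sample ωs) _) (cong (Pick.pick F T k) (run-valuesTree G (2 * k) sample ωs))
    many : ∀ ωs → (3 * T <ᵇ F * ∣ run G (vote ωs) - S ∣) ≡ true → k ≤ ∑ (xs ωs) λ x → ind (Pick.bad F T k S x)
    many ωs h with k ≤? ∑ (xs ωs) (λ x → ind (Pick.bad F T k S x))
    ... | yes k≤ = k≤
    ... | no  k≰ = ⊥-elim (<-irrefl refl (<-≤-trans (<ᵇ⇒< (3 * T) _ (subst Bool.T (sym h) _))
      (subst (λ x → F * ∣ x - S ∣ ≤ 3 * T) (sym (run-vote ωs)) (Pick.pick-accurate F T k S (xs ωs) (length-values (2 * k) _ ωs) (≰⇒> k≰)))))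

-- Halving the guess.

≤ᵇ-false⁻ : ∀ {a b} → (a ≤ᵇ b) ≡ false → b < a
≤ᵇ-false⁻ {a} {b} h with b <? a
... | yes b<a = b<a
... | no  b≮a with trans (sym h) (≤ᵇ-true (≮⇒≥ b≮a))
... | ()

module _ (E S T X : ℕ) (1≤E : 1 ≤ E) (near : 12 * E * ∣ X - S ∣ ≤ 3 * T) where

  private
    near′ : 4 * (E * ∣ X - S ∣) ≤ T
    near′ = *-cancelˡ-≤ 3 (≤-trans (≤-reflexive (lem E ∣ X - S ∣)) near)
      where
      lem : ∀ e y → 3 * (4 * (e * y)) ≡ 12 * e * y
      lem = solve-∀

    near″ : 4 * ∣ X - S ∣ ≤ T
    near″ = ≤-trans (*-monoʳ-≤ 4 (≤-trans (≤-reflexive (sym (*-identityˡ ∣ X - S ∣))) (*-monoˡ-≤ ∣ X - S ∣ 1≤E))) near′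

  -- The error is at most T/(4E) ≤ T/4, so X ≥ 3T/4 gives T ≤ 2S, and T/(4E) is small relative to S.
  large-accepted : 3 * T ≤ 4 * X → E * ∣ X - S ∣ ≤ S
  large-accepted h = *-cancelˡ-≤ 4 (≤-trans near′ (≤-trans T≤2S (*-monoˡ-≤ S {2} {4} (s≤s (s≤s z≤n)))))
    where
    open ≤-Reasoning
    T≤2S : T ≤ 2 * S
    T≤2S = *-cancelˡ-≤ 2 (+-cancelʳ-≤ T (2 * T) (2 * (2 * S)) (begin
      2 * T + T                   ≡⟨ +-comm (2 * T) T ⟩
      3 * T                       ≤⟨ h ⟩
      4 * X                       ≤⟨ *-monoʳ-≤ 4 (m≤n+∣m-n∣ X S) ⟩
      4 * (S + ∣ X - S ∣)         ≡⟨ *-distribˡ-+ 4 S ∣ X - S ∣ ⟩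
      4 * S + 4 * ∣ X - S ∣       ≤⟨ +-monoʳ-≤ (4 * S) near″ ⟩
      4 * S + T                   ≡⟨ cong (_+ T) (*-assoc 2 2 S) ⟩
      2 * (2 * S) + T             ∎))

  -- X < 3T/4 with an error of at most T/4.
  small-rejected : 4 * X < 3 * T → S < T
  small-rejected h = *-cancelˡ-< 4 S T (begin-strict
    4 * S                 ≤⟨ *-monoʳ-≤ 4 (m≤n+∣n-m∣ S X) ⟩
    4 * (X + ∣ X - S ∣)   ≡⟨ *-distribˡ-+ 4 X ∣ X - S ∣ ⟩
    4 * X + 4 * ∣ X - S ∣ <⟨ +-mono-<-≤ h near″ ⟩
    3 * T + T             ≡⟨ +-comm (3 * T) T ⟩
    4 * T                 ∎)
    where open ≤-Reasoning

module Loop (n L d E F D : ℕ) (1≤d : 1 ≤ d) (1≤E : 1 ≤ E) (F≡ : F ≡ 12 * E) (D≡ : D ≡ 9 * (64 * (F * suc L))) where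

  1≤F : 1 ≤ F
  1≤F = subst (1 ≤_) (sym F≡) (*-mono-≤ {1} {12} {1} (s≤s z≤n) 1≤E)

  1≤D : 1 ≤ D
  1≤D = subst (1 ≤_) (sym D≡) (*-mono-≤ {1} {9} {1} (s≤s z≤n) (*-mono-≤ {1} {64} {1} (s≤s z≤n) (*-mono-≤ {1} {F} {1} 1≤F (s≤s z≤n))))

  module Guess (m : ℕ) = Estimator n L d D (2 ^ m) 1≤d 1≤D
  module Vote (m : ℕ) = Amplify F (2 ^ m) L (Guess.Ω m) (Guess.sample m)

  loopSpace : ℕ → List (List (List (List Seed)))
  loopSpace zero    = [] ∷ []
  loopSpace (suc m) = cartesianProductWith _∷_ (Vote.Ω′ m) (loopSpace m)

  -- The guess 2^m is reached only if S < 2^(m+1) or an earlier vote failed.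
  loop : ℕ → List (List (List Seed)) → Tree n ℕ
  loop zero    _        = return 0
  loop (suc m) []       = return 0
  loop (suc m) (ω ∷ ωs) = Vote.vote m ω >>= λ x → if 3 * 2 ^ m ≤ᵇ 4 * x then return x else loop m ωs

  cost-loop : ∀ (G : Graph n) m ωs → cost G (loop m ωs) ≤ m * (2 * L * budget L d D)
  cost-loop G zero    ωs       = z≤n
  cost-loop G (suc m) []       = z≤n
  cost-loop G (suc m) (ω ∷ ωs) = ≤-trans (≤-reflexive (cost->>= G (Vote.vote m ω) _))
    (+-mono-≤ (Vote.cost-vote m G (λ ω → cost-truncate G (budget L d D) 0 _) ω) (rest (3 * 2 ^ m ≤ᵇ 4 * run G (Vote.vote m ω))))
    where
    rest : ∀ b → cost G (if b then return (run G (Vote.vote m ω)) else loop m ωs) ≤ m * (2 * L * budget L d D)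
    rest true  = z≤n
    rest false = cost-loop G m ωs

  module Correct (G : Graph n) (n≤ : n ≤ 2 ^ L)
    (degrees : (∀ a b → ∑ (allFin n) (tri G a b) ≤ d) × (∀ a c → (∑ (allFin n) λ b → tri G a b c) ≤ d))
    (deg≤ : ∀ a → (∑ (allFin n) λ b → ∑ (allFin n) λ c → tri G a b c) ≤ 4 ^ L) where

    S : ℕ
    S = ∑ (allFin n) λ a → ∑ (allFin n) λ b → ∑ (allFin n) λ c → tri G a b c

    voteBad : ∀ m → List (List Seed) → Bool
    voteBad m ω = 3 * 2 ^ m <ᵇ F * ∣ run G (Vote.vote m ω) - S ∣

    ∑-voteBad : ∀ m → S < 2 ^ suc m → 16 ^ L * (∑ (Vote.Ω′ m) λ ω → ind (voteBad m ω)) ≤ length (Vote.Ω′ m)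
    ∑-voteBad m S< = Vote.vote-error m G S
      (Guess.Correct.sample-error m G n≤ degrees deg≤ (m^n>0 2 m) (<⇒≤ S<) F 1≤F D≡)

    failed : ℕ → Bool
    failed X = S <ᵇ E * ∣ X - S ∣

    failed-false : ∀ {X} → E * ∣ X - S ∣ ≤ S → ind (failed X) ≡ 0
    failed-false {X} h with S <ᵇ E * ∣ X - S ∣ in eq
    ... | false = refl
    ... | true  = ⊥-elim (<-irrefl refl (<-≤-trans (<ᵇ⇒< S _ (subst Bool.T (sym eq) _)) h))

    near′ : ∀ {T X} → F * ∣ X - S ∣ ≤ T → 12 * E * ∣ X - S ∣ ≤ T
    near′ {T} {X} = subst (λ f → f * ∣ X - S ∣ ≤ T) F≡

    -- An accurate vote is either accepted, and then correct, or passes the decision on to the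
    -- remaining guesses.
    step : ∀ m ω ωs → voteBad m ω ≡ false → S < 2 ^ m → ind (failed (run G (loop (suc m) (ω ∷ ωs)))) ≤ ind (failed (run G (loop m ωs)))
    step m ω ωs good S< = subst (λ r → ind (failed r) ≤ ind (failed (run G (loop m ωs)))) (sym (run->>= G (Vote.vote m ω) _))
      (cases (run G (Vote.vote m ω)) (<ᵇ-false⁻ good))
      where
      cases : ∀ X → F * ∣ X - S ∣ ≤ 3 * 2 ^ m → ind (failed (run G (if 3 * 2 ^ m ≤ᵇ 4 * X then return X else loop m ωs))) ≤ ind (failed (run G (loop m ωs)))
      cases X near with 3 * 2 ^ m ≤ᵇ 4 * X in eq
      ... | true  = ≤-trans (≤-reflexive (failed-false {X} (large-accepted E S (2 ^ m) X 1≤E (near′ {X = X} near) (≤ᵇ-true⁻ eq)))) z≤n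
      ... | false = ≤-refl

    -- Rejecting an accurate vote would force S below the guess, so here it is accepted and correct.
    last-step : ∀ m ω ωs → voteBad m ω ≡ false → 2 ^ m ≤ S → ind (failed (run G (loop (suc m) (ω ∷ ωs)))) ≡ 0
    last-step m ω ωs good ≤S = trans (cong (λ r → ind (failed r)) (run->>= G (Vote.vote m ω) _))
      (cases (run G (Vote.vote m ω)) (<ᵇ-false⁻ good))
      where
      cases : ∀ X → F * ∣ X - S ∣ ≤ 3 * 2 ^ m → ind (failed (run G (if 3 * 2 ^ m ≤ᵇ 4 * X then return X else loop m ωs))) ≡ 0
      cases X near with 3 * 2 ^ m ≤ᵇ 4 * X in eq
      ... | true  = failed-false {X} (large-accepted E S (2 ^ m) X 1≤E (near′ {X = X} near) (≤ᵇ-true⁻ eq))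
      ... | false = ⊥-elim (<-irrefl refl (<-≤-trans (small-rejected E S (2 ^ m) X 1≤E (near′ {X = X} near) (≤ᵇ-false⁻ eq)) ≤S))

    -- A union bound over the votes, each of which fails with probability at most 1/16^L while S is
    -- below twice its guess.
    ∑-failed : ∀ m → S < 2 ^ m → 16 ^ L * (∑ (loopSpace m) λ ωs → ind (failed (run G (loop m ωs)))) ≤ m * length (loopSpace m)
    -- All guesses are used up only with S < 1, so the answer 0 is exact.
    ∑-failed zero    (s≤s S≤0) = ≤-reflexive (trans (cong (16 ^ L *_) (trans (+-identityʳ _) (failed-false {0} (subst (λ s → E * ∣ 0 - s ∣ ≤ s) (sym (n≤0⇒n≡0 S≤0)) (≤-reflexive (*-zeroʳ E)))))) (*-zeroʳ (16 ^ L)))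
    ∑-failed (suc m) S< = begin
      16 ^ L * (∑ (loopSpace (suc m)) f)
        ≡⟨ cong (16 ^ L *_) (∑-cartesianProductWith _∷_ Ω₁ Ω₂ f) ⟩
      16 ^ L * (∑ Ω₁ λ ω → ∑ Ω₂ λ ωs → f (ω ∷ ωs))
        ≤⟨ bound (S <? 2 ^ m) ⟩
      suc m * (N₁ * N₂)
        ≡⟨ cong (suc m *_) (sym (length-cartesianProductWith _∷_ Ω₁ Ω₂)) ⟩
      suc m * length (loopSpace (suc m)) ∎
      where
      open ≤-Reasoning
      Ω₁ = Vote.Ω′ m
      Ω₂ = loopSpace m
      N₁ = length Ω₁
      N₂ = length Ω₂
      f : List (List (List Seed)) → ℕ
      f ωs = ind (failed (run G (loop (suc m) ωs)))
      a : List (List Seed) → ℕ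
      a ω = ind (voteBad m ω)
      b : List (List (List Seed)) → ℕ
      b ωs = ind (failed (run G (loop m ωs)))
      union : ∀ {A : Set} v {x} (y : A → ℕ) ωs → x ≤ 1 → (v ≡ false → x ≤ y ωs) → x ≤ ind v + y ωs
      union true  y ωs x≤1 h = ≤-trans x≤1 (m≤m+n 1 (y ωs))
      union false y ωs x≤1 h = h refl
      lem₁ : ∀ l a b n₁ n₂ → l * (n₂ * a + n₁ * b) ≡ n₂ * (l * a) + n₁ * (l * b)
      lem₁ = solve-∀
      lem₂ : ∀ m n₁ n₂ → n₂ * n₁ + n₁ * (m * n₂) ≡ suc m * (n₁ * n₂)
      lem₂ = solve-∀
      bound-by : ∀ (y : List (List (List Seed)) → ℕ) {c} → c ≤ m → 16 ^ L * ∑ Ω₂ y ≤ c * N₂ →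
        (∀ ω ωs → voteBad m ω ≡ false → f (ω ∷ ωs) ≤ y ωs) →
        16 ^ L * (∑ Ω₁ λ ω → ∑ Ω₂ λ ωs → f (ω ∷ ωs)) ≤ suc m * (N₁ * N₂)
      bound-by y {c} c≤m hy h = begin
        16 ^ L * (∑ Ω₁ λ ω → ∑ Ω₂ λ ωs → f (ω ∷ ωs))
          ≤⟨ *-monoʳ-≤ (16 ^ L) (∑-mono Ω₁ λ ω → ∑-mono Ω₂ λ ωs → union (voteBad m ω) y ωs (ind≤1 (failed (run G (loop (suc m) (ω ∷ ωs))))) (h ω ωs)) ⟩
        16 ^ L * (∑ Ω₁ λ ω → ∑ Ω₂ λ ωs → a ω + y ωs)
          ≡⟨ cong (16 ^ L *_) (trans (∑-cong Ω₁ λ ω → trans (∑-+ Ω₂ (λ _ → a ω) y) (cong (_+ ∑ Ω₂ y) (∑-const Ω₂ (a ω))))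
                                     (trans (∑-+ Ω₁ (λ ω → N₂ * a ω) _) (cong₂ _+_ (∑-*ˡ Ω₁ N₂ a) (∑-const Ω₁ (∑ Ω₂ y))))) ⟩
        16 ^ L * (N₂ * ∑ Ω₁ a + N₁ * ∑ Ω₂ y)
          ≡⟨ lem₁ (16 ^ L) (∑ Ω₁ a) (∑ Ω₂ y) N₁ N₂ ⟩
        N₂ * (16 ^ L * ∑ Ω₁ a) + N₁ * (16 ^ L * ∑ Ω₂ y)
          ≤⟨ +-mono-≤ (*-monoʳ-≤ N₂ (∑-voteBad m S<)) (*-monoʳ-≤ N₁ (≤-trans hy (*-monoˡ-≤ N₂ c≤m))) ⟩
        N₂ * N₁ + N₁ * (m * N₂)
          ≡⟨ lem₂ m N₁ N₂ ⟩
        suc m * (N₁ * N₂) ∎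
      bound : Dec (S < 2 ^ m) → 16 ^ L * (∑ Ω₁ λ ω → ∑ Ω₂ λ ωs → f (ω ∷ ωs)) ≤ suc m * (N₁ * N₂)
      bound (yes S<2^m) = bound-by b ≤-refl (∑-failed m S<2^m) (λ ω ωs good → step m ω ωs good S<2^m)
      -- The later votes carry no guarantee, but they matter only if this one fails; hence the error
      -- function 0.
      bound (no  S≮2^m) = bound-by (λ _ → 0) {0} z≤n (≤-reflexive (trans (cong (16 ^ L *_) (∑-zero Ω₂)) (*-zeroʳ (16 ^ L))))
        (λ ω ωs good → ≤-reflexive (last-step m ω ωs good (≮⇒≥ S≮2^m)))

-- Ordered and unordered triangles.

∑³ : ∀ {n} → (Fin n → Fin n → Fin n → ℕ) → ℕ
∑³ {n} h = ∑ (allFin n) λ a → ∑ (allFin n) λ b → ∑ (allFin n) λ c → h a b c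

module _ {n : ℕ} where

  private
    V : List (Fin n)
    V = allFin n

    length-V : length V ≡ n
    length-V = length-tabulate (λ i → i)

  ∑³-cong : ∀ {g h : Fin n → Fin n → Fin n → ℕ} → (∀ a b c → g a b c ≡ h a b c) → ∑³ g ≡ ∑³ h
  ∑³-cong eq = ∑-cong V λ a → ∑-cong V λ b → ∑-cong V λ c → eq a b c

  ∑³-+ : ∀ (g h : Fin n → Fin n → Fin n → ℕ) → ∑³ (λ a b c → g a b c + h a b c) ≡ ∑³ g + ∑³ h
  ∑³-+ g h = trans (∑-cong V λ a → trans (∑-cong V λ b → ∑-+ V (g a b) (h a b)) (∑-+ V (λ b → ∑ V (g a b)) (λ b → ∑ V (h a b))))
    (∑-+ V (λ a → ∑ V λ b → ∑ V (g a b)) (λ a → ∑ V λ b → ∑ V (h a b)))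

  ∑³-swap₁₂ : ∀ (h : Fin n → Fin n → Fin n → ℕ) → ∑³ (λ a b c → h b a c) ≡ ∑³ h
  ∑³-swap₁₂ h = ∑-swap V V λ a b → ∑ V (h b a)

  ∑³-swap₂₃ : ∀ (h : Fin n → Fin n → Fin n → ℕ) → ∑³ (λ a b c → h a c b) ≡ ∑³ h
  ∑³-swap₂₃ h = ∑-cong V λ a → ∑-swap V V λ b c → h a c b

  ∑³-cube : ∀ (h : Fin n → Fin n → Fin n → ℕ) k → (∀ a b c → h a b c ≤ 1) → n ≤ k → ∀ a → (∑ V λ b → ∑ V λ c → h a b c) ≤ k * k
  ∑³-cube h k h≤1 n≤k a = begin
    (∑ V λ b → ∑ V λ c → h a b c) ≤⟨ ∑-mono V (λ b → ∑-mono V λ c → h≤1 a b c) ⟩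
    (∑ V λ b → ∑ V λ c → 1)       ≡⟨ trans (∑-cong V λ _ → trans (∑-const V 1) (*-identityʳ (length V))) (∑-const V (length V)) ⟩
    length V * length V           ≤⟨ *-mono-≤ V≤k V≤k ⟩
    k * k                         ∎
    where
    open ≤-Reasoning
    V≤k : length V ≤ k
    V≤k = ≤-trans (≤-reflexive length-V) n≤k

  ∑-allFin-≤ : ∀ (h : Fin n → ℕ) {m k} → (∀ a → h a ≤ m) → n ≤ k → ∑ V h ≤ k * m
  ∑-allFin-≤ h {m} h≤m n≤k = ≤-trans (∑-mono V h≤m) (≤-trans (≤-reflexive (∑-const V m)) (*-monoˡ-≤ m (≤-trans (≤-reflexive length-V) n≤k)))

increasing : ℕ → ℕ → ℕ → ℕ
increasing x y z = ind ((x <ᵇ y) ∧ (y <ᵇ z))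

<ᵇ-false : ∀ {x y} → y ≤ x → (x <ᵇ y) ≡ false
<ᵇ-false {x} {y} y≤x with x <ᵇ y in eq
... | false = refl
... | true  = ⊥-elim (<-irrefl refl (<-≤-trans (<ᵇ⇒< x y (subst Bool.T (sym eq) _)) y≤x))

<ᵇ-flip : ∀ {x y} → x ≢ y → (y <ᵇ x) ≡ not (x <ᵇ y)
<ᵇ-flip {x} {y} x≢y with <-cmp x y
... | tri< x<y _ _ = trans (<ᵇ-false (<⇒≤ x<y)) (cong not (sym (<ᵇ-true x<y)))
... | tri≈ _ x≡y _ = ⊥-elim (x≢y x≡y)
... | tri> _ _ y<x = trans (<ᵇ-true y<x) (cong not (sym (<ᵇ-false (<⇒≤ y<x))))

-- Of the eight outcomes of three comparisons, two are cyclic and excluded by transitivity; the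
-- other six are the six orders.
one-increasing : ∀ {x y z} → x ≢ y → y ≢ z → x ≢ z →
  increasing x y z + increasing y x z + increasing x z y + increasing y z x + increasing z x y + increasing z y x ≡ 1
one-increasing {x} {y} {z} x≢y y≢z x≢z
  rewrite <ᵇ-flip x≢y | <ᵇ-flip y≢z | <ᵇ-flip x≢z with x <ᵇ y in p | y <ᵇ z in q | x <ᵇ z in r
... | true  | true  | true  = refl
... | true  | true  | false = ⊥-elim (<-irrefl refl (<-≤-trans (<-trans (<ᵇ⇒< x y (subst Bool.T (sym p) _)) (<ᵇ⇒< y z (subst Bool.T (sym q) _))) (≮⇒≥ λ x<z → contra (trans (sym r) (<ᵇ-true x<z)))))
  where
  contra : false ≢ true
  contra ()
... | true  | false | true  = refl
... | true  | false | false = refl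
... | false | true  | true  = refl
... | false | true  | false = refl
... | false | false | false = refl
... | false | false | true  = ⊥-elim (contra (trans (sym q) (<ᵇ-true (≤-<-trans (≮⇒≥ λ x<y → contra (trans (sym p) (<ᵇ-true x<y))) (<ᵇ⇒< x z (subst Bool.T (sym r) _))))))
  where
  contra : false ≢ true
  contra ()

module _ {n : ℕ} (G : Graph n) where

  private
    V : List (Fin n)
    V = allFin n

  tri-swap₁₂ : ∀ a b c → tri G b a c ≡ tri G a b c
  tri-swap₁₂ a b c rewrite Graph.sym G b a | Bool.∧-comm (adj G a c) (adj G b c) = refl

  tri-swap₂₃ : ∀ a b c → tri G a c b ≡ tri G a b c
  tri-swap₂₃ a b c rewrite Graph.sym G c b = cong ind (begin
    adj G a c ∧ adj G b c ∧ adj G a b   ≡⟨ Bool.∧-comm (adj G a c) _ ⟩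
    (adj G b c ∧ adj G a b) ∧ adj G a c ≡⟨ cong (_∧ adj G a c) (Bool.∧-comm (adj G b c) (adj G a b)) ⟩
    (adj G a b ∧ adj G b c) ∧ adj G a c ≡⟨ Bool.∧-assoc (adj G a b) (adj G b c) (adj G a c) ⟩
    adj G a b ∧ adj G b c ∧ adj G a c   ∎)
    where open ≡-Reasoning

  private
    o : Fin n → Fin n → Fin n → ℕ
    o a b c = increasing (toℕ a) (toℕ b) (toℕ c)

    h : Fin n → Fin n → Fin n → ℕ
    h a b c = tri G a b c * o a b c

    t≡∑³h : t G ≡ ∑³ h
    t≡∑³h = ∑³-cong λ a b c → expand (toℕ a <ᵇ toℕ b) (toℕ b <ᵇ toℕ c) (isTri G a b c)
      where
      expand : ∀ x y z → ind (x ∧ y ∧ z) ≡ ind z * ind (x ∧ y)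
      expand true  true  z     = sym (*-identityʳ (ind z))
      expand true  false z     = sym (*-zeroʳ (ind z))
      expand false y     z     = sym (*-zeroʳ (ind z))

    partition : ∀ a b c → tri G a b c ≡ h a b c + h b a c + h a c b + h b c a + h c a b + h c b a
    partition a b c
      rewrite tri-swap₁₂ a b c | tri-swap₂₃ a b c
            | trans (tri-swap₂₃ b a c) (tri-swap₁₂ a b c)
            | trans (tri-swap₁₂ a c b) (tri-swap₂₃ a b c)
            | trans (tri-swap₁₂ b c a) (trans (tri-swap₂₃ b a c) (tri-swap₁₂ a b c))
      with isTri G a b c in eq
    ... | false = refl
    ... | true  = let a≢b , b≢c , c≢a = isTri-distinct G eq in
      trans (sym (one-increasing (λ p → a≢b (Fin.toℕ-injective p)) (λ p → b≢c (Fin.toℕ-injective p)) (λ p → c≢a (Fin.toℕ-injective (sym p)))))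
        (lem (o a b c) (o b a c) (o a c b) (o b c a) (o c a b) (o c b a))
      where
      lem : ∀ x y z u v w → x + y + z + u + v + w ≡ 1 * x + 1 * y + 1 * z + 1 * u + 1 * v + 1 * w
      lem = solve-∀

  -- Each ordered triangle becomes increasing under exactly one of the six permutations, and summing
  -- over all triples is invariant under permutation.
  ordered-triangles : ∑³ (tri G) ≡ 6 * t G
  ordered-triangles = begin
    ∑³ (tri G)
      ≡⟨ ∑³-cong partition ⟩
    ∑³ (λ a b c → h a b c + h b a c + h a c b + h b c a + h c a b + h c b a)
      ≡⟨ trans (∑³-+ _ h₆) (cong (_+ ∑³ h₆) (trans (∑³-+ _ h₅) (cong (_+ ∑³ h₅) (trans (∑³-+ _ h₄) (cong (_+ ∑³ h₄) (trans (∑³-+ _ h₃) (cong (_+ ∑³ h₃) (∑³-+ h h₂)))))))) ⟩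
    ∑³ h + ∑³ h₂ + ∑³ h₃ + ∑³ h₄ + ∑³ h₅ + ∑³ h₆
      ≡⟨ cong₂ _+_ (cong₂ _+_ (cong₂ _+_ (cong₂ _+_ (cong (∑³ h +_) e₂) e₃) e₄) e₅) e₆ ⟩
    ∑³ h + ∑³ h + ∑³ h + ∑³ h + ∑³ h + ∑³ h
      ≡⟨ lem (∑³ h) ⟩
    6 * ∑³ h
      ≡⟨ cong (6 *_) (sym t≡∑³h) ⟩
    6 * t G ∎
    where
    open ≡-Reasoning
    h₂ h₃ h₄ h₅ h₆ : Fin n → Fin n → Fin n → ℕ
    h₂ a b c = h b a c
    h₃ a b c = h a c b
    h₄ a b c = h b c a
    h₅ a b c = h c a b
    h₆ a b c = h c b a
    e₂ : ∑³ h₂ ≡ ∑³ h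
    e₂ = ∑³-swap₁₂ h
    e₃ : ∑³ h₃ ≡ ∑³ h
    e₃ = ∑³-swap₂₃ h
    e₄ : ∑³ h₄ ≡ ∑³ h
    e₄ = trans (∑³-swap₁₂ h₃) e₃
    e₅ : ∑³ h₅ ≡ ∑³ h
    e₅ = trans (∑³-swap₂₃ h₂) e₂
    e₆ : ∑³ h₆ ≡ ∑³ h
    e₆ = trans (∑³-swap₂₃ h₄) e₄
    lem : ∀ x → x + x + x + x + x + x ≡ 6 * x
    lem = solve-∀

  module _ {d} (ΔE≤d : ΔE≤ G d) where

    -- A row of the link of `a` counts the triangles on the edge from `a` to `b`, and is empty if
    -- there is no such edge.
    row-degree : ∀ a b → ∑ V (tri G a b) ≤ d
    row-degree a b with adj G a b in ab
    ... | false = ≤-trans (≤-reflexive (∑-zero V)) z≤n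
    ... | true  = ≤-trans (∑-mono V λ c → ≤-reflexive (cong ind (Bool.∧-comm (adj G b c) (adj G a c)))) (ΔE≤d a b ab)

    column-degree : ∀ a c → (∑ V λ b → tri G a b c) ≤ d
    column-degree a c = ≤-trans (≤-reflexive (∑-cong V λ b → tri-swap₂₃ a c b)) (row-degree a c)

-- Rational arithmetic and the accuracy of the output.

private
  toℚᵘ-ℕ→ℚ : ∀ m → toℚᵘ (ℕ→ℚ m) ℚᵘ.≃ mkℚᵘ (ℤ.+ m) 0
  toℚᵘ-ℕ→ℚ m = ℚ.toℚᵘ-fromℚᵘ (mkℚᵘ (ℤ.+ m) 0)

ℕ→ℚ-+ : ∀ a b → ℕ→ℚ (a + b) ≡ ℕ→ℚ a ℚ.+ ℕ→ℚ b
ℕ→ℚ-+ a b = ℚ.toℚᵘ-injective (begin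
  toℚᵘ (ℕ→ℚ (a + b))                      ≈⟨ toℚᵘ-ℕ→ℚ (a + b) ⟩
  mkℚᵘ (ℤ.+ (a + b)) 0                      ≈⟨ *≡* (cong (ℤ._* ℤ.+ 1) (trans (ℤ.pos-+ a b) (sym (cong₂ ℤ._+_ (ℤ.*-identityʳ (ℤ.+ a)) (ℤ.*-identityʳ (ℤ.+ b)))))) ⟩
  mkℚᵘ (ℤ.+ a) 0 ℚᵘ.+ mkℚᵘ (ℤ.+ b) 0          ≈⟨ ℚᵘ.+-cong (ℚᵘ.≃-sym (toℚᵘ-ℕ→ℚ a)) (ℚᵘ.≃-sym (toℚᵘ-ℕ→ℚ b)) ⟩
  toℚᵘ (ℕ→ℚ a) ℚᵘ.+ toℚᵘ (ℕ→ℚ b)          ≈⟨ ℚᵘ.≃-sym (ℚ.toℚᵘ-homo-+ (ℕ→ℚ a) (ℕ→ℚ b)) ⟩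
  toℚᵘ (ℕ→ℚ a ℚ.+ ℕ→ℚ b)                  ∎)
  where open ℚᵘ.≃-Reasoning

ℕ→ℚ-* : ∀ a b → ℕ→ℚ (a * b) ≡ ℕ→ℚ a ℚ.* ℕ→ℚ b
ℕ→ℚ-* a b = ℚ.toℚᵘ-injective (begin
  toℚᵘ (ℕ→ℚ (a * b))                      ≈⟨ toℚᵘ-ℕ→ℚ (a * b) ⟩
  mkℚᵘ (ℤ.+ (a * b)) 0                      ≈⟨ *≡* (cong (ℤ._* ℤ.+ 1) (ℤ.pos-* a b)) ⟩
  mkℚᵘ (ℤ.+ a) 0 ℚᵘ.* mkℚᵘ (ℤ.+ b) 0          ≈⟨ ℚᵘ.*-cong (ℚᵘ.≃-sym (toℚᵘ-ℕ→ℚ a)) (ℚᵘ.≃-sym (toℚᵘ-ℕ→ℚ b)) ⟩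
  toℚᵘ (ℕ→ℚ a) ℚᵘ.* toℚᵘ (ℕ→ℚ b)          ≈⟨ ℚᵘ.≃-sym (ℚ.toℚᵘ-homo-* (ℕ→ℚ a) (ℕ→ℚ b)) ⟩
  toℚᵘ (ℕ→ℚ a ℚ.* ℕ→ℚ b)                  ∎)
  where open ℚᵘ.≃-Reasoning

ℕ→ℚ-mono : ∀ {a b} → a ≤ b → ℕ→ℚ a ℚ.≤ ℕ→ℚ b
ℕ→ℚ-mono {a} {b} a≤b = ℚ.toℚᵘ-cancel-≤ (begin
  toℚᵘ (ℕ→ℚ a)   ≃⟨ toℚᵘ-ℕ→ℚ a ⟩
  mkℚᵘ (ℤ.+ a) 0   ≤⟨ *≤* (ℤ.*-monoʳ-≤-nonNeg (ℤ.+ 1) (ℤ.+≤+ a≤b)) ⟩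
  mkℚᵘ (ℤ.+ b) 0   ≃⟨ ℚᵘ.≃-sym (toℚᵘ-ℕ→ℚ b) ⟩
  toℚᵘ (ℕ→ℚ b)   ∎)
  where open ℚᵘ.≤-Reasoning

ℕ→ℚ-nonNeg : ∀ m → ℚ.NonNegative (ℕ→ℚ m)
ℕ→ℚ-nonNeg m = ℚ.normalize-nonNeg m 1

ℕ→ℚ-reciprocal : ∀ k → ℕ→ℚ (suc k) ℚ.* (ℤ.+ 1 ℚ./ suc k) ≡ 1ℚ
ℕ→ℚ-reciprocal k = ℚ.toℚᵘ-injective (begin
  toℚᵘ (ℕ→ℚ (suc k) ℚ.* (ℤ.+ 1 ℚ./ suc k))           ≈⟨ ℚ.toℚᵘ-homo-* (ℕ→ℚ (suc k)) (ℤ.+ 1 ℚ./ suc k) ⟩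
  toℚᵘ (ℕ→ℚ (suc k)) ℚᵘ.* toℚᵘ (ℤ.+ 1 ℚ./ suc k)     ≈⟨ ℚᵘ.*-cong (toℚᵘ-ℕ→ℚ (suc k)) (ℚ.toℚᵘ-fromℚᵘ (mkℚᵘ (ℤ.+ 1) k)) ⟩
  mkℚᵘ (ℤ.+ suc k) 0 ℚᵘ.* mkℚᵘ (ℤ.+ 1) k               ≈⟨ *≡* (cong ℤ.+_ (trans (*-identityʳ _) (trans (*-comm (suc k) 1) (sym (cong (1 *_) (*-identityˡ (suc k))))))) ⟩
  toℚᵘ 1ℚ                                          ∎)
  where open ℚᵘ.≃-Reasoning

ℕ→ℚ-∣-∣ : ∀ a b → ℚ.∣ ℕ→ℚ a ℚ.- ℕ→ℚ b ∣ ≡ ℕ→ℚ ∣ a - b ∣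
ℕ→ℚ-∣-∣ a b with ≤-total b a
... | inj₁ b≤a with m≤n⇒∃[o]m+o≡n b≤a
... | o , refl rewrite ∣-∣-comm (b + o) b | ∣m-m+n∣≡n b o =
  trans (cong ℚ.∣_∣ (trans (cong (ℚ._- ℕ→ℚ b) (ℕ→ℚ-+ b o)) (lem (ℕ→ℚ b) (ℕ→ℚ o)))) (ℚ.0≤p⇒∣p∣≡p (ℚ.nonNegative⁻¹ (ℕ→ℚ o) {{ℕ→ℚ-nonNeg o}}))
  where
  open +-*-Solver
  lem : ∀ x y → x ℚ.+ y ℚ.- x ≡ y
  lem = solve 2 (λ x y → x :+ y :- x := y) refl
ℕ→ℚ-∣-∣ a b | inj₂ a≤b with m≤n⇒∃[o]m+o≡n a≤b
... | o , refl rewrite ∣m-m+n∣≡n a o =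
  trans (cong ℚ.∣_∣ (trans (cong (λ z → ℕ→ℚ a ℚ.- z) (ℕ→ℚ-+ a o)) (lem (ℕ→ℚ a) (ℕ→ℚ o))))
        (trans (ℚ.∣-p∣≡∣p∣ (ℕ→ℚ o)) (ℚ.0≤p⇒∣p∣≡p (ℚ.nonNegative⁻¹ (ℕ→ℚ o) {{ℕ→ℚ-nonNeg o}})))
  where
  open +-*-Solver
  lem : ∀ x y → x ℚ.- (x ℚ.+ y) ≡ ℚ.- y
  lem = solve 2 (λ x y → x :- (x :+ y) := :- y) refl

≤ᵇℚ-true : ∀ {p q} → p ℚ.≤ q → (p ℚ.≤ᵇ q) ≡ true
≤ᵇℚ-true {p} {q} p≤q with p ℚ.≤ᵇ q in eq
... | true  = refl
... | false = ⊥-elim (subst Bool.T eq (ℚ.≤⇒≤ᵇ p≤q))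

*-swapʳ : ∀ x y z → x ℚ.* y ℚ.* z ≡ x ℚ.* z ℚ.* y
*-swapʳ = solve 3 (λ x y z → x :* y :* z := x :* z :* y) refl
  where open +-*-Solver

-- `1≤Eε` turns error S/E into accuracy ε; `Eε≤2` bounds the query count in terms of 1/ε.
record Precision (ε : ℚ) : Set where
  field
    E     : ℕ
    1≤E   : 1 ≤ E
    1≤Eε  : 1ℚ ℚ.≤ ℕ→ℚ E ℚ.* ε
    Eε≤2  : ℕ→ℚ E ℚ.* ε ℚ.≤ ℕ→ℚ 2

-- E = ⌊1/ε⌋ + 1, which is at most 2/ε because ε < 1.
precision : ∀ ε → 0ℚ ℚ.< ε → ε ℚ.< 1ℚ → Precision ε
precision (mkℚ (ℤ.-[1+ p ]) q c) 0<ε _ = ⊥-elim (ℚ.<-asym 0<ε (ℚ.negative⁻¹ (mkℚ (ℤ.-[1+ p ]) q c)))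
precision (mkℚ (ℤ.+ zero) q c) (ℚ.*<* 0<) _ = ⊥-elim (ℤ.<-irrefl refl 0<)
precision ε@(mkℚ (ℤ.+ suc p) q c) 0<ε (ℚ.*<* (ℤ.+<+ p<q)) with quotient (suc q) (suc p) (s≤s z≤n)
... | k , k≤ , ≤k = record
  { E = suc k
  ; 1≤E = s≤s z≤n
  ; 1≤Eε = ℚ.*-cancelʳ-≤-pos (ℕ→ℚ (suc q)) (begin
      1ℚ ℚ.* ℕ→ℚ (suc q)                  ≡⟨ ℚ.*-identityˡ _ ⟩
      ℕ→ℚ (suc q)                         ≤⟨ ℕ→ℚ-mono ≤k ⟩
      ℕ→ℚ (suc k * suc p)                 ≡⟨ scaled ⟩
      ℕ→ℚ (suc k) ℚ.* ε ℚ.* ℕ→ℚ (suc q)   ∎)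
  ; Eε≤2 = ℚ.*-cancelʳ-≤-pos (ℕ→ℚ (suc q)) (begin
      ℕ→ℚ (suc k) ℚ.* ε ℚ.* ℕ→ℚ (suc q)   ≡⟨ sym scaled ⟩
      ℕ→ℚ (suc k * suc p)                 ≤⟨ ℕ→ℚ-mono {suc k * suc p} {2 * suc q} (≤-trans (+-mono-≤ p≤q k≤) (≤-reflexive (cong (λ x → suc q + x) (sym (+-identityʳ (suc q)))))) ⟩
      ℕ→ℚ (2 * suc q)                     ≡⟨ ℕ→ℚ-* 2 (suc q) ⟩
      ℕ→ℚ 2 ℚ.* ℕ→ℚ (suc q)               ∎)
  }
  where
  open ℚ.≤-Reasoning
  instance
    q-pos : ℚ.Positive (ℕ→ℚ (suc q))
    q-pos = ℚ.normalize-pos (suc q) 1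
  p≤q : suc p ≤ suc q
  p≤q = <⇒≤ (subst₂ _<_ (*-identityʳ (suc p)) (*-identityˡ (suc q)) p<q)
  ε-scaled : ε ℚ.* ℕ→ℚ (suc q) ≡ ℕ→ℚ (suc p)
  ε-scaled = ℚ.toℚᵘ-injective (ℚᵘ.≃-trans (ℚ.toℚᵘ-homo-* ε (ℕ→ℚ (suc q))) (ℚᵘ.≃-trans (ℚᵘ.*-congˡ {toℚᵘ ε} (toℚᵘ-ℕ→ℚ (suc q)))
    (ℚᵘ.≃-trans (*≡* {mkℚᵘ (ℤ.+ suc p) q ℚᵘ.* mkℚᵘ (ℤ.+ suc q) 0} {mkℚᵘ (ℤ.+ suc p) 0} (trans (ℤ.*-identityʳ _) (cong (λ x → ℤ.+ suc p ℤ.* ℤ.+ x) (sym (*-identityʳ (suc q)))))) (ℚᵘ.≃-sym (toℚᵘ-ℕ→ℚ (suc p))))))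
  scaled : ℕ→ℚ (suc k * suc p) ≡ ℕ→ℚ (suc k) ℚ.* ε ℚ.* ℕ→ℚ (suc q)
  scaled = trans (ℕ→ℚ-* (suc k) (suc p)) (trans (cong (ℕ→ℚ (suc k) ℚ.*_) (sym ε-scaled)) (sym (ℚ.*-assoc (ℕ→ℚ (suc k)) ε (ℕ→ℚ (suc q)))))

1/6 : ℚ
1/6 = ℤ.+ 1 ℚ./ 6

1/6-nonNeg : ℚ.NonNegative 1/6
1/6-nonNeg = ℚ.normalize-nonNeg 1 6

scaled-estimate : ∀ {n} (G : Graph n) {ε E X} → 0ℚ ℚ.< ε → 1ℚ ℚ.≤ ℕ→ℚ E ℚ.* ε → E * ∣ X - 6 * t G ∣ ≤ 6 * t G →
  goodEstimate ε G (ℕ→ℚ X ℚ.* 1/6) ≡ true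
scaled-estimate G {ε} {E} {X} 0<ε 1≤Eε near = ≤ᵇℚ-true (begin
  ℚ.∣ ℕ→ℚ X ℚ.* 1/6 ℚ.- ℕ→ℚ (t G) ∣
    ≡⟨ cong (λ z → ℚ.∣ ℕ→ℚ X ℚ.* 1/6 ℚ.- z ∣) (sym sixth) ⟩
  ℚ.∣ ℕ→ℚ X ℚ.* 1/6 ℚ.- ℕ→ℚ (6 * t G) ℚ.* 1/6 ∣
    ≡⟨ cong ℚ.∣_∣ (lem₁ (ℕ→ℚ X) (ℕ→ℚ (6 * t G)) 1/6) ⟩
  ℚ.∣ (ℕ→ℚ X ℚ.- ℕ→ℚ (6 * t G)) ℚ.* 1/6 ∣
    ≡⟨ trans (ℚ.∣p*q∣≡∣p∣*∣q∣ (ℕ→ℚ X ℚ.- ℕ→ℚ (6 * t G)) 1/6) (cong (ℚ._* 1/6) (ℕ→ℚ-∣-∣ X (6 * t G))) ⟩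
  y ℚ.* 1/6
    ≡⟨ cong (ℚ._* 1/6) (sym (ℚ.*-identityʳ y)) ⟩
  y ℚ.* 1ℚ ℚ.* 1/6
    ≤⟨ ℚ.*-monoʳ-≤-nonNeg 1/6 {{1/6-nonNeg}} (ℚ.*-monoˡ-≤-nonNeg y {{ℕ→ℚ-nonNeg ∣ X - 6 * t G ∣}} 1≤Eε) ⟩
  y ℚ.* (ℕ→ℚ E ℚ.* ε) ℚ.* 1/6
    ≡⟨ lem₂ y (ℕ→ℚ E) ε 1/6 ⟩
  ε ℚ.* (ℕ→ℚ E ℚ.* y ℚ.* 1/6)
    ≤⟨ ℚ.*-monoˡ-≤-nonNeg ε {{ℚ.pos⇒nonNeg ε {{ℚ.positive 0<ε}}}} (ℚ.*-monoʳ-≤-nonNeg 1/6 {{1/6-nonNeg}} (ℚ.≤-trans (ℚ.≤-reflexive (sym (ℕ→ℚ-* E ∣ X - 6 * t G ∣))) (ℕ→ℚ-mono near))) ⟩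
  ε ℚ.* (ℕ→ℚ (6 * t G) ℚ.* 1/6)
    ≡⟨ cong (ε ℚ.*_) sixth ⟩
  ε ℚ.* ℕ→ℚ (t G) ∎)
  where
  open ℚ.≤-Reasoning
  y = ℕ→ℚ ∣ X - 6 * t G ∣
  open +-*-Solver using (solve; _:*_; _:-_; _:=_)
  lem₁ : ∀ a b c → a ℚ.* c ℚ.- b ℚ.* c ≡ (a ℚ.- b) ℚ.* c
  lem₁ = solve 3 (λ a b c → a :* c :- b :* c := (a :- b) :* c) refl
  lem₂ : ∀ y e ε s → y ℚ.* (e ℚ.* ε) ℚ.* s ≡ ε ℚ.* (e ℚ.* y ℚ.* s)
  lem₂ = solve 4 (λ y e ε s → y :* (e :* ε) :* s := ε :* (e :* y :* s)) refl
  sixth : ℕ→ℚ (6 * t G) ℚ.* 1/6 ≡ ℕ→ℚ (t G)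
  sixth = trans (cong (ℚ._* 1/6) (ℕ→ℚ-* 6 (t G))) (trans (*-swapʳ (ℕ→ℚ 6) (ℕ→ℚ (t G)) 1/6) (ℚ.*-identityˡ (ℕ→ℚ (t G))))

zero-estimate : ∀ {n} (G : Graph n) {ε} → 1ℚ ℚ.≤ ε ⊎ t G ≡ 0 → goodEstimate ε G 0ℚ ≡ true
zero-estimate G {ε} (inj₁ 1≤ε) = ≤ᵇℚ-true (begin
  ℚ.∣ 0ℚ ℚ.- ℕ→ℚ (t G) ∣   ≡⟨ ℕ→ℚ-∣-∣ 0 (t G) ⟩
  ℕ→ℚ (t G)                ≡⟨ sym (ℚ.*-identityˡ (ℕ→ℚ (t G))) ⟩
  1ℚ ℚ.* ℕ→ℚ (t G)         ≤⟨ ℚ.*-monoʳ-≤-nonNeg (ℕ→ℚ (t G)) {{ℕ→ℚ-nonNeg (t G)}} 1≤ε ⟩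
  ε ℚ.* ℕ→ℚ (t G)          ∎)
  where open ℚ.≤-Reasoning
zero-estimate G {ε} (inj₂ t≡0) = trans (cong (λ m → ℚ.∣ 0ℚ ℚ.- ℕ→ℚ m ∣ ℚ.≤ᵇ ε ℚ.* ℕ→ℚ m) t≡0) (≤ᵇℚ-true (ℚ.≤-reflexive (sym (ℚ.*-zeroʳ ε))))

-- From seeded trees to randomized algorithms.

toAlg : ∀ {n} → Tree n ℚ → Alg n
toAlg (return x)      = output x
toAlg (ask A B C v k) = query A B C v λ b → toAlg (k b)

queries-toAlg : ∀ {n} (G : Graph n) t → queries G (toAlg t) ≡ cost G t
queries-toAlg G (return x)      = refl
queries-toAlg G (ask A B C v k) = cong suc (queries-toAlg G (k (TIS G A B C)))

prob-toAlg : ∀ {n} (G : Graph n) P t → prob G P (toAlg t) ≡ ℕ→ℚ (ind (P (run G t)))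
prob-toAlg G P (return x) with P x
... | true  = refl
... | false = refl
prob-toAlg G P (ask A B C v k) = prob-toAlg G P (k (TIS G A B C))

-- All randomness is drawn at once, as the index of a seed; the empty list gets a default, and the
-- seed spaces used are shown nonempty.
uniform : ∀ {n} {A : Set} → List A → (A → Alg n) → Alg n
uniform []       f = output 0ℚ
uniform (x ∷ xs) f = random (length xs) λ i → f (lookup (x ∷ xs) i)

queries-uniform : ∀ {n} {A : Set} (G : Graph n) (Ω : List A) f {c} → (∀ ω → queries G (f ω) ≤ c) → queries G (uniform Ω f) ≤ c
queries-uniform G []       f h = z≤n
queries-uniform G (x ∷ xs) f {c} h = go (allFin (suc (length xs)))
  where
  go : ∀ is → foldr _⊔_ 0 (map (λ i → queries G (f (lookup (x ∷ xs) i))) is) ≤ c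
  go []       = z≤n
  go (i ∷ is) = ⊔-lub (h (lookup (x ∷ xs) i)) (go is)

sumℚ : ∀ {A : Set} → (A → ℚ) → List A → ℚ
sumℚ f xs = foldr ℚ._+_ 0ℚ (map f xs)

sumFinℚ-lookup : ∀ {A : Set} (xs : List A) (f : A → ℚ) → sumFinℚ (λ i → f (lookup xs i)) ≡ sumℚ f xs
sumFinℚ-lookup xs f = cong (foldr ℚ._+_ 0ℚ) (trans (map-tabulate (λ i → i) (λ i → f (lookup xs i)))
  (trans (sym (map-tabulate (lookup xs) f)) (cong (map f) (tabulate-lookup xs))))

sumℚ-ℕ→ℚ : ∀ {A : Set} (xs : List A) {f : A → ℚ} {g : A → ℕ} → (∀ x → f x ≡ ℕ→ℚ (g x)) → sumℚ f xs ≡ ℕ→ℚ (∑ xs g)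
sumℚ-ℕ→ℚ []       h = refl
sumℚ-ℕ→ℚ (x ∷ xs) {g = g} h = trans (cong₂ ℚ._+_ (h x) (sumℚ-ℕ→ℚ xs h)) (sym (ℕ→ℚ-+ (g x) (∑ xs g)))

module _ {n : ℕ} {A : Set} (G : Graph n) (P : ℚ → Bool) (tree : A → Tree n ℚ) where

  private
    good bad : A → ℕ
    good ω = ind (P (run G (tree ω)))
    bad  ω = ind (not (P (run G (tree ω))))

  prob-uniform : ∀ Ω → 1 ≤ length Ω → ∀ m → m * ∑ Ω bad ≤ length Ω →
    (1ℚ ℚ.- prob G P (uniform Ω λ ω → toAlg (tree ω))) ℚ.* ℕ→ℚ m ℚ.≤ ℕ→ℚ 1
  prob-uniform []          ()  m few
  prob-uniform Ω′@(x ∷ xs) 1≤Ω m few = begin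
    (1ℚ ℚ.- sumFinℚ (λ i → prob G P (toAlg (tree (lookup Ω′ i)))) ℚ.* r) ℚ.* ℕ→ℚ m
      ≡⟨ cong (λ z → (1ℚ ℚ.- z ℚ.* r) ℚ.* ℕ→ℚ m) (trans (sumFinℚ-lookup Ω′ λ ω → prob G P (toAlg (tree ω))) (sumℚ-ℕ→ℚ Ω′ {g = good} λ ω → prob-toAlg G P (tree ω))) ⟩
    (1ℚ ℚ.- ℕ→ℚ (∑ Ω′ good) ℚ.* r) ℚ.* ℕ→ℚ m
      ≡⟨ cong (λ z → (z ℚ.- ℕ→ℚ (∑ Ω′ good) ℚ.* r) ℚ.* ℕ→ℚ m) (sym (trans (cong (ℚ._* r) (trans (sym (ℕ→ℚ-+ (∑ Ω′ good) (∑ Ω′ bad))) (cong ℕ→ℚ total))) (ℕ→ℚ-reciprocal (length xs)))) ⟩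
    ((ℕ→ℚ (∑ Ω′ good) ℚ.+ ℕ→ℚ (∑ Ω′ bad)) ℚ.* r ℚ.- ℕ→ℚ (∑ Ω′ good) ℚ.* r) ℚ.* ℕ→ℚ m
      ≡⟨ lem (ℕ→ℚ (∑ Ω′ good)) (ℕ→ℚ (∑ Ω′ bad)) r (ℕ→ℚ m) ⟩
    ℕ→ℚ m ℚ.* ℕ→ℚ (∑ Ω′ bad) ℚ.* r
      ≡⟨ cong (ℚ._* r) (sym (ℕ→ℚ-* m (∑ Ω′ bad))) ⟩
    ℕ→ℚ (m * ∑ Ω′ bad) ℚ.* r
      ≤⟨ ℚ.*-monoʳ-≤-nonNeg r {{ℚ.normalize-nonNeg 1 (suc (length xs))}} (ℕ→ℚ-mono few) ⟩
    ℕ→ℚ (suc (length xs)) ℚ.* r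
      ≡⟨ ℕ→ℚ-reciprocal (length xs) ⟩
    ℕ→ℚ 1 ∎
    where
    open ℚ.≤-Reasoning
    r = ℤ.+ 1 ℚ./ suc (length xs)
    open +-*-Solver using (solve; _:*_; _:+_; _:-_; _:=_)
    lem : ∀ g b r m → ((g ℚ.+ b) ℚ.* r ℚ.- g ℚ.* r) ℚ.* m ≡ m ℚ.* b ℚ.* r
    lem = solve 4 (λ g b r m → ((g :+ b) :* r :- g :* r) :* m := m :* b :* r) refl
    one : ∀ b → ind b + ind (not b) ≡ 1
    one true  = refl
    one false = refl
    total : ∑ Ω′ good + ∑ Ω′ bad ≡ suc (length xs)
    total = trans (sym (∑-+ Ω′ good bad)) (trans (∑-cong Ω′ λ ω → one (P (run G (tree ω)))) (trans (∑-const Ω′ 1) (*-identityʳ _)))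

-- The logarithm, nonempty seed spaces and the query bound.

n≤2^⌈log₂n⌉ : ∀ n → n ≤ 2 ^ ⌈log₂ n ⌉
n≤2^⌈log₂n⌉ = <-rec (λ n → n ≤ 2 ^ ⌈log₂ n ⌉) step
  where
  step : ∀ n → (∀ {m} → m < n → m ≤ 2 ^ ⌈log₂ m ⌉) → n ≤ 2 ^ ⌈log₂ n ⌉
  step zero          ih = z≤n
  step (suc zero)    ih = ≤-refl
  step n@(suc (suc m)) ih = begin
    n                                  ≡⟨ sym (⌊n/2⌋+⌈n/2⌉≡n n) ⟩
    ⌊ n /2⌋ + ⌈ n /2⌉                  ≤⟨ +-monoˡ-≤ ⌈ n /2⌉ (⌊n/2⌋≤⌈n/2⌉ n) ⟩
    ⌈ n /2⌉ + ⌈ n /2⌉                  ≤⟨ +-mono-≤ half half ⟩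
    2 ^ (ℓ ∸ 1) + 2 ^ (ℓ ∸ 1)          ≡⟨ cong (2 ^ (ℓ ∸ 1) +_) (sym (+-identityʳ _)) ⟩
    2 ^ suc (ℓ ∸ 1)                    ≡⟨ cong (2 ^_) (m+[n∸m]≡n (⌈log₂⌉-mono-≤ {2} {n} (s≤s (s≤s z≤n)))) ⟩
    2 ^ ℓ                              ∎
    where
    open ≤-Reasoning
    ℓ = ⌈log₂ n ⌉
    half : ⌈ n /2⌉ ≤ 2 ^ (ℓ ∸ 1)
    half = ≤-trans (ih (⌈n/2⌉<n m)) (≤-reflexive (cong (2 ^_) (⌈log₂⌈n/2⌉⌉≡⌈log₂n⌉∸1 n)))

sequences-nonempty : ∀ {A : Set} {xss : List (List A)} → All (λ xs → 1 ≤ length xs) xss → 1 ≤ length (sequences xss)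
sequences-nonempty []       = ≤-refl
sequences-nonempty {xss = xs ∷ xss} (h ∷ hs) =
  ≤-trans (*-mono-≤ h (sequences-nonempty hs)) (≤-reflexive (sym (length-sequences xs xss)))

replicate-all : ∀ {A : Set} {P : A → Set} k {x} → P x → All P (replicate k x)
replicate-all zero    p = []
replicate-all (suc k) p = p ∷ replicate-all k p

map-all : ∀ {A B : Set} {P : B → Set} (f : A → B) → (∀ x → P (f x)) → ∀ xs → All P (map f xs)
map-all f h []       = []
map-all f h (x ∷ xs) = h x ∷ map-all f h xs

masks-nonempty : ∀ p k → 1 ≤ length (masks p k)
masks-nonempty p k = sequences-nonempty (replicate-all k (s≤s z≤n))

space-nonempty : ∀ {d D T κ} (ℓ : Level d D T κ) k → 1 ≤ length (Level.space ℓ k)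
space-nonempty ℓ k = ≤-trans (*-mono-≤ (masks-nonempty p k) (*-mono-≤ (masks-nonempty q k) (masks-nonempty q k)))
  (≤-reflexive (sym (trans (length-cartesianProductWith _,_ (masks p k) _) (cong (length (masks p k) *_) (length-cartesianProductWith _,_ (masks q k) (masks q k))))))
  where open Level ℓ using (p; q)

m³≤m⁴ : ∀ m → 1 ≤ m → m ^ 3 ≤ m ^ 4
m³≤m⁴ m 1≤m = ^-monoʳ-≤ m {{>-nonZero 1≤m}} (n≤1+n 3)

β₃≤ : ∀ k → 1 ≤ k → Rates.β₃ k ≤ 72 * k ^ 4
β₃≤ k 1≤k = begin
  Rates.β₃ k              ≡⟨ lem₁ k ⟩
  24 * k ^ 3 + 48 * k ^ 4 ≤⟨ +-monoˡ-≤ (48 * k ^ 4) (*-monoʳ-≤ 24 (m³≤m⁴ k 1≤k)) ⟩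
  24 * k ^ 4 + 48 * k ^ 4 ≡⟨ sym (*-distribʳ-+ (k ^ 4) 24 48) ⟩
  72 * k ^ 4              ∎
  where
  open ≤-Reasoning
  lem₁ : ∀ k → let r = 2 * k * (2 * k * (2 * k * 1)) in
    r + (r + (r + 0 + 2 * k * r) + 2 * k * r) + 2 * k * r ≡ 24 * (k * (k * (k * 1))) + 48 * (k * (k * (k * (k * 1))))
  lem₁ = solve-∀

levelFactor : ℕ → ℕ
levelFactor c = 8 + 72 * (24 * c ^ 4)

opaque
  loopFactor : ℕ → ℕ
  loopFactor c = 8 * (128 * (1 + 2 * levelFactor c))

  loopFactor≡ : ∀ c → loopFactor c ≡ 8 * (128 * (1 + 2 * levelFactor c))
  loopFactor≡ c = refl

module _ (L d E c D : ℕ) (1≤L : 1 ≤ L) (1≤d : 1 ≤ d) (1≤E : 1 ≤ E) (D≤ : D ≤ c * (E * L)) where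

  private
    w : ℕ
    w = d * E ^ 4

    1≤w : 1 ≤ w
    1≤w = *-mono-≤ 1≤d (m^n>0 E {{>-nonZero 1≤E}} 4)

    L^-mono : ∀ {i j} → i ≤ j → L ^ i ≤ L ^ j
    L^-mono = ^-monoʳ-≤ L {{>-nonZero 1≤L}}

  -- One L⁴ is the price of listing a triangle, three digits times the depth of the search; the
  -- other is from D⁴.
  levelCost≤ : levelCost L d D ≤ levelFactor c * (w * L ^ 8)
  levelCost≤ = begin
    existsCost L + Rates.β₃ L * (2 * (D * D * (4 * (3 * (d * (D * D))))))
      ≡⟨ cong₂ (λ x y → x + Rates.β₃ L * y) (lem₁ L) (lem₂ d D) ⟩
    8 * L ^ 3 + Rates.β₃ L * (24 * (d * D ^ 4))
      ≤⟨ +-mono-≤ (*-monoʳ-≤ 8 (≤-trans (L^-mono {3} {8} (m≤m+n 3 5)) (≤-trans (≤-reflexive (sym (*-identityˡ (L ^ 8)))) (*-monoˡ-≤ (L ^ 8) 1≤w))))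
                  (*-mono-≤ (β₃≤ L 1≤L) (*-monoʳ-≤ 24 (*-monoʳ-≤ d (^-monoˡ-≤ 4 D≤)))) ⟩
    8 * (w * L ^ 8) + 72 * L ^ 4 * (24 * (d * (c * (E * L)) ^ 4))
      ≡⟨ cong (8 * (w * L ^ 8) +_) (trans (cong (λ z → 72 * L ^ 4 * (24 * (d * z))) (trans (^-distribʳ-* c (E * L) 4) (cong (c ^ 4 *_) (^-distribʳ-* E L 4))))
           (trans (lem₃ 72 24 (L ^ 4) d (c ^ 4) (E ^ 4)) (cong (λ z → 72 * (24 * c ^ 4) * (w * z)) (sym (^-distribˡ-+-* L 4 4))))) ⟩
    8 * (w * L ^ 8) + 72 * (24 * c ^ 4) * (w * L ^ 8)
      ≡⟨ sym (*-distribʳ-+ (w * L ^ 8) 8 (72 * (24 * c ^ 4))) ⟩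
    levelFactor c * (w * L ^ 8) ∎
    where
    open ≤-Reasoning
    lem₁ : ∀ k → 2 * k * (2 * k * (2 * k * 1)) ≡ 8 * (k * (k * (k * 1)))
    lem₁ = solve-∀
    lem₂ : ∀ d D → 2 * (D * D * (4 * (3 * (d * (D * D))))) ≡ 24 * (d * (D * (D * (D * (D * 1)))))
    lem₂ = solve-∀
    lem₃ : ∀ a b l d c e → a * l * (b * (d * (c * (e * l)))) ≡ a * (b * c) * (d * e * (l * l))
    lem₃ = solve-∀

  private
    suc≤double : suc L ≤ 2 * L
    suc≤double = ≤-trans (+-monoˡ-≤ L 1≤L) (≤-reflexive (cong (L +_) (sym (+-identityʳ L))))

    lf = levelFactor c

  budget≤ : budget L d D ≤ 128 * ((1 + 2 * lf) * (w * L ^ 9))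
  budget≤ = *-monoʳ-≤ 128 (begin
    1 + suc L * levelCost L d D
      ≤⟨ +-mono-≤ (*-mono-≤ 1≤w (m^n>0 L {{>-nonZero 1≤L}} 9)) (*-mono-≤ suc≤double levelCost≤) ⟩
    w * L ^ 9 + 2 * L * (lf * (w * L ^ 8))
      ≡⟨ cong (w * L ^ 9 +_) (lem L lf w (L ^ 8)) ⟩
    w * L ^ 9 + 2 * lf * (w * L ^ 9)
      ≡⟨⟩
    (1 + 2 * lf) * (w * L ^ 9) ∎)
    where
    open ≤-Reasoning
    lem : ∀ l f w x → 2 * l * (f * (w * x)) ≡ 2 * f * (w * (l * x))
    lem = solve-∀

  -- On top of L⁹ in the budget, the votes and the guesses contribute a factor L each; d L^11 is
  -- then relaxed to d² L^18.
  loopCost≤ : suc (3 * L) * (2 * L * budget L d D) ≤ loopFactor c * (d ^ 2 * L ^ 18 * E ^ 4)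
  loopCost≤ = begin
    suc (3 * L) * (2 * L * budget L d D)
      ≤⟨ *-mono-≤ (+-monoˡ-≤ (3 * L) 1≤L) (*-monoʳ-≤ (2 * L) budget≤) ⟩
    4 * L * (2 * L * (128 * ((1 + 2 * lf) * (w * L ^ 9))))
      ≡⟨ lem₁ L 128 (1 + 2 * lf) d (E ^ 4) (L ^ 9) ⟩
    8 * (128 * (1 + 2 * lf)) * (d * L ^ 11 * E ^ 4)
      ≤⟨ *-monoʳ-≤ (8 * (128 * (1 + 2 * lf))) (*-monoˡ-≤ (E ^ 4) (*-mono-≤ d≤d² (L^-mono {11} {18} (m≤m+n 11 7)))) ⟩
    8 * (128 * (1 + 2 * lf)) * (d ^ 2 * L ^ 18 * E ^ 4)
      ≡⟨ cong (_* (d ^ 2 * L ^ 18 * E ^ 4)) (sym (loopFactor≡ c)) ⟩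
    loopFactor c * (d ^ 2 * L ^ 18 * E ^ 4) ∎
    where
    open ≤-Reasoning
    d≤d² : d ≤ d ^ 2
    d≤d² = ≤-trans (≤-reflexive (sym (*-identityʳ d))) (*-monoʳ-≤ d (≤-trans 1≤d (≤-reflexive (sym (*-identityʳ d)))))
    lem₁ : ∀ l a b d e x → 4 * l * (2 * l * (a * (b * (d * e * x)))) ≡ 8 * (a * b) * (d * (l * (l * x)) * e)
    lem₁ = solve-∀

square-mono : ∀ {x y} → 0ℚ ℚ.≤ x → x ℚ.≤ y → x ℚ.* x ℚ.≤ y ℚ.* y
square-mono {x} {y} 0≤x x≤y = ℚ.≤-trans (ℚ.*-monoˡ-≤-nonNeg x {{ℚ.nonNegative 0≤x}} x≤y)
  (ℚ.*-monoʳ-≤-nonNeg y {{ℚ.nonNegative (ℚ.≤-trans 0≤x x≤y)}} x≤y)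

-- The factor 16 is the bound on (Eε)⁴.
scale-queries : ∀ {ε} E {k} b → 0ℚ ℚ.< ε → ℕ→ℚ E ℚ.* ε ℚ.≤ ℕ→ℚ 2 → k ≤ b * E ^ 4 →
  ℕ→ℚ k ℚ.* (ε ℚ.* ε ℚ.* ε ℚ.* ε) ℚ.≤ ℕ→ℚ (b * 16)
scale-queries {ε} E {k} b 0<ε Eε≤2 k≤ = begin
  ℕ→ℚ k ℚ.* (ε ℚ.* ε ℚ.* ε ℚ.* ε)
    ≡⟨ cong (ℕ→ℚ k ℚ.*_) (regroup ε) ⟩
  ℕ→ℚ k ℚ.* (ε ℚ.* ε ℚ.* (ε ℚ.* ε))
    ≤⟨ ℚ.*-monoʳ-≤-nonNeg (ε ℚ.* ε ℚ.* (ε ℚ.* ε)) {{ℚ.nonNegative (square-mono ℚ.≤-refl (square-mono ℚ.≤-refl 0≤ε))}} (ℕ→ℚ-mono k≤) ⟩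
  ℕ→ℚ (b * E ^ 4) ℚ.* (ε ℚ.* ε ℚ.* (ε ℚ.* ε))
    ≡⟨ trans (cong (ℚ._* (ε ℚ.* ε ℚ.* (ε ℚ.* ε))) power) (lem (ℕ→ℚ b) (ℕ→ℚ E) ε) ⟩
  ℕ→ℚ b ℚ.* (x ℚ.* x ℚ.* (x ℚ.* x))
    ≤⟨ ℚ.*-monoˡ-≤-nonNeg (ℕ→ℚ b) {{ℕ→ℚ-nonNeg b}} (square-mono (square-mono ℚ.≤-refl 0≤x) (square-mono 0≤x Eε≤2)) ⟩
  ℕ→ℚ b ℚ.* ℕ→ℚ 16
    ≡⟨ sym (ℕ→ℚ-* b 16) ⟩
  ℕ→ℚ (b * 16) ∎
  where
  open ℚ.≤-Reasoning
  x = ℕ→ℚ E ℚ.* ε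
  0≤ε : 0ℚ ℚ.≤ ε
  0≤ε = ℚ.<⇒≤ 0<ε
  0≤x : 0ℚ ℚ.≤ x
  0≤x = ℚ.≤-trans (ℚ.≤-reflexive (sym (ℚ.*-zeroʳ (ℕ→ℚ E)))) (ℚ.*-monoˡ-≤-nonNeg (ℕ→ℚ E) {{ℕ→ℚ-nonNeg E}} 0≤ε)
  open +-*-Solver using (solve; _:*_; _:=_)
  regroup : ∀ ε → ε ℚ.* ε ℚ.* ε ℚ.* ε ≡ ε ℚ.* ε ℚ.* (ε ℚ.* ε)
  regroup ε = ℚ.*-assoc (ε ℚ.* ε) ε ε
  lem : ∀ b e ε → b ℚ.* (e ℚ.* e ℚ.* (e ℚ.* e)) ℚ.* (ε ℚ.* ε ℚ.* (ε ℚ.* ε)) ≡ b ℚ.* (e ℚ.* ε ℚ.* (e ℚ.* ε) ℚ.* (e ℚ.* ε ℚ.* (e ℚ.* ε)))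
  lem = solve 3 (λ b e ε → b :* (e :* e :* (e :* e)) :* (ε :* ε :* (ε :* ε)) := b :* (e :* ε :* (e :* ε) :* (e :* ε :* (e :* ε)))) refl
  fourth : E ^ 4 ≡ E * E * (E * E)
  fourth = fourth′ E
    where
    fourth′ : ∀ e → e * (e * (e * (e * 1))) ≡ e * e * (e * e)
    fourth′ = solve-∀
  power : ℕ→ℚ (b * E ^ 4) ≡ ℕ→ℚ b ℚ.* (ℕ→ℚ E ℚ.* ℕ→ℚ E ℚ.* (ℕ→ℚ E ℚ.* ℕ→ℚ E))
  power = trans (ℕ→ℚ-* b (E ^ 4)) (cong (ℕ→ℚ b ℚ.*_) (trans (cong ℕ→ℚ fourth) (trans (ℕ→ℚ-* (E * E) (E * E)) (cong₂ ℚ._*_ (ℕ→ℚ-* E E) (ℕ→ℚ-* E E)))))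

-- Absorbs the number of guesses in the union bound.
linear≤4^ : ∀ k → suc (3 * k) ≤ 4 ^ k
linear≤4^ zero    = ≤-refl
linear≤4^ (suc k) = begin
  suc (3 * suc k)           ≡⟨ lem k ⟩
  suc (3 * k) + 3           ≤⟨ +-mono-≤ (linear≤4^ k) (≤-trans (≤-reflexive (sym (*-identityʳ 3))) (*-monoʳ-≤ 3 (m^n>0 4 k))) ⟩
  4 ^ k + 3 * 4 ^ k         ≡⟨⟩
  4 ^ suc k                 ∎
  where
  open ≤-Reasoning
  lem : ∀ k → suc (3 * suc k) ≡ suc (3 * k) + 3
  lem = solve-∀

opaque
  accuracyFactor : ℕ
  accuracyFactor = 9 * (64 * (12 * 2))

  sharpness : ℕ → ℕ → ℕ
  sharpness F L = 9 * (64 * (F * suc L))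

  sharpness≡ : ∀ F L → sharpness F L ≡ 9 * (64 * (F * suc L))
  sharpness≡ F L = refl

  sharpness≤ : ∀ E L → 1 ≤ L → sharpness (12 * E) L ≤ accuracyFactor * (E * L)
  sharpness≤ E L 1≤L = begin
    9 * (64 * (12 * E * suc L))   ≤⟨ *-monoʳ-≤ 9 (*-monoʳ-≤ 64 (*-monoʳ-≤ (12 * E) (≤-trans (+-monoˡ-≤ L 1≤L) (≤-reflexive (cong (L +_) (sym (+-identityʳ L))))))) ⟩
    9 * (64 * (12 * E * (2 * L))) ≡⟨ lem 9 64 12 2 E L ⟩
    9 * (64 * (12 * 2)) * (E * L) ∎
    where
    open ≤-Reasoning
    lem : ∀ a b c d e l → a * (b * (c * e * (d * l))) ≡ a * (b * (c * d)) * (e * l)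
    lem = solve-∀

-- Assembly of the algorithm.

queryFactor : ℕ
queryFactor = loopFactor accuracyFactor * 16

Guarantee : (C₁ C₂ : ℕ) (ε : ℚ) (n d : ℕ) → Alg n → Graph n → Set
Guarantee C₁ C₂ ε n d 𝒜 G =
  (ℕ→ℚ (queries G 𝒜) ℚ.* (ε ℚ.* ε ℚ.* ε ℚ.* ε) ℚ.≤ ℕ→ℚ (C₁ * (d ^ 2) * (logn n ^ 18)))
  × ((1ℚ ℚ.- prob G (goodEstimate ε G) 𝒜) ℚ.* ℕ→ℚ (n * n) ℚ.≤ ℕ→ℚ C₂)

module Main (n d : ℕ) (64≤n : 64 ≤ n) (1≤d : 1 ≤ d) {ε : ℚ} (0<ε : 0ℚ ℚ.< ε) (ε-precision : Precision ε) where

  open Precision ε-precision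

  L m F D : ℕ
  L = logn n
  -- Since S ≤ 8^L < 2^m, the invariant holds at the first guess, 2^(3L).
  m = suc (3 * L)
  F = 12 * E
  D = sharpness F L

  1≤L : 1 ≤ L
  1≤L = ⌈log₂⌉-mono-≤ {2} {n} (≤-trans (m≤m+n 2 62) 64≤n)

  n≤ : n ≤ 2 ^ L
  n≤ = n≤2^⌈log₂n⌉ n

  open Loop n L d E F D 1≤d 1≤E refl (sharpness≡ F L)

  tree : List (List (List Seed)) → Tree n ℚ
  tree ωs = loop m ωs >>= λ X → return (ℕ→ℚ X ℚ.* 1/6)

  algorithm : Alg n
  algorithm = uniform (loopSpace m) λ ωs → toAlg (tree ωs)

  queries≤ : ∀ G → ℕ→ℚ (queries G algorithm) ℚ.* (ε ℚ.* ε ℚ.* ε ℚ.* ε) ℚ.≤ ℕ→ℚ (queryFactor * (d ^ 2) * (L ^ 18))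
  queries≤ G = ℚ.≤-trans
    (scale-queries E (K * (d ^ 2 * L ^ 18)) 0<ε Eε≤2 (≤-trans (queries-uniform G (loopSpace m) (λ ωs → toAlg (tree ωs)) cost≤)
      (≤-trans (loopCost≤ L d E accuracyFactor D 1≤L 1≤d 1≤E (sharpness≤ E L 1≤L)) (≤-reflexive (sym (*-assoc K (d ^ 2 * L ^ 18) (E ^ 4)))))))
    (ℚ.≤-reflexive (cong ℕ→ℚ (lem K (d ^ 2) (L ^ 18) 16)))
    where
    K = loopFactor accuracyFactor
    lem : ∀ k a b c → k * (a * b) * c ≡ k * c * a * b
    lem = solve-∀
    cost≤ : ∀ ωs → queries G (toAlg (tree ωs)) ≤ m * (2 * L * budget L d D)
    cost≤ ωs = ≤-trans (≤-reflexive (trans (queries-toAlg G (tree ωs)) (trans (cost->>= G (loop m ωs) _) (+-identityʳ _)))) (cost-loop G m ωs)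

  loopSpace-nonempty : ∀ k → 1 ≤ length (loopSpace k)
  loopSpace-nonempty zero    = ≤-refl
  loopSpace-nonempty (suc k) = ≤-trans (*-mono-≤ Ω′-nonempty (loopSpace-nonempty k))
    (≤-reflexive (sym (length-cartesianProductWith _∷_ (Vote.Ω′ k) (loopSpace k))))
    where
    Ω′-nonempty : 1 ≤ length (Vote.Ω′ k)
    Ω′-nonempty = sequences-nonempty (replicate-all (2 * L) (sequences-nonempty
      (map-all (λ ℓ → Level.space ℓ (length (allFin n))) (λ ℓ → space-nonempty ℓ (length (allFin n))) (Guess.schedule k L))))

  module _ (G : Graph n) (ΔE≤d : ΔE≤ G d) where

    private
      deg≤ : ∀ a → (∑ (allFin n) λ b → ∑ (allFin n) λ c → tri G a b c) ≤ 4 ^ L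
      deg≤ a = ≤-trans (∑³-cube (tri G) (2 ^ L) (λ a b c → ind≤1 (isTri G a b c)) n≤ a) (≤-reflexive (sym (4^≡2^² L)))

    open Correct G n≤ (row-degree G ΔE≤d , column-degree G ΔE≤d) deg≤

    S<2^m : S < 2 ^ m
    S<2^m = begin-strict
      S                    ≤⟨ ∑-allFin-≤ (λ a → ∑ (allFin n) λ b → ∑ (allFin n) λ c → tri G a b c) deg≤ n≤ ⟩
      2 ^ L * 4 ^ L        ≡⟨ sym (^-distribʳ-* 2 4 L) ⟩
      8 ^ L                ≡⟨ ^-*-assoc 2 3 L ⟩
      2 ^ (3 * L)          <⟨ ^-monoʳ-< 2 (s≤s (s≤s z≤n)) (n<1+n (3 * L)) ⟩
      2 ^ suc (3 * L)      ∎
      where open ≤-Reasoning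

    wrong : List (List (List Seed)) → ℕ
    wrong ωs = ind (not (goodEstimate ε G (run G (tree ωs))))

    wrong≤ : ∀ ωs → wrong ωs ≤ ind (failed (run G (loop m ωs)))
    wrong≤ ωs = subst (λ x → ind (not (goodEstimate ε G x)) ≤ ind (failed X)) (sym (run->>= G (loop m ωs) _)) (cases (E * ∣ X - S ∣ ≤? S))
      where
      X = run G (loop m ωs)
      cases : Dec (E * ∣ X - S ∣ ≤ S) → ind (not (goodEstimate ε G (ℕ→ℚ X ℚ.* 1/6))) ≤ ind (failed X)
      cases (yes near) = subst (λ b → ind (not b) ≤ ind (failed X))
        (sym (scaled-estimate G {ε} {E} {X} 0<ε 1≤Eε (subst (λ s → E * ∣ X - s ∣ ≤ s) (ordered-triangles G) near))) z≤n
      cases (no far) = ≤-trans (ind≤1 (not (goodEstimate ε G (ℕ→ℚ X ℚ.* 1/6)))) (≤-reflexive (sym (cong ind (<ᵇ-true (≰⇒> far)))))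

    -- Of the factor 16^L = 4^L * 4^L, one half pays for n² ≤ 4^L and the other for the number of
    -- guesses.
    few-wrong : n * n * ∑ (loopSpace m) wrong ≤ length (loopSpace m)
    few-wrong = *-cancelˡ-≤ (4 ^ L) {{m^n≢0 4 L}} (begin
      4 ^ L * (n * n * I)
        ≤⟨ *-monoʳ-≤ (4 ^ L) (*-mono-≤ (≤-trans (*-mono-≤ n≤ n≤) (≤-reflexive (sym (4^≡2^² L)))) (∑-mono (loopSpace m) wrong≤)) ⟩
      4 ^ L * (4 ^ L * J)
        ≡⟨ trans (sym (*-assoc (4 ^ L) (4 ^ L) J)) (cong (_* J) (sym (^-distribʳ-* 4 4 L))) ⟩
      16 ^ L * J
        ≤⟨ ∑-failed m S<2^m ⟩
      m * length (loopSpace m)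
        ≤⟨ *-monoˡ-≤ (length (loopSpace m)) (linear≤4^ L) ⟩
      4 ^ L * length (loopSpace m) ∎)
      where
      open ≤-Reasoning
      I = ∑ (loopSpace m) wrong
      J = ∑ (loopSpace m) λ ωs → ind (failed (run G (loop m ωs)))

    failure≤ : (1ℚ ℚ.- prob G (goodEstimate ε G) algorithm) ℚ.* ℕ→ℚ (n * n) ℚ.≤ ℕ→ℚ 1
    failure≤ = prob-uniform G (goodEstimate ε G) tree (loopSpace m) (loopSpace-nonempty m) (n * n) few-wrong

  guarantee : ∀ G → ΔE≤ G d → Guarantee queryFactor 1 ε n d algorithm G
  guarantee G ΔE≤d = queries≤ G , failure≤ G ΔE≤d

zero-guarantee : ∀ C₁ C₂ {ε n} d (G : Graph n) → goodEstimate ε G 0ℚ ≡ true → Guarantee C₁ C₂ ε n d (output 0ℚ) G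
zero-guarantee C₁ C₂ {ε} {n} d G good =
  ℚ.≤-trans (ℚ.≤-reflexive (ℚ.*-zeroˡ (ε ℚ.* ε ℚ.* ε ℚ.* ε))) (ℕ→ℚ-mono {0} {C₁ * (d ^ 2) * (logn n ^ 18)} z≤n) ,
  ℚ.≤-trans (ℚ.≤-reflexive (trans (cong (λ b → (1ℚ ℚ.- (if b then 1ℚ else 0ℚ)) ℚ.* ℕ→ℚ (n * n)) good) (ℚ.*-zeroˡ (ℕ→ℚ (n * n))))) (ℕ→ℚ-mono {0} {C₂} z≤n)

no-triangles : ∀ {n} (G : Graph n) → ΔE≤ G 0 → t G ≡ 0
no-triangles {n} G ΔE≤0 = n≤0⇒n≡0 (≤-trans (≤-trans (m≤n*m (t G) 6) (≤-reflexive (sym (ordered-triangles G))))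
  (≤-trans (∑-mono (allFin n) λ a → ∑-mono (allFin n) λ b → row-degree G ΔE≤0 a b)
  (≤-reflexive (trans (∑-cong (allFin n) λ _ → ∑-zero (allFin n)) (∑-zero (allFin n))))))

Solution : ℚ → ℕ → ℕ → Set
Solution ε n d = Σ (Alg n) λ 𝒜 → ∀ G → ΔE≤ G d → Guarantee queryFactor 1 ε n d 𝒜 G

zero-solution : ∀ ε n d → (∀ (G : Graph n) → ΔE≤ G d → 1ℚ ℚ.≤ ε ⊎ t G ≡ 0) → Solution ε n d
zero-solution ε n d h = output 0ℚ , λ G ΔE≤d → zero-guarantee queryFactor 1 {ε} {n} d G (zero-estimate G {ε} (h G ΔE≤d))

main-solution : ∀ ε n d → 64 ≤ n → 1 ≤ d → 0ℚ ℚ.< ε → Precision ε → Solution ε n d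
main-solution ε n d 64≤n 1≤d 0<ε ε-precision = Main.algorithm n d 64≤n 1≤d 0<ε ε-precision , Main.guarantee n d 64≤n 1≤d 0<ε ε-precision

-- Sampling is set up for d ≥ 1 and ε < 1. If ε ≥ 1, or if d = 0 and so no triangle exists, the
-- constant answer 0 is good without any query.
solution : ∀ ε n d → 64 ≤ n → 0ℚ ℚ.< ε → Dec (1 ≤ d) → Dec (ε ℚ.< 1ℚ) → Solution ε n d
solution ε n d 64≤n 0<ε (yes 1≤d) (yes ε<1) = main-solution ε n d 64≤n 1≤d 0<ε (precision ε 0<ε ε<1)
solution ε n d 64≤n 0<ε (yes _)   (no ε≮1)  = zero-solution ε n d λ _ _ → inj₁ (ℚ.≮⇒≥ ε≮1)
solution ε n d 64≤n 0<ε (no d≮1)  _         = zero-solution ε n d λ G ΔE≤d →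
  inj₂ (no-triangles G (subst (ΔE≤ G) (n<1⇒n≡0 (≰⇒> d≮1)) ΔE≤d))

theorem1 : Σ ℕ λ C₁ → Σ ℕ λ C₂ →
    (ε : ℚ) → 0ℚ ℚ.< ε → (n d : ℕ) → 64 ≤ n →
    Σ (Alg n) λ 𝒜 → (G : Graph n) → ΔE≤ G d →
    (ℕ→ℚ (queries G 𝒜) ℚ.* (ε ℚ.* ε ℚ.* ε ℚ.* ε)
    ℚ.≤ ℕ→ℚ (C₁ * (d ^ 2) * (logn n ^ 18)))
    × ((1ℚ ℚ.- prob G (goodEstimate ε G) 𝒜) ℚ.* ℕ→ℚ (n * n) ℚ.≤ ℕ→ℚ C₂)
theorem1 = queryFactor , 1 , λ ε 0<ε n d 64≤n → solution ε n d 64≤n 0<ε (1 ≤? d) (ε ℚ.<? 1ℚ)
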